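{- For all $n\ge0$, $$\sum_{\sigma\in\mathfrak S_n}q^{\mathrm{aid}(\sigma)}t^{\mathrm{des}(\sigma)}=\sum_{\sigma\in\mathfrak S_n}q^{\mathrm{maj}(\sigma)}t^{\mathrm{exc}(\sigma)}.$$
   Context: For $\sigma=\sigma_1\cdots\sigma_n\in\mathfrak S_n$: $\mathrm{Des}(\sigma)=\{i\in[n-1]:\sigma_i>\sigma_{i+1}\}$, $\mathrm{des}(\sigma)=|\mathrm{Des}(\sigma)|$, $\mathrm{maj}(\sigma)=\sum_{i\in\mathrm{Des}(\sigma)}i$, $\mathrm{exc}(\sigma)=|\{i:\sigma_i>i\}|$. An inversion of $\sigma$ is a pair $(\sigma_i,\sigma_j)$ with $i<j$, $\sigma_i>\sigma_j$; it is admissible if either ($i>1$ and $\sigma_{i-1}<\sigma_i$) or there is $k$ with $i<k<j$ and $\sigma_i<\sigma_k$. $\mathrm{ai}(\sigma)$ is the number of admissible inversions and $\mathrm{aid}(\sigma)=\mathrm{ai}(\sigma)+\mathrm{des}(\sigma)$. -}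

module Defs where

open import Algebra.Bundles using (CommutativeRing)
open import Data.Fin.Base using (Fin; zero; suc; punchIn; toℕ; _<_; _>_)
open import Data.Fin.Patterns using (0F)
open import Data.Fin.Permutation
  using (Permutation′; _⟨$⟩ʳ_; _≈_; id; insert; remove; insert-remove; insert-punchIn)
open import Data.Fin.Properties using (_<?_; any?; _≟_; punchIn-injective)
open import Data.List.Base
  using (List; []; _∷_; map; concatMap; filter; foldr; length; allFin; cartesianProduct)
open import Data.List.Membership.Propositional using (lose)
open import Data.List.Membership.Propositional.Properties using (∈-allFin)
open import Data.List.Relation.Unary.All as All using (All; []; _∷_)
import Data.List.Relation.Unary.All.Properties as All
open import Data.List.Relation.Unary.AllPairs as AllPairs using (AllPairs; []; _∷_)
import Data.List.Relation.Unary.AllPairs.Properties as AllPairs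
open import Data.List.Relation.Unary.Any as Any using (Any; here)
import Data.List.Relation.Unary.Any.Properties as Any
open import Data.List.Relation.Unary.Unique.Propositional.Properties using (allFin⁺)
open import Data.Nat.Base as ℕ using (ℕ; zero; suc)
open import Data.Nat.ListAction using (sum)
import Data.Nat.Properties as ℕ
open import Data.Product.Base using (_×_; _,_; ∃-syntax)
open import Data.Sum.Base using (_⊎_)
open import Function.Base using (_∘_)
open import Relation.Binary.PropositionalEquality using (_≡_; refl; sym; trans; cong)
open import Relation.Nullary using (¬_; Dec; yes; no)
open import Relation.Nullary.Decidable using (_×-dec_; _⊎-dec_)

-- A permutation σ of [n] is a bijection of Fin n, so positions and values are
-- both shifted down by one: the letter σᵢ is suc (toℕ (σ ⟨$⟩ʳ i′)), where
-- toℕ i′ = i - 1.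

-- Next i j says that j is the position immediately after i; the last position
-- has no successor, and so is never a descent.
Next : ∀ {n} → Fin n → Fin n → Set
Next i j = toℕ j ≡ suc (toℕ i)

next? : ∀ {n} (i j : Fin n) → Dec (Next i j)
next? i j = toℕ j ℕ.≟ suc (toℕ i)

module _ {n : ℕ} (σ : Permutation′ n) where

  IsDescent : Fin n → Set
  IsDescent i = ∃[ j ] Next i j × σ ⟨$⟩ʳ i > σ ⟨$⟩ʳ j

  isDescent? : ∀ i → Dec (IsDescent i)
  isDescent? i = any? λ j → next? i j ×-dec (σ ⟨$⟩ʳ j <? σ ⟨$⟩ʳ i)

  Des : List (Fin n)
  Des = filter isDescent? (allFin n)

  des : ℕ
  des = length Des

  -- suc ∘ toℕ recovers the 1-based position.
  maj : ℕ
  maj = sum (map (suc ∘ toℕ) Des)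

  exc : ℕ
  exc = length (filter (λ i → i <? σ ⟨$⟩ʳ i) (allFin n))

  -- An inversion (σᵢ , σⱼ) is recorded by its pair of positions (i , j), which
  -- determines it since σ is injective.
  IsInversion : Fin n × Fin n → Set
  IsInversion (i , j) = i < j × σ ⟨$⟩ʳ i > σ ⟨$⟩ʳ j

  -- Positions h with Next h i exist exactly when i is not the first position.
  IsAdmissible : Fin n × Fin n → Set
  IsAdmissible (i , j) =
      (∃[ h ] Next h i × σ ⟨$⟩ʳ h < σ ⟨$⟩ʳ i)
    ⊎ (∃[ k ] i < k × k < j × σ ⟨$⟩ʳ i < σ ⟨$⟩ʳ k)

  isInversion? : ∀ p → Dec (IsInversion p)
  isInversion? (i , j) = (i <? j) ×-dec (σ ⟨$⟩ʳ j <? σ ⟨$⟩ʳ i)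

  isAdmissible? : ∀ p → Dec (IsAdmissible p)
  isAdmissible? (i , j) =
            any? (λ h → next? h i ×-dec (σ ⟨$⟩ʳ h <? σ ⟨$⟩ʳ i))
    ⊎-dec any? (λ k → (i <? k) ×-dec (k <? j) ×-dec (σ ⟨$⟩ʳ i <? σ ⟨$⟩ʳ k))

  ai : ℕ
  ai = length (filter (λ p → isInversion? p ×-dec isAdmissible? p)
                      (cartesianProduct (allFin n) (allFin n)))

  aid : ℕ
  aid = ai ℕ.+ des

-- 𝔖 n lists the symmetric group: choose the first letter j, then a permutation
-- of the remaining letters. By 𝔖-complete and 𝔖-unique every permutation occurs
-- exactly once, up to pointwise equality (the library's equality on
-- permutations, on which all the statistics above depend).
𝔖 : ∀ n → List (Permutation′ n)
𝔖 zero    = id ∷ []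
𝔖 (suc n) = concatMap (λ j → map (insert zero j) (𝔖 n)) (allFin (suc n))

insert-congʳ : ∀ {n} (j : Fin (suc n)) {π ρ : Permutation′ n} →
               π ≈ ρ → insert 0F j π ≈ insert 0F j ρ
insert-congʳ j π≈ρ k with 0F ≟ k
... | yes _ = refl
... | no  _ = cong (punchIn j) (π≈ρ _)

𝔖-complete : ∀ n (σ : Permutation′ n) → Any (σ ≈_) (𝔖 n)
𝔖-complete zero    σ = here λ ()
𝔖-complete (suc n) σ = Any.concat⁺ (Any.map⁺ (lose (∈-allFin (σ ⟨$⟩ʳ 0F))
  (Any.map⁺ (Any.map
    (λ {ρ} rem≈ρ k → trans (sym (insert-remove 0F σ k))
      (insert-congʳ (σ ⟨$⟩ʳ 0F) {remove 0F σ} {ρ} rem≈ρ k))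
    (𝔖-complete n (remove 0F σ))))))

𝔖-unique : ∀ n → AllPairs (λ σ τ → ¬ σ ≈ τ) (𝔖 n)
𝔖-unique zero    = [] ∷ []
𝔖-unique (suc n) = AllPairs.concat⁺
  (All.map⁺ (All.universal
    (λ j → AllPairs.map⁺ (AllPairs.map (λ {π} {ρ} → same j {π} {ρ}) (𝔖-unique n))) _))
  (AllPairs.map⁺ (AllPairs.map
    (λ j≢l → All.map⁺ (All.universal
      (λ π → All.map⁺ (All.universal (λ ρ eq → j≢l (eq 0F)) _)) _))
    (allFin⁺ (suc n))))
  where
  same : ∀ j {π ρ : Permutation′ n} → ¬ π ≈ ρ → ¬ insert 0F j π ≈ insert 0F j ρ
  same j {π} {ρ} π≉ρ eq = π≉ρ λ k → punchIn-injective j _ _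
    (trans (sym (insert-punchIn 0F j π k))
      (trans (eq (suc k)) (insert-punchIn 0F j ρ k)))

module SumOver {c ℓ} (R : CommutativeRing c ℓ) where
  open CommutativeRing R using (Carrier; _+_; 0#; semiring)
  open import Algebra.Properties.Semiring.Exp semiring public using (_^_)

  ∑𝔖 : ∀ n → (Permutation′ n → Carrier) → Carrier
  ∑𝔖 n f = foldr _+_ 0# (map f (𝔖 n))

{-# OPTIONS --safe #-}
-- Put s = q t, let A n and M n be the two sides, and multiply sequences by the
-- q-binomial convolution ⋆. Let W n = q^C(n,2) (-s)ⁿ and
-- P n = q^C(n,2) (-1)ⁿ (1 + s + ⋯ + sⁿ).
--
-- Removing the largest letter of a word turns the left-hand side into a Riccati
-- equation for A, which P linearises: P ⋆ A = W.
--
-- On the other side, bar the letters at excedances and order all barred letters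
-- before all unbarred ones. Then maj - exc is the sum of the positions i of the
-- descents of the barred word (Shareshian and Wachs). The factor of a position i
-- in q^(maj - exc) is q^i + (1 - q^i) [no descent at i]; expanding the product
-- cuts the word into blocks that increase in the order of barred words. As
-- letters of an increasing run grow at least as fast as their positions, a block
-- with letters V in positions m + 1, …, m + l contributes
-- ∏_{v ∈ V} ([v ≤ m + l] + s [v > m + 1]), so that the arrangements with
-- prescribed block sizes are counted by a coefficient of a product of linear
-- forms, one form for each letter. Let K be the sequence obtained by replacing
-- [v > m + 1] by [v > m]. Comparing the linear forms gives M = W ⋆ K, and a
-- telescoping product of linear forms gives P ⋆ K = δ. Therefore
-- A = K ⋆ P ⋆ A = K ⋆ W = M.
module Submission where

open import Algebra.Bundles using (CommutativeRing)
open import Algebra.Solver.Ring.AlmostCommutativeRing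
  using (_-Raw-AlmostCommutative⟶_; fromCommutativeRing)
open import Data.Bool.Base using (Bool; true; false; _∧_; _∨_; T; not)
open import Data.Bool.Properties using (∨-zeroʳ; ∨-identityʳ; ∨-assoc; ∧-comm)
open import Data.Empty using (⊥-elim)
open import Data.Fin.Base using (Fin; zero; suc; punchIn; toℕ)
open import Data.Fin.Permutation using (Permutation′; _⟨$⟩ʳ_; insert; insert-punchIn)
import Data.Fin.Properties as Fin
open import Data.Integer.Base as ℤ using (ℤ; +_; -[1+_]; _⊖_)
import Data.Integer.Properties as ℤ
open import Data.List.Base
  using (List; []; _∷_; _++_; _∷ʳ_; map; concatMap; foldr; length; reverse; tabulate; allFin;
    applyDownFrom; replicate; _ʳ++_; filter; applyUpTo; cartesianProduct)
import Data.List.Properties as List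
open import Data.List.Relation.Binary.Permutation.Propositional
  using (_↭_; ↭-refl; prep; swap; ↭-sym)
open import Data.List.Relation.Binary.Permutation.Propositional.Properties as ↭
  using (↭-length; All-resp-↭; ↭-reverse)
open import Data.List.Relation.Binary.Sublist.Propositional
  using (_⊆_; []; _∷_; ⊆-refl) renaming (_∷ʳ_ to skip)
open import Data.List.Relation.Binary.Sublist.Propositional.Properties using (All-resp-⊆)
open import Data.List.Relation.Unary.All as All using (All; []; _∷_)
import Data.List.Relation.Unary.All.Properties as All
open import Data.List.Relation.Unary.AllPairs using (AllPairs; []; _∷_)
import Data.List.Relation.Unary.AllPairs.Properties as AllPairs
open import Data.Maybe.Base using (Maybe; just; nothing)
open import Data.Nat.Base as ℕ using (ℕ; zero; suc; z≤n; s≤s; _<ᵇ_; _≡ᵇ_)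
open import Data.Nat.ListAction using (sum)
open import Data.Nat.ListAction.Properties using (sum-↭)
import Data.Nat.Properties as ℕ
open import Data.Nat.Solver using (module +-*-Solver)
open import Data.Product.Base using (_×_; _,_)
open import Data.Unit.Base using (tt)
open import Defs
open import Function.Base using (_∘_)
open import Function.Bundles using (module Injection)
open import Function.Definitions using (Injective)
open import Function.Properties.Inverse using (Inverse⇒Injection)
open import Relation.Binary.PropositionalEquality as ≡ using (_≡_)
open import Relation.Nullary using (¬_; yes; no; does)
open import Relation.Nullary.Decidable using (_×-dec_)
open import Relation.Unary using (Pred; Decidable)

-- As Eulerian generating functions both sides equal W / P, which is the classical quotient (1 - s)
-- e(z) / (e(sz) - s e(z)) for the q-exponential e(z) = ∑ zⁿ / (q;q)ₙ, after cancelling e(z) e(sz)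
-- and dividing out 1 - s. In an arbitrary commutative ring neither 1 - s nor (q;q)ₙ is invertible.
-- Hence the explicit sums 1 + s + ⋯ + sⁿ in P, and an explicit inverse K of P in place of a
-- division. K and P are tied together by an instance of MacMahon's master theorem. Replacing
-- [v > m + 1] by [v > m] gives all letters of block p the same linear form L p, so K collects the
-- coefficients of x^b in ∏ (L p)^(b_p). The matrix of the forms L p has 1 + s on the diagonal, 1 on
-- one side of it and s on the other. Its principal minors of order k all equal 1 + s + ⋯ + sᵏ; with
-- the sign (-1)ᵏ they are the coefficients of P.

-- Ring normalisation with integer coefficients

module IntegerSolver {c ℓ} (R : CommutativeRing c ℓ) where
  open CommutativeRing R hiding (zero)
  open import Algebra.Properties.Ring ring
  open import Algebra.Properties.Monoid.Mult.TCOptimised +-monoid using (×-homo-+; 1+×) renaming (_×_ to _·_)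
  open import Relation.Binary.Reasoning.Setoid setoid

  ι : ℤ → Carrier
  ι (+ n)      = n · 1#
  ι (-[1+ n ]) = - (suc n · 1#)

  ι-⊖ : ∀ m n → ι (m ⊖ n) ≈ m · 1# - n · 1#
  ι-⊖ m zero = sym (trans (+-congˡ -0#≈0#) (+-identityʳ _))
  ι-⊖ zero (suc n) = sym (+-identityˡ _)
  ι-⊖ (suc m) (suc n) = begin
    ι (suc m ⊖ suc n)                      ≡⟨ ≡.cong ι (ℤ.[1+m]⊖[1+n]≡m⊖n m n) ⟩
    ι (m ⊖ n)                              ≈⟨ ι-⊖ m n ⟩
    m · 1# - n · 1#                        ≈⟨ +-congʳ (+-identityʳ _) ⟨
    m · 1# + 0# - n · 1#                   ≈⟨ +-congʳ (+-congˡ (-‿inverseʳ 1#)) ⟨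
    m · 1# + (1# - 1#) - n · 1#            ≈⟨ +-congʳ
      (trans (sym (+-assoc _ _ _)) (+-congʳ (+-comm _ _))) ⟩
    1# + m · 1# - 1# - n · 1#              ≈⟨ +-assoc _ _ _ ⟩
    1# + m · 1# + (- 1# - n · 1#)          ≈⟨ +-congˡ (-‿+-comm _ _) ⟩
    1# + m · 1# - (1# + n · 1#)            ≈⟨ +-cong (1+× m 1#) (-‿cong (1+× n 1#)) ⟨
    suc m · 1# - suc n · 1#                ∎

  ι-neg : ∀ i → ι (ℤ.- i) ≈ - ι i
  ι-neg (+ zero)  = sym -0#≈0#
  ι-neg (+ suc n) = refl
  ι-neg -[1+ n ]  = sym (-‿involutive _)

  ι-+ : ∀ i j → ι (i ℤ.+ j) ≈ ι i + ι j
  ι-+ (+ m)    (+ n)    = ×-homo-+ 1# m n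
  ι-+ (+ m)    -[1+ n ] = ι-⊖ m (suc n)
  ι-+ -[1+ m ] (+ n)    = trans (ι-⊖ n (suc m)) (+-comm _ _)
  ι-+ -[1+ m ] -[1+ n ] = begin
    - (suc (suc (m ℕ.+ n)) · 1#)       ≡⟨ ≡.cong (λ k → - (suc k · 1#)) (≡.sym (ℕ.+-suc m n)) ⟩
    - ((suc m ℕ.+ suc n) · 1#)         ≈⟨ -‿cong (×-homo-+ 1# (suc m) (suc n)) ⟩
    - (suc m · 1# + suc n · 1#)        ≈⟨ -‿+-comm _ _ ⟨
    - (suc m · 1#) - (suc n · 1#)      ∎

  ι-*⁺ : ∀ m j → ι (+ m ℤ.* j) ≈ m · 1# * ι j
  ι-*⁺ zero    j = sym (zeroˡ _)
  ι-*⁺ (suc m) j = begin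
    ι (+ suc m ℤ.* j)          ≡⟨ ≡.cong ι (ℤ.suc-* (+ m) j) ⟩
    ι (j ℤ.+ + m ℤ.* j)        ≈⟨ ι-+ j (+ m ℤ.* j) ⟩
    ι j + ι (+ m ℤ.* j)        ≈⟨ +-cong (sym (*-identityˡ _)) (ι-*⁺ m j) ⟩
    1# * ι j + m · 1# * ι j    ≈⟨ distribʳ _ _ _ ⟨
    (1# + m · 1#) * ι j        ≈⟨ *-congʳ (1+× m 1#) ⟨
    suc m · 1# * ι j           ∎

  ι-* : ∀ i j → ι (i ℤ.* j) ≈ ι i * ι j
  ι-* (+ m)    j = ι-*⁺ m j
  ι-* -[1+ m ] j = begin
    ι (-[1+ m ] ℤ.* j)           ≡⟨ ≡.cong ι (≡.sym (ℤ.neg-distribˡ-* (+ suc m) j)) ⟩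
    ι (ℤ.- (+ suc m ℤ.* j))      ≈⟨ ι-neg (+ suc m ℤ.* j) ⟩
    - ι (+ suc m ℤ.* j)          ≈⟨ -‿cong (ι-*⁺ (suc m) j) ⟩
    - (suc m · 1# * ι j)         ≈⟨ -‿distribˡ-* _ _ ⟩
    - (suc m · 1#) * ι j         ∎

  ι-homomorphism : ℤ.+-*-rawRing -Raw-AlmostCommutative⟶ fromCommutativeRing R
  ι-homomorphism = record
    { ⟦_⟧    = ι
    ; +-homo = ι-+
    ; *-homo = ι-*
    ; -‿homo = ι-neg
    ; 0-homo = refl
    ; 1-homo = refl
    }

  -- Equality in `R` need not be decidable. Cancellation during normalisation only has to compare
  -- integer coefficients.
  ι-equal? : ∀ i j → Maybe (ι i ≈ ι j)
  ι-equal? i j with i ℤ.≟ j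
  ... | yes i≡j = just (reflexive (≡.cong ι i≡j))
  ... | no  _   = nothing

  open import Algebra.Solver.Ring ℤ.+-*-rawRing (fromCommutativeRing R) ι-homomorphism ι-equal?
    public using (solve; _:=_; _:+_; _:*_; _:-_; :-_; con; Polynomial)

  :0 :1 : ∀ {n} → Polynomial n
  :0 = con (+ 0)
  :1 = con (+ 1)

-- The q-binomial convolution algebra

-- A sequence f stands for the Eulerian generating function ∑ fₙ zⁿ / (q;q)ₙ:
-- then _⋆_ is the product, η is the substitution z ↦ qz, and Z is
-- multiplication by z. No division by (q;q)ₙ is needed for this.
module QSequences {c ℓ} (R : CommutativeRing c ℓ) (q : CommutativeRing.Carrier R) where
  open CommutativeRing R hiding (zero)
  open IntegerSolver R
  open import Algebra.Properties.Semiring.Exp semiring using (_^_)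
  open import Relation.Binary.Reasoning.Setoid setoid

  Seq : Set c
  Seq = ℕ → Carrier

  infix 4 _≋_
  _≋_ : Seq → Seq → Set ℓ
  f ≋ g = ∀ n → f n ≈ g n

  infixl 6 _⊕_
  _⊕_ : Seq → Seq → Seq
  (f ⊕ g) n = f n + g n

  infixr 7 _⊙_
  _⊙_ : Carrier → Seq → Seq
  (a ⊙ f) n = a * f n

  D η Z : Seq → Seq
  D f n = f (suc n)
  η f n = q ^ n * f n
  Z f zero    = 0#
  Z f (suc n) = (1# - q ^ suc n) * f n

  infixl 7 _⋆_
  -- `D` is the q-difference f ↦ (f(z) - f(qz)) / z, and the recursion is its Leibniz rule D(fg) =
  -- (Df) g + f(qz) (Dg).
  _⋆_ : Seq → Seq → Seq
  (f ⋆ g) zero    = f 0 * g 0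
  (f ⋆ g) (suc n) = (D f ⋆ g) n + (η f ⋆ D g) n

  -- This is n ↦ q^C(n,2) γ n. The shift is put on γ so that `D (gauss γ)` is `η (gauss (γ ∘ suc))`
  -- by computation.
  gauss : Seq → Seq
  gauss γ zero    = γ 0
  gauss γ (suc n) = q ^ n * gauss (γ ∘ suc) n

  -- The series 1 and z; the entry 1 - q is (q;q)₁. Writing `Z` as a product with `z̃` lets it move
  -- through other products by associativity.
  δ z̃ : Seq
  δ zero    = 1#
  δ (suc _) = 0#
  z̃ zero          = 0#
  z̃ (suc zero)    = 1# - q
  z̃ (suc (suc _)) = 0#

  Z-cong : ∀ {f g} → f ≋ g → Z f ≋ Z g
  Z-cong f≋g zero    = refl
  Z-cong f≋g (suc n) = *-congˡ (f≋g n)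

  η-⊙ : ∀ a f → η (a ⊙ f) ≋ a ⊙ η f
  η-⊙ a f n = solve 3 (λ a x y → y :* (a :* x) := a :* (y :* x)) refl a (f n) (q ^ n)

  Dη : ∀ f → D (η f) ≋ q ⊙ η (D f)
  Dη f n = *-assoc _ _ _

  η+ZD : ∀ f → f ≋ η f ⊕ Z (D f)
  η+ZD f zero    = solve 1 (λ x → x := :1 :* x :+ :0) refl (f 0)
  η+ZD f (suc n) = solve 2 (λ x y → x := y :* x :+ (:1 :- y) :* x) refl (f (suc n)) (q ^ suc n)

  ⋆-cong≤ : ∀ {f f′ g g′} n → (∀ k → k ℕ.≤ n → f k ≈ f′ k) → (∀ k → k ℕ.≤ n → g k ≈ g′ k) →
            (f ⋆ g) n ≈ (f′ ⋆ g′) n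
  ⋆-cong≤ zero    f≈ g≈ = *-cong (f≈ 0 z≤n) (g≈ 0 z≤n)
  ⋆-cong≤ (suc n) f≈ g≈ = +-cong
    (⋆-cong≤ n (λ k k≤n → f≈ (suc k) (s≤s k≤n)) (λ k k≤n → g≈ k (ℕ.m≤n⇒m≤1+n k≤n)))
    (⋆-cong≤ n (λ k k≤n → *-congˡ (f≈ k (ℕ.m≤n⇒m≤1+n k≤n))) (λ k k≤n → g≈ (suc k) (s≤s k≤n)))

  ⋆-cong : ∀ {f f′ g g′} → f ≋ f′ → g ≋ g′ → f ⋆ g ≋ f′ ⋆ g′
  ⋆-cong f≋ g≋ n = ⋆-cong≤ n (λ k _ → f≋ k) (λ k _ → g≋ k)

  ⋆-congˡ : ∀ {f g g′} → g ≋ g′ → f ⋆ g ≋ f ⋆ g′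
  ⋆-congˡ = ⋆-cong (λ _ → refl)

  ⋆-congʳ : ∀ {f f′ g} → f ≋ f′ → f ⋆ g ≋ f′ ⋆ g
  ⋆-congʳ f≋ = ⋆-cong f≋ (λ _ → refl)

  ⋆-⊙ˡ : ∀ a f g → (a ⊙ f) ⋆ g ≋ a ⊙ (f ⋆ g)
  ⋆-⊙ˡ a f g zero    = *-assoc _ _ _
  ⋆-⊙ˡ a f g (suc n) = begin
    ((a ⊙ D f) ⋆ g) n + (η (a ⊙ f) ⋆ D g) n     ≈⟨ +-congˡ (⋆-congʳ (η-⊙ a f) n) ⟩
    ((a ⊙ D f) ⋆ g) n + ((a ⊙ η f) ⋆ D g) n     ≈⟨ +-cong (⋆-⊙ˡ a (D f) g n) (⋆-⊙ˡ a (η f) (D g) n) ⟩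
    a * (D f ⋆ g) n + a * (η f ⋆ D g) n         ≈⟨ distribˡ _ _ _ ⟨
    a * (f ⋆ g) (suc n)                         ∎

  ⋆-⊕ˡ : ∀ f f′ g → (f ⊕ f′) ⋆ g ≋ f ⋆ g ⊕ f′ ⋆ g
  ⋆-⊕ˡ f f′ g zero    = distribʳ _ _ _
  ⋆-⊕ˡ f f′ g (suc n) = begin
    ((D f ⊕ D f′) ⋆ g) n + (η (f ⊕ f′) ⋆ D g) n
      ≈⟨ +-congˡ (⋆-congʳ (λ k → distribˡ _ _ _) n) ⟩
    ((D f ⊕ D f′) ⋆ g) n + ((η f ⊕ η f′) ⋆ D g) n
      ≈⟨ +-cong (⋆-⊕ˡ (D f) (D f′) g n) (⋆-⊕ˡ (η f) (η f′) (D g) n) ⟩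
    (D f ⋆ g) n + (D f′ ⋆ g) n + ((η f ⋆ D g) n + (η f′ ⋆ D g) n)
      ≈⟨ solve 4 (λ a b c d → a :+ b :+ (c :+ d) := a :+ c :+ (b :+ d)) refl _ _ _ _ ⟩
    (f ⋆ g) (suc n) + (f′ ⋆ g) (suc n) ∎

  ⋆-zeroˡ≤ : ∀ {f} g n → (∀ k → k ℕ.≤ n → f k ≈ 0#) → (f ⋆ g) n ≈ 0#
  ⋆-zeroˡ≤ {f} g n f≈0 = begin
    (f ⋆ g) n                    ≈⟨ ⋆-cong≤ n (λ k k≤n → trans (f≈0 k k≤n) (sym (zeroˡ 1#)))
      (λ _ _ → refl) ⟩
    ((0# ⊙ λ _ → 1#) ⋆ g) n      ≈⟨ ⋆-⊙ˡ 0# (λ _ → 1#) g n ⟩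
    0# * ((λ _ → 1#) ⋆ g) n      ≈⟨ zeroˡ _ ⟩
    0#                           ∎

  -- Pascal's rule for q-binomials in its other form.
  D-⋆ : ∀ f g → D (f ⋆ g) ≋ f ⋆ D g ⊕ D f ⋆ η g
  D-⋆ f g zero = solve 4 (λ a b c d → b :* c :+ :1 :* a :* d := a :* d :+ b :* (:1 :* c))
    refl (f 0) (f 1) (g 0) (g 1)
  D-⋆ f g (suc n) = begin
    (D f ⋆ g) (suc n) + (η f ⋆ D g) (suc n)
      ≈⟨ +-cong (D-⋆ (D f) g n) (D-⋆ (η f) (D g) n) ⟩
    (D f ⋆ D g) n + (D (D f) ⋆ η g) n + ((η f ⋆ D (D g)) n + (D (η f) ⋆ η (D g)) n)
      ≈⟨ +-congˡ (+-congˡ (shift n)) ⟩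
    (D f ⋆ D g) n + (D (D f) ⋆ η g) n + ((η f ⋆ D (D g)) n + (η (D f) ⋆ D (η g)) n)
      ≈⟨ solve 4 (λ a b c d → a :+ b :+ (c :+ d) := a :+ c :+ (b :+ d)) refl _ _ _ _ ⟩
    (f ⋆ D g) (suc n) + (D f ⋆ η g) (suc n) ∎
    where
    -- Proved directly, because `⋆-⊙ʳ` rests on `⋆-comm`, which in turn rests on `D-⋆`.
    shiftʳ : ∀ a f g → f ⋆ (a ⊙ g) ≋ a ⊙ (f ⋆ g)
    shiftʳ a f g zero    = solve 3 (λ a x y → x :* (a :* y) := a :* (x :* y)) refl a (f 0) (g 0)
    shiftʳ a f g (suc n) = trans (+-cong (shiftʳ a (D f) g n) (shiftʳ a (η f) (D g) n))
      (sym (distribˡ _ _ _))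

    shift : D (η f) ⋆ η (D g) ≋ η (D f) ⋆ D (η g)
    shift n = begin
      (D (η f) ⋆ η (D g)) n         ≈⟨ ⋆-congʳ (Dη f) n ⟩
      ((q ⊙ η (D f)) ⋆ η (D g)) n   ≈⟨ ⋆-⊙ˡ q _ _ n ⟩
      q * (η (D f) ⋆ η (D g)) n     ≈⟨ shiftʳ q _ _ n ⟨
      (η (D f) ⋆ (q ⊙ η (D g))) n   ≈⟨ ⋆-congˡ (Dη g) n ⟨
      (η (D f) ⋆ D (η g)) n         ∎

  -- Exchanging the factors exchanges the two forms of Pascal's rule.
  ⋆-comm : ∀ f g → f ⋆ g ≋ g ⋆ f
  ⋆-comm f g zero    = *-comm _ _
  ⋆-comm f g (suc n) = begin
    (D f ⋆ g) n + (η f ⋆ D g) n    ≈⟨ +-cong (⋆-comm (D f) g n) (⋆-comm (η f) (D g) n) ⟩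
    (g ⋆ D f) n + (D g ⋆ η f) n    ≈⟨ D-⋆ g f n ⟨
    (g ⋆ f) (suc n)                ∎

  ⋆-⊕ʳ : ∀ f g g′ → f ⋆ (g ⊕ g′) ≋ f ⋆ g ⊕ f ⋆ g′
  ⋆-⊕ʳ f g g′ n = begin
    (f ⋆ (g ⊕ g′)) n            ≈⟨ ⋆-comm f _ n ⟩
    ((g ⊕ g′) ⋆ f) n            ≈⟨ ⋆-⊕ˡ g g′ f n ⟩
    (g ⋆ f) n + (g′ ⋆ f) n      ≈⟨ +-cong (⋆-comm g f n) (⋆-comm g′ f n) ⟩
    (f ⋆ g) n + (f ⋆ g′) n      ∎

  ⋆-⊙ʳ : ∀ a f g → f ⋆ (a ⊙ g) ≋ a ⊙ (f ⋆ g)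
  ⋆-⊙ʳ a f g n = trans (⋆-comm f _ n) (trans (⋆-⊙ˡ a g f n) (*-congˡ (⋆-comm g f n)))

  η-⋆ : ∀ f g → η (f ⋆ g) ≋ η f ⋆ η g
  η-⋆ f g zero    = solve 2 (λ x y → :1 :* (x :* y) := :1 :* x :* (:1 :* y)) refl (f 0) (g 0)
  η-⋆ f g (suc n) = begin
    q * q ^ n * ((D f ⋆ g) n + (η f ⋆ D g) n)
      ≈⟨ solve 4 (λ q p x y → q :* p :* (x :+ y) := q :* (p :* x) :+ q :* (p :* y)) refl q (q ^ n) _ _ ⟩
    q * η (D f ⋆ g) n + q * η (η f ⋆ D g) n
      ≈⟨ +-cong (*-congˡ (η-⋆ (D f) g n)) (*-congˡ (η-⋆ (η f) (D g) n)) ⟩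
    q * (η (D f) ⋆ η g) n + q * (η (η f) ⋆ η (D g)) n
      ≈⟨ +-cong (sym (⋆-⊙ˡ q _ _ n)) (sym (⋆-⊙ʳ q _ _ n)) ⟩
    ((q ⊙ η (D f)) ⋆ η g) n + (η (η f) ⋆ (q ⊙ η (D g))) n
      ≈⟨ +-cong (⋆-congʳ (Dη f) n) (⋆-congˡ (Dη g) n) ⟨
    (η f ⋆ η g) (suc n) ∎

  ⋆-assoc : ∀ f g h → (f ⋆ g) ⋆ h ≋ f ⋆ (g ⋆ h)
  ⋆-assoc f g h zero    = *-assoc _ _ _
  ⋆-assoc f g h (suc n) = begin
    ((D f ⋆ g ⊕ η f ⋆ D g) ⋆ h) n + (η (f ⋆ g) ⋆ D h) n
      ≈⟨ +-cong (⋆-⊕ˡ (D f ⋆ g) _ h n) (⋆-congʳ (η-⋆ f g) n) ⟩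
    ((D f ⋆ g) ⋆ h) n + ((η f ⋆ D g) ⋆ h) n + ((η f ⋆ η g) ⋆ D h) n
      ≈⟨ +-cong (+-cong (⋆-assoc (D f) g h n) (⋆-assoc (η f) (D g) h n)) (⋆-assoc (η f) (η g) (D h) n) ⟩
    (D f ⋆ (g ⋆ h)) n + (η f ⋆ (D g ⋆ h)) n + (η f ⋆ (η g ⋆ D h)) n
      ≈⟨ +-assoc _ _ _ ⟩
    (D f ⋆ (g ⋆ h)) n + ((η f ⋆ (D g ⋆ h)) n + (η f ⋆ (η g ⋆ D h)) n)
      ≈⟨ +-congˡ (⋆-⊕ʳ (η f) (D g ⋆ h) (η g ⋆ D h) n) ⟨
    (D f ⋆ (g ⋆ h)) n + (η f ⋆ D (g ⋆ h)) n ∎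

  δ-⋆ : ∀ f → δ ⋆ f ≋ f
  δ-⋆ f zero    = *-identityˡ _
  δ-⋆ f (suc n) = begin
    (D δ ⋆ f) n + (η δ ⋆ D f) n   ≈⟨ +-cong (⋆-zeroˡ≤ f n (λ _ _ → refl)) (⋆-congʳ ηδ n) ⟩
    0# + (δ ⋆ D f) n              ≈⟨ +-identityˡ _ ⟩
    (δ ⋆ D f) n                   ≈⟨ δ-⋆ (D f) n ⟩
    f (suc n)                     ∎
    where
    ηδ : η δ ≋ δ
    ηδ zero    = *-identityˡ _
    ηδ (suc n) = zeroʳ _

  z̃-⋆ : ∀ f → z̃ ⋆ f ≋ Z f
  z̃-⋆ f zero    = zeroˡ _
  z̃-⋆ f (suc n) = begin
    (D z̃ ⋆ f) n + (η z̃ ⋆ D f) n           ≈⟨ +-cong (⋆-congʳ Dz̃ n) (⋆-congʳ ηz̃ n) ⟩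
    (((1# - q) ⊙ δ) ⋆ f) n + ((q ⊙ z̃) ⋆ D f) n
      ≈⟨ +-cong (trans (⋆-⊙ˡ (1# - q) δ f n) (*-congˡ (δ-⋆ f n)))
                (trans (⋆-⊙ˡ q z̃ (D f) n) (*-congˡ (z̃-⋆ (D f) n))) ⟩
    (1# - q) * f n + q * Z (D f) n        ≈⟨ step n ⟩
    (1# - q * q ^ n) * f n                ∎
    where
    Dz̃ : D z̃ ≋ (1# - q) ⊙ δ
    Dz̃ zero    = sym (*-identityʳ _)
    Dz̃ (suc n) = sym (zeroʳ _)
    ηz̃ : η z̃ ≋ q ⊙ z̃
    ηz̃ zero          = trans (zeroʳ _) (sym (zeroʳ _))
    ηz̃ (suc zero)    = *-congʳ (*-identityʳ _)
    ηz̃ (suc (suc n)) = trans (zeroʳ _) (sym (zeroʳ _))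
    step : ∀ n → (1# - q) * f n + q * Z (D f) n ≈ (1# - q * q ^ n) * f n
    step zero    = solve 2 (λ q x → (:1 :- q) :* x :+ q :* :0 := (:1 :- q :* :1) :* x) refl q (f 0)
    step (suc n) = solve 3 (λ q p x → (:1 :- q) :* x :+ q :* ((:1 :- p) :* x) := (:1 :- q :* p) :* x)
      refl q (q ^ suc n) (f (suc n))

  Z-⋆ : ∀ f g → Z f ⋆ g ≋ Z (f ⋆ g)
  Z-⋆ f g n = begin
    (Z f ⋆ g) n          ≈⟨ ⋆-congʳ (z̃-⋆ f) n ⟨
    (z̃ ⋆ f ⋆ g) n        ≈⟨ ⋆-assoc z̃ f g n ⟩
    (z̃ ⋆ (f ⋆ g)) n      ≈⟨ z̃-⋆ _ n ⟩
    Z (f ⋆ g) n          ∎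

  ⋆-Z : ∀ f g → f ⋆ Z g ≋ Z (f ⋆ g)
  ⋆-Z f g n = trans (⋆-comm f _ n) (trans (Z-⋆ g f n) (Z-cong (⋆-comm g f) n))

-- Sums over the arrangements of a list of letters

module WordSums {c ℓ} (R : CommutativeRing c ℓ) where
  open CommutativeRing R hiding (zero)
  open IntegerSolver R
  open import Relation.Binary.Reasoning.Setoid setoid

  ⟦_⟧ : Bool → Carrier
  ⟦ true  ⟧ = 1#
  ⟦ false ⟧ = 0#

  module _ {a} {A : Set a} where

    pickSum : List A → (A → List A → Carrier) → Carrier
    pickSum []      g = 0#
    pickSum (x ∷ U) g = g x U + pickSum U (λ y r → g y (x ∷ r))

    splitSum : List A → (List A → List A → Carrier) → Carrier
    splitSum []      g = g [] []
    splitSum (x ∷ U) g = splitSum U (λ L S → g (x ∷ L) S) + splitSum U (λ L S → g L (x ∷ S))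

    wordSum : ℕ → List A → (List A → Carrier) → Carrier
    wordSum zero    U f = f []
    wordSum (suc n) U f = pickSum U (λ x r → wordSum n r (f ∘ (x ∷_)))

    pickSum-cong-↭ : ∀ U {g h} → (∀ x r → x ∷ r ↭ U → g x r ≈ h x r) → pickSum U g ≈ pickSum U h
    pickSum-cong-↭ []      eq = refl
    pickSum-cong-↭ (x ∷ U) eq = +-cong (eq x U ↭-refl)
      (pickSum-cong-↭ U (λ y r p → eq y (x ∷ r) (_↭_.trans (swap y x ↭-refl) (prep x p))))

    pickSum-cong : ∀ U {g h} → (∀ x r → g x r ≈ h x r) → pickSum U g ≈ pickSum U h
    pickSum-cong U eq = pickSum-cong-↭ U (λ x r _ → eq x r)

    pickSum-+ : ∀ U g h → pickSum U (λ x r → g x r + h x r) ≈ pickSum U g + pickSum U h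
    pickSum-+ []      g h = sym (+-identityˡ 0#)
    pickSum-+ (x ∷ U) g h = trans (+-congˡ (pickSum-+ U _ _))
      (solve 4 (λ a b c d → a :+ b :+ (c :+ d) := a :+ c :+ (b :+ d)) refl _ _ _ _)

    pickSum-* : ∀ U a g → pickSum U (λ x r → a * g x r) ≈ a * pickSum U g
    pickSum-* []      a g = sym (zeroʳ a)
    pickSum-* (x ∷ U) a g = trans (+-congˡ (pickSum-* U a _)) (sym (distribˡ _ _ _))

    pickSum-swap : ∀ U (g : A → A → List A → Carrier) →
      pickSum U (λ x r → pickSum r (λ y → g x y)) ≈ pickSum U (λ x r → pickSum r (λ y → g y x))
    pickSum-swap []      g = refl
    pickSum-swap (u ∷ U) g = begin
      pickSum U (λ y r → g u y r) + pickSum U (λ x r → g x u r + pickSum r (λ y r′ → g x y (u ∷ r′)))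
        ≈⟨ +-congˡ (pickSum-+ U _ _) ⟩
      pickSum U (λ y r → g u y r) + (pickSum U (λ x r → g x u r)
        + pickSum U (λ x r → pickSum r (λ y r′ → g x y (u ∷ r′))))
        ≈⟨ +-congˡ (+-congˡ (pickSum-swap U (λ x y r′ → g x y (u ∷ r′)))) ⟩
      pickSum U (λ y r → g u y r) + (pickSum U (λ x r → g x u r)
        + pickSum U (λ x r → pickSum r (λ y r′ → g y x (u ∷ r′))))
        ≈⟨ solve 3 (λ a b c → a :+ (b :+ c) := b :+ (a :+ c)) refl _ _ _ ⟩
      pickSum U (λ x r → g x u r) + (pickSum U (λ y r → g u y r)
        + pickSum U (λ x r → pickSum r (λ y r′ → g y x (u ∷ r′))))
        ≈⟨ +-congˡ (pickSum-+ U _ _) ⟨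
      pickSum U (λ x r → g x u r) + pickSum U (λ y r → g u y r + pickSum r (λ x r′ → g x y (u ∷ r′))) ∎

    pickSum-↭ : ∀ {U V g} → (∀ x {r s} → r ↭ s → g x r ≈ g x s) → U ↭ V → pickSum U g ≈ pickSum V g
    pickSum-↭ g-↭ _↭_.refl = refl
    pickSum-↭ g-↭ (prep x p) = +-cong (g-↭ x p) (pickSum-↭ (λ y p′ → g-↭ y (prep x p′)) p)
    pickSum-↭ {g = g} g-↭ (swap {xs} {ys} x y p) = begin
      g x (y ∷ xs) + (g y (x ∷ xs) + pickSum xs (λ z r → g z (x ∷ y ∷ r)))
        ≈⟨ +-cong (g-↭ x (prep y p)) (+-cong (g-↭ y (prep x p)) (trans
             (pickSum-cong xs (λ z r → g-↭ z (swap x y ↭-refl)))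
             (pickSum-↭ (λ z p′ → g-↭ z (prep y (prep x p′))) p))) ⟩
      g x (y ∷ ys) + (g y (x ∷ ys) + pickSum ys (λ z r → g z (y ∷ x ∷ r)))
        ≈⟨ solve 3 (λ a b c → a :+ (b :+ c) := b :+ (a :+ c)) refl _ _ _ ⟩
      g y (x ∷ ys) + (g x (y ∷ ys) + pickSum ys (λ z r → g z (y ∷ x ∷ r))) ∎
    pickSum-↭ g-↭ (_↭_.trans p p′) = trans (pickSum-↭ g-↭ p) (pickSum-↭ g-↭ p′)

    splitSum-cong : ∀ U {g h} →
      (∀ L S → L ⊆ U → S ⊆ U → length L ℕ.+ length S ≡ length U → g L S ≈ h L S) →
      splitSum U g ≈ splitSum U h
    splitSum-cong []      eq = eq [] [] [] [] ≡.refl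
    splitSum-cong (x ∷ U) eq = +-cong
      (splitSum-cong U (λ L S L⊆ S⊆ len → eq (x ∷ L) S (≡.refl ∷ L⊆) (skip x S⊆) (≡.cong suc len)))
      (splitSum-cong U (λ L S L⊆ S⊆ len → eq L (x ∷ S) (skip x L⊆) (≡.refl ∷ S⊆)
        (≡.trans (ℕ.+-suc _ _) (≡.cong suc len))))

    splitSum-+ : ∀ U g h → splitSum U (λ L S → g L S + h L S) ≈ splitSum U g + splitSum U h
    splitSum-+ []      g h = refl
    splitSum-+ (x ∷ U) g h = trans (+-cong (splitSum-+ U _ _) (splitSum-+ U _ _))
      (solve 4 (λ a b c d → a :+ b :+ (c :+ d) := a :+ c :+ (b :+ d)) refl _ _ _ _)

    pickSum-splitSum : ∀ U (g : A → List A → List A → Carrier) →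
      pickSum U (λ x r → splitSum r (g x)) ≈ splitSum U (λ L S → pickSum L (λ x L′ → g x L′ S))
    pickSum-splitSum []      g = refl
    pickSum-splitSum (u ∷ U) g = begin
      splitSum U (g u) + pickSum U (λ x r →
        splitSum r (λ L S → g x (u ∷ L) S) + splitSum r (λ L S → g x L (u ∷ S)))
        ≈⟨ +-congˡ (pickSum-+ U (λ x r → splitSum r (λ L S → g x (u ∷ L) S))
             (λ x r → splitSum r (λ L S → g x L (u ∷ S)))) ⟩
      splitSum U (g u) + (pickSum U (λ x r → splitSum r (λ L S → g x (u ∷ L) S))
                        + pickSum U (λ x r → splitSum r (λ L S → g x L (u ∷ S))))
        ≈⟨ +-congˡ (+-cong (pickSum-splitSum U (λ x L S → g x (u ∷ L) S))
             (pickSum-splitSum U (λ x L S → g x L (u ∷ S)))) ⟩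
      splitSum U (g u) + (splitSum U (λ L S → pickSum L (λ x L′ → g x (u ∷ L′) S))
                        + splitSum U (λ L S → pickSum L (λ x L′ → g x L′ (u ∷ S))))
        ≈⟨ +-assoc _ _ _ ⟨
      splitSum U (g u) + splitSum U (λ L S → pickSum L (λ x L′ → g x (u ∷ L′) S))
                       + splitSum U (λ L S → pickSum L (λ x L′ → g x L′ (u ∷ S)))
        ≈⟨ +-congʳ (splitSum-+ U (g u) (λ L S → pickSum L (λ x L′ → g x (u ∷ L′) S))) ⟨
      splitSum U (λ L S → g u L S + pickSum L (λ x L′ → g x (u ∷ L′) S))
                       + splitSum U (λ L S → pickSum L (λ x L′ → g x L′ (u ∷ S))) ∎

    -- Isolates the splitting with empty left part, which in `wordSum-split` is the case that `m`
    -- comes first.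
    splitSum-[]ˡ : ∀ U {g g′ : List A → List A → Carrier} {h : List A → Carrier} →
      (∀ S → g [] S ≈ h S) → (∀ S → g′ [] S ≈ 0#) →
      (∀ x L S → g (x ∷ L) S ≈ g′ (x ∷ L) S) → splitSum U g ≈ h U + splitSum U g′
    splitSum-[]ˡ [] {g} {g′} {h} g[] g′[] g∷ = begin
      g [] []            ≈⟨ g[] [] ⟩
      h []               ≈⟨ +-identityʳ _ ⟨
      h [] + 0#          ≈⟨ +-congˡ (g′[] []) ⟨
      h [] + g′ [] []    ∎
    splitSum-[]ˡ (x ∷ U) {g} {g′} {h} g[] g′[] g∷ = trans
      (+-cong (splitSum-cong U (λ L S _ _ _ → g∷ x L S))
        (splitSum-[]ˡ U {h = h ∘ (x ∷_)} (λ S → g[] _) (λ S → g′[] _) (λ y L S → g∷ y L _)))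
      (solve 3 (λ a b c → a :+ (b :+ c) := b :+ (a :+ c)) refl _ _ _)

    wordSum-cong : ∀ n U {f g} → (∀ w → f w ≈ g w) → wordSum n U f ≈ wordSum n U g
    wordSum-cong zero    U eq = eq []
    wordSum-cong (suc n) U eq = pickSum-cong U (λ x r → wordSum-cong n r (λ w → eq (x ∷ w)))

    wordSum-cong-↭ : ∀ n U {f g} → n ≡ length U → (∀ w → w ↭ U → f w ≈ g w) →
                     wordSum n U f ≈ wordSum n U g
    wordSum-cong-↭ zero    []        _   eq = eq [] ↭-refl
    wordSum-cong-↭ (suc n) U@(_ ∷ _) len eq = pickSum-cong-↭ U (λ x r p →
      wordSum-cong-↭ n r (ℕ.suc-injective (≡.trans len (≡.sym (↭-length p))))
        (λ w p′ → eq (x ∷ w) (_↭_.trans (prep x p′) p)))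

    wordSum-* : ∀ n U a f → wordSum n U (λ w → a * f w) ≈ a * wordSum n U f
    wordSum-* zero    U a f = refl
    wordSum-* (suc n) U a f = trans (pickSum-cong U (λ x r → wordSum-* n r a _)) (pickSum-* U a _)

    wordSum-∷ʳ : ∀ n U f → wordSum (suc n) U f ≈ pickSum U (λ x r → wordSum n r (λ w → f (w ∷ʳ x)))
    wordSum-∷ʳ zero    U f = refl
    wordSum-∷ʳ (suc n) U f = begin
      pickSum U (λ x r → wordSum (suc n) r (f ∘ (x ∷_)))
        ≈⟨ pickSum-cong U (λ x r → wordSum-∷ʳ n r (f ∘ (x ∷_))) ⟩
      pickSum U (λ x r → pickSum r (λ y r′ → wordSum n r′ (λ w → f (x ∷ (w ∷ʳ y)))))
        ≈⟨ pickSum-swap U (λ x y r′ → wordSum n r′ (λ w → f (x ∷ (w ∷ʳ y)))) ⟩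
      pickSum U (λ x r → pickSum r (λ y r′ → wordSum n r′ (λ w → f (y ∷ (w ∷ʳ x))))) ∎

    wordSum-reverse : ∀ n U f → wordSum n U (f ∘ reverse) ≈ wordSum n U f
    wordSum-reverse zero    U f = refl
    wordSum-reverse (suc n) U f = begin
      pickSum U (λ x r → wordSum n r (λ w → f (reverse (x ∷ w))))
        ≈⟨ pickSum-cong U (λ x r → wordSum-cong n r
             (λ w → reflexive (≡.cong f (List.unfold-reverse x w)))) ⟩
      pickSum U (λ x r → wordSum n r (λ w → f (reverse w ∷ʳ x)))
        ≈⟨ pickSum-cong U (λ x r → wordSum-reverse n r (λ w → f (w ∷ʳ x))) ⟩
      pickSum U (λ x r → wordSum n r (λ w → f (w ∷ʳ x)))
        ≈⟨ wordSum-∷ʳ n U f ⟨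
      wordSum (suc n) U f ∎

    wordSum-↭ : ∀ n {U V} f → U ↭ V → wordSum n U f ≈ wordSum n V f
    wordSum-↭ zero    f p = refl
    wordSum-↭ (suc n) f p = pickSum-↭ (λ x p′ → wordSum-↭ n (f ∘ (x ∷_)) p′) p

    -- Induction on the first letter of the word: either it is `m`, and the left part is empty, or
    -- it is some x of U, which then heads the left part.
    wordSum-split : ∀ m U f → wordSum (suc (length U)) (m ∷ U) f ≈
      splitSum U (λ L S → wordSum (length L) L (λ u → wordSum (length S) S (λ v → f (u ++ m ∷ v))))
    wordSum-split m U f = go (length U) U ≡.refl f
      where
      pieces : (List A → Carrier) → List A → List A → Carrier
      pieces f L S = wordSum (length L) L (λ u → wordSum (length S) S (λ v → f (u ++ m ∷ v)))

      go : ∀ n U → n ≡ length U → ∀ f → wordSum (suc n) (m ∷ U) f ≈ splitSum U (pieces f)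
      go zero    []        _    f = +-identityʳ _
      go (suc n) U@(_ ∷ _) n≡∣U∣ f = begin
        wordSum (suc n) U (f ∘ (m ∷_)) + pickSum U (λ x r → wordSum (suc n) (m ∷ r) (f ∘ (x ∷_)))
          ≈⟨ +-cong (reflexive (≡.cong (λ k → wordSum k U (f ∘ (m ∷_))) n≡∣U∣))
                    (pickSum-cong-↭ U (λ x r p →
                      go n r (ℕ.suc-injective (≡.trans n≡∣U∣ (≡.sym (↭-length p)))) (f ∘ (x ∷_)))) ⟩
        wordSum (length U) U (f ∘ (m ∷_)) + pickSum U (λ x r → splitSum r (pieces (f ∘ (x ∷_))))
          ≈⟨ +-congˡ (pickSum-splitSum U (λ x → pieces (f ∘ (x ∷_)))) ⟩
        wordSum (length U) U (f ∘ (m ∷_))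
          + splitSum U (λ L S → pickSum L (λ x L′ → pieces (f ∘ (x ∷_)) L′ S))
          ≈⟨ splitSum-[]ˡ U {pieces f} {λ L S → pickSum L (λ x L′ → pieces (f ∘ (x ∷_)) L′ S)}
               {λ S → wordSum (length S) S (f ∘ (m ∷_))} (λ S → refl) (λ S → refl)
               (λ x L S → pickSum-cong-↭ (x ∷ L) (λ y r p → reflexive (≡.cong
                 (λ k → wordSum k r (λ u → wordSum (length S) S (λ v → f (y ∷ u ++ m ∷ v))))
                 (≡.sym (ℕ.suc-injective (↭-length p)))))) ⟨
        splitSum U (pieces f) ∎

  private
    ∑ : List Carrier → Carrier
    ∑ = foldr _+_ 0#

    ∑-++ : ∀ xs ys → ∑ (xs ++ ys) ≈ ∑ xs + ∑ ys
    ∑-++ []       ys = sym (+-identityˡ _)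
    ∑-++ (x ∷ xs) ys = trans (+-congˡ (∑-++ xs ys)) (sym (+-assoc _ _ _))

    ∑-cong : ∀ {b} {B : Set b} {f g : B → Carrier} →
      (∀ x → f x ≈ g x) → ∀ xs → ∑ (map f xs) ≈ ∑ (map g xs)
    ∑-cong eq []       = refl
    ∑-cong eq (x ∷ xs) = +-cong (eq x) (∑-cong eq xs)

    ∑-concatMap : ∀ {b d} {B : Set b} {C : Set d} (f : C → Carrier) (g : B → List C) xs →
                  ∑ (map f (concatMap g xs)) ≈ ∑ (map (λ x → ∑ (map f (g x))) xs)
    ∑-concatMap f g []       = refl
    ∑-concatMap f g (x ∷ xs) = begin
      ∑ (map f (g x ++ concatMap g xs))                ≡⟨ ≡.cong ∑ (List.map-++ f (g x) _) ⟩
      ∑ (map f (g x) ++ map f (concatMap g xs))        ≈⟨ ∑-++ (map f (g x)) _ ⟩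
      ∑ (map f (g x)) + ∑ (map f (concatMap g xs))     ≈⟨ +-congˡ (∑-concatMap f g xs) ⟩
      ∑ (map (λ x → ∑ (map f (g x))) (x ∷ xs))         ∎

  open SumOver R using (∑𝔖)

  ∑𝔖-cong : ∀ n {f g : Permutation′ n → Carrier} → (∀ σ → f σ ≈ g σ) → ∑𝔖 n f ≈ ∑𝔖 n g
  ∑𝔖-cong n eq = ∑-cong eq (𝔖 n)

  module _ {a} {A : Set a} where

    pickSum-tabulate : ∀ {n} (u : Fin (suc n) → A) g →
      pickSum (tabulate u) g ≈ ∑ (tabulate (λ j → g (u j) (tabulate (u ∘ punchIn j))))
    pickSum-tabulate {zero}  u g = refl
    pickSum-tabulate {suc n} u g = +-congˡ (pickSum-tabulate (u ∘ suc) (λ y r → g y (u zero ∷ r)))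

    word : ∀ {n} → (Fin n → A) → Permutation′ n → List A
    word u σ = tabulate (λ i → u (σ ⟨$⟩ʳ i))

    -- Both enumerations choose the first letter first; after the choice of j, the alphabet
    -- `u ∘ punchIn j` is exactly what `pickSum` leaves.
    ∑𝔖-word : ∀ n (u : Fin n → A) f → ∑𝔖 n (f ∘ word u) ≈ wordSum n (tabulate u) f
    ∑𝔖-word zero    u f = +-identityʳ _
    ∑𝔖-word (suc n) u f = begin
      ∑𝔖 (suc n) (f ∘ word u)
        ≈⟨ ∑-concatMap (f ∘ word u) (λ j → map (insert zero j) (𝔖 n)) (allFin (suc n)) ⟩
      ∑ (map (λ j → ∑ (map (f ∘ word u) (map (insert zero j) (𝔖 n)))) (allFin (suc n)))
        ≈⟨ ∑-cong letter (allFin (suc n)) ⟩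
      ∑ (map (λ j → wordSum n (tabulate (u ∘ punchIn j)) (f ∘ (u j ∷_))) (allFin (suc n)))
        ≡⟨ ≡.cong ∑ (List.map-tabulate (λ j → j)
             (λ j → wordSum n (tabulate (u ∘ punchIn j)) (f ∘ (u j ∷_)))) ⟩
      ∑ (tabulate (λ j → wordSum n (tabulate (u ∘ punchIn j)) (f ∘ (u j ∷_))))
        ≈⟨ pickSum-tabulate u (λ x r → wordSum n r (f ∘ (x ∷_))) ⟨
      wordSum (suc n) (tabulate u) f ∎
      where
      letter : ∀ j → ∑ (map (f ∘ word u) (map (insert zero j) (𝔖 n))) ≈
               wordSum n (tabulate (u ∘ punchIn j)) (f ∘ (u j ∷_))
      letter j = begin
        ∑ (map (f ∘ word u) (map (insert zero j) (𝔖 n)))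
          ≡⟨ ≡.cong ∑ (List.map-∘ (𝔖 n)) ⟨
        ∑𝔖 n (λ π → f (word u (insert zero j π)))
          ≈⟨ ∑-cong (λ π → reflexive (≡.cong (λ w → f (u j ∷ w))
               (List.tabulate-cong (λ i → ≡.cong u (insert-punchIn zero j π i))))) (𝔖 n) ⟩
        ∑𝔖 n (λ π → f (u j ∷ word (u ∘ punchIn j) π))
          ≈⟨ ∑𝔖-word n (u ∘ punchIn j) (f ∘ (u j ∷_)) ⟩
        wordSum n (tabulate (u ∘ punchIn j)) (f ∘ (u j ∷_)) ∎

-- Admissible inversions and descents around a largest letter

𝟙 : Bool → ℕ
𝟙 true  = 1
𝟙 false = 0

<ᵇ-true : ∀ {m n} → m ℕ.< n → (m <ᵇ n) ≡ true
<ᵇ-true {m} {n} m<n with m <ᵇ n | ℕ.<⇒<ᵇ m<n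
... | true | _ = ≡.refl

<ᵇ-false : ∀ {m n} → n ℕ.≤ m → (m <ᵇ n) ≡ false
<ᵇ-false {m} {n} n≤m with m <ᵇ n in eq
... | false = ≡.refl
... | true with () ← ℕ.<⇒≱ (ℕ.<ᵇ⇒< m n (≡.subst T (≡.sym eq) tt)) n≤m

Descending : List ℕ → Set
Descending = AllPairs ℕ._>_

desc : ℕ → List ℕ
desc = applyDownFrom suc

desc-descending : ∀ n → Descending (desc n)
desc-descending n = AllPairs.applyDownFrom⁺₁ suc n (λ j<i _ → s≤s j<i)

Descending-resp-⊆ : ∀ {U V} → U ⊆ V → Descending V → Descending U
Descending-resp-⊆ []             []         = []
Descending-resp-⊆ (skip _ p)     (_ ∷ d)    = Descending-resp-⊆ p d
Descending-resp-⊆ (≡.refl ∷ p)   (x> ∷ d)   = All-resp-⊆ p x> ∷ Descending-resp-⊆ p d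

less : ℕ → List ℕ → ℕ
less x w = sum (map (λ y → 𝟙 (y <ᵇ x)) w)

inv : List ℕ → List ℕ → ℕ
inv u v = sum (map (λ x → less x v) u)

desFrom : ℕ → List ℕ → ℕ
desFrom x []      = 0
desFrom x (y ∷ w) = 𝟙 (y <ᵇ x) ℕ.+ desFrom y w

desʷ : List ℕ → ℕ
desʷ []      = 0
desʷ (x ∷ w) = desFrom x w

-- The flag says whether an inversion of x with the next letter is admissible;
-- it is raised by the first letter above x.
adm : Bool → ℕ → List ℕ → ℕ
adm b x []      = 0
adm b x (y ∷ w) = 𝟙 (b ∧ (y <ᵇ x)) ℕ.+ adm (b ∨ (x <ᵇ y)) x w

aiFrom : ℕ → List ℕ → ℕ
aiFrom p []      = 0
aiFrom p (x ∷ w) = adm (p <ᵇ x) x w ℕ.+ aiFrom x w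

aiʷ : List ℕ → ℕ
aiʷ []      = 0
aiʷ (x ∷ w) = adm false x w ℕ.+ aiFrom x w

less-max : ∀ {m v} → All (ℕ._< m) v → less m v ≡ length v
less-max []             = ≡.refl
less-max (y<m ∷ v<m) rewrite <ᵇ-true y<m = ≡.cong suc (less-max v<m)

less-↭ : ∀ x {u v} → u ↭ v → less x u ≡ less x v
less-↭ x p = sum-↭ (↭.map⁺ _ p)

inv-↭ : ∀ {u u′ v v′} → u ↭ u′ → v ↭ v′ → inv u v ≡ inv u′ v′
inv-↭ {u} p p′ = ≡.trans (≡.cong sum (List.map-cong (λ x → less-↭ x p′) u)) (sum-↭ (↭.map⁺ _ p))

inv-∷ʳ-max : ∀ {m u} v → All (ℕ._< m) u → inv u (m ∷ v) ≡ inv u v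
inv-∷ʳ-max                 v []          = ≡.refl
inv-∷ʳ-max {m} {x ∷ u} v (x<m ∷ u<m) rewrite <ᵇ-false (ℕ.<⇒≤ x<m) =
  ≡.cong (less x v ℕ.+_) (inv-∷ʳ-max v u<m)

adm-true : ∀ x w → adm true x w ≡ less x w
adm-true x []      = ≡.refl
adm-true x (y ∷ w) = ≡.cong (𝟙 (y <ᵇ x) ℕ.+_) (adm-true x w)

adm-false-max : ∀ {m v} → All (ℕ._< m) v → adm false m v ≡ 0
adm-false-max []             = ≡.refl
adm-false-max {v = y ∷ _} (y<m ∷ v<m) rewrite <ᵇ-false (ℕ.<⇒≤ y<m) = adm-false-max v<m

-- The larger letter m raises the flag, so beyond m every letter below x forms an admissible
-- inversion with x.
adm-++ : ∀ b {x m} u v → x ℕ.< m → adm b x (u ++ m ∷ v) ≡ adm b x u ℕ.+ less x v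
adm-++ b {x} {m} [] v x<m
  rewrite <ᵇ-false (ℕ.<⇒≤ x<m) | <ᵇ-true x<m | ∨-zeroʳ b with b
... | true  = adm-true x v
... | false = adm-true x v
adm-++ b {x} (y ∷ u) v x<m = ≡.trans
  (≡.cong (𝟙 (b ∧ (y <ᵇ x)) ℕ.+_) (adm-++ _ u v x<m)) (≡.sym (ℕ.+-assoc (𝟙 (b ∧ (y <ᵇ x))) _ _))

aiFrom-max : ∀ {m v} → All (ℕ._< m) v → aiFrom m v ≡ aiʷ v
aiFrom-max []          = ≡.refl
aiFrom-max (y<m ∷ v<m) rewrite <ᵇ-false (ℕ.<⇒≤ y<m) = ≡.refl

private
  regroup : ∀ a b c d e → (a ℕ.+ b) ℕ.+ (c ℕ.+ d ℕ.+ e) ≡ (a ℕ.+ c) ℕ.+ (b ℕ.+ d) ℕ.+ e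
  regroup = solve 5 (λ a b c d e → (a :+ b) :+ (c :+ d :+ e) := (a :+ c) :+ (b :+ d) :+ e) ≡.refl
    where open +-*-Solver

-- All inversions between u and v are admissible because m lies between them. All `length v`
-- inversions of m are admissible because its left neighbour is smaller. The first letter of v
-- follows a larger letter, which is as good as following none.
aiFrom-++ : ∀ {p m} u v → p ℕ.< m → All (ℕ._< m) u → All (ℕ._< m) v →
            aiFrom p (u ++ m ∷ v) ≡ aiFrom p u ℕ.+ inv u v ℕ.+ (length v ℕ.+ aiʷ v)
aiFrom-++ [] v p<m [] v<m rewrite <ᵇ-true p<m =
  ≡.cong₂ ℕ._+_ (≡.trans (adm-true _ v) (less-max v<m)) (aiFrom-max v<m)
aiFrom-++ {p} (x ∷ u) v p<m (x<m ∷ u<m) v<m = ≡.trans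
  (≡.cong₂ ℕ._+_ (adm-++ (p <ᵇ x) u v x<m) (aiFrom-++ u v x<m u<m v<m))
  (regroup (adm (p <ᵇ x) x u) _ _ _ _)

-- In the first position the maximum has no left neighbour, and no letter exceeds it, so none of its
-- inversions is admissible. This is the exception that `maxFactor` corrects for k = 0.
ai-max∷ : ∀ {m v} → All (ℕ._< m) v → aiʷ (m ∷ v) ≡ aiʷ v
ai-max∷ v<m rewrite adm-false-max v<m = aiFrom-max v<m

ai-++ : ∀ {x m} u v → All (ℕ._< m) (x ∷ u) → All (ℕ._< m) v →
        aiʷ (x ∷ u ++ m ∷ v) ≡ aiʷ (x ∷ u) ℕ.+ inv (x ∷ u) v ℕ.+ (length v ℕ.+ aiʷ v)
ai-++ {x} u v (x<m ∷ u<m) v<m = ≡.trans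
  (≡.cong₂ ℕ._+_ (adm-++ false u v x<m) (aiFrom-++ u v x<m u<m v<m))
  (regroup (adm false x u) _ _ _ _)

desFrom-++ : ∀ {x m} u v → x ℕ.< m → All (ℕ._< m) u →
             desFrom x (u ++ m ∷ v) ≡ desFrom x u ℕ.+ desFrom m v
desFrom-++ [] v x<m [] rewrite <ᵇ-false (ℕ.<⇒≤ x<m) = ≡.refl
desFrom-++ {x} (y ∷ u) v x<m (y<m ∷ u<m) = ≡.trans
  (≡.cong (𝟙 (y <ᵇ x) ℕ.+_) (desFrom-++ u v y<m u<m)) (≡.sym (ℕ.+-assoc (𝟙 (y <ᵇ x)) _ _))

desFrom-max : ∀ {m y} v → y ℕ.< m → desFrom m (y ∷ v) ≡ suc (desʷ (y ∷ v))
desFrom-max v y<m rewrite <ᵇ-true y<m = ≡.refl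

-- The Riccati equation for A

module AdmissibleInversions {c ℓ} (R : CommutativeRing c ℓ) (q s : CommutativeRing.Carrier R) where
  open CommutativeRing R hiding (zero)
  open IntegerSolver R
  open QSequences R q
  open WordSums R
  open import Algebra.Properties.Semiring.Exp semiring using (_^_; ^-homo-*)
  open import Relation.Binary.Reasoning.Setoid setoid

  weight : List ℕ → Carrier
  weight w = q ^ aiʷ w * s ^ desʷ w

  A : Seq
  A n = wordSum n (desc n) weight

  -- For a maximal letter with k letters before and l letters after it: the
  -- generic factor s q^l, corrected for l = 0 and for k = 0.
  maxFactor : ℕ → ℕ → Carrier
  maxFactor k l = s * q ^ l + (1# - s) * δ l + s * (δ k * (1# - q ^ l))

  weight-max : ∀ {m} u v → All (ℕ._< m) u → All (ℕ._< m) v →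
    weight (u ++ m ∷ v) ≈ q ^ inv u v * (maxFactor (length u) (length v) * (weight u * weight v))
  weight-max [] [] _ _ = solve 1
    (λ s → :1 :* :1 := :1 :* ((s :* :1 :+ (:1 :- s) :* :1 :+ s :* (:1 :* (:1 :- :1))) :*
      (:1 :* :1 :* (:1 :* :1))))
    refl s
  weight-max {m} [] v@(_ ∷ v′) _ v<m@(y<m ∷ _) = begin
    q ^ aiʷ (m ∷ v) * s ^ desFrom m v
      ≡⟨ ≡.cong₂ (λ i j → q ^ i * s ^ j) (ai-max∷ v<m) (desFrom-max v′ y<m) ⟩
    q ^ aiʷ v * (s * s ^ desʷ v)
      ≈⟨ solve 4 (λ s a b p → a :* (s :* b) :=
           :1 :* ((s :* p :+ (:1 :- s) :* :0 :+ s :* (:1 :* (:1 :- p))) :* (:1 :* :1 :* (a :* b))))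
         refl s (q ^ aiʷ v) (s ^ desʷ v) (q ^ length v) ⟩
    1# * (maxFactor 0 (length v) * (weight [] * weight v)) ∎
  weight-max {m} (x ∷ u) [] u<m@(x<m ∷ u<m′) v<m = begin
    q ^ aiʷ (x ∷ u ++ m ∷ []) * s ^ desFrom x (u ++ m ∷ [])
      ≡⟨ ≡.cong₂ (λ i j → q ^ i * s ^ j) (ai-++ u [] u<m v<m) (desFrom-++ u [] x<m u<m′) ⟩
    q ^ (aiʷ (x ∷ u) ℕ.+ inv (x ∷ u) [] ℕ.+ 0) * s ^ (desʷ (x ∷ u) ℕ.+ 0)
      ≡⟨ ≡.cong₂ (λ i j → q ^ i * s ^ j) (ℕ.+-identityʳ (aiʷ (x ∷ u) ℕ.+ inv (x ∷ u) []))
           (ℕ.+-identityʳ (desʷ (x ∷ u))) ⟩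
    q ^ (aiʷ (x ∷ u) ℕ.+ inv (x ∷ u) []) * s ^ desʷ (x ∷ u)
      ≈⟨ *-congʳ (^-homo-* q (aiʷ (x ∷ u)) _) ⟩
    q ^ aiʷ (x ∷ u) * q ^ inv (x ∷ u) [] * s ^ desʷ (x ∷ u)
      ≈⟨ solve 4 (λ s a b i → a :* i :* b :=
           i :* ((s :* :1 :+ (:1 :- s) :* :1 :+ s :* (:0 :* (:1 :- :1))) :* (a :* b :* (:1 :* :1))))
         refl s (q ^ aiʷ (x ∷ u)) (s ^ desʷ (x ∷ u)) (q ^ inv (x ∷ u) []) ⟩
    q ^ inv (x ∷ u) [] * (maxFactor (length (x ∷ u)) 0 * (weight (x ∷ u) * weight [])) ∎
  weight-max {m} (x ∷ u) v@(_ ∷ v′) u<m@(x<m ∷ u<m′) v<m@(y<m ∷ _) = begin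
    q ^ aiʷ (x ∷ u ++ m ∷ v) * s ^ desFrom x (u ++ m ∷ v)
      ≡⟨ ≡.cong₂ (λ i j → q ^ i * s ^ j) (ai-++ u v u<m v<m)
           (≡.trans (desFrom-++ u v x<m u<m′) (≡.cong (desFrom x u ℕ.+_) (desFrom-max v′ y<m))) ⟩
    q ^ (aiʷ (x ∷ u) ℕ.+ inv (x ∷ u) v ℕ.+ (length v ℕ.+ aiʷ v)) * s ^ (desʷ (x ∷ u) ℕ.+ suc (desʷ v))
      ≈⟨ *-cong (trans (^-homo-* q (aiʷ (x ∷ u) ℕ.+ _) _)
           (*-cong (^-homo-* q (aiʷ (x ∷ u)) _) (^-homo-* q (length v) _)))
                (^-homo-* s (desʷ (x ∷ u)) _) ⟩
    q ^ aiʷ (x ∷ u) * q ^ inv (x ∷ u) v * (q ^ length v * q ^ aiʷ v)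
      * (s ^ desʷ (x ∷ u) * (s * s ^ desʷ v))
      ≈⟨ solve 7 (λ s a b i p a′ b′ → a :* i :* (p :* a′) :* (b :* (s :* b′)) :=
           i :* ((s :* p :+ (:1 :- s) :* :0 :+ s :* (:0 :* (:1 :- p))) :* (a :* b :* (a′ :* b′))))
         refl s (q ^ aiʷ (x ∷ u)) (s ^ desʷ (x ∷ u)) (q ^ inv (x ∷ u) v) (q ^ length v) (q ^ aiʷ v)
           (s ^ desʷ v) ⟩
    q ^ inv (x ∷ u) v * (maxFactor (length (x ∷ u)) (length v) * (weight (x ∷ u) * weight v)) ∎

  -- The greatest letter x goes either to the left, where it is inverted with all of S, or to the
  -- right, where it creates no inversion. This is the recursion `D-⋆`.
  splitSum-⋆ : ∀ {U} → Descending U → ∀ f g →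
    splitSum U (λ L S → q ^ inv L S * (f (length L) * g (length S))) ≈ (f ⋆ g) (length U)
  splitSum-⋆ []                f g = *-identityˡ _
  splitSum-⋆ {x ∷ U} (U<x ∷ d) f g = begin
    splitSum U (λ L S → q ^ inv (x ∷ L) S * (f (suc (length L)) * g (length S)))
      + splitSum U (λ L S → q ^ inv L (x ∷ S) * (f (length L) * g (suc (length S))))
      ≈⟨ +-cong (splitSum-cong U left) (splitSum-cong U right) ⟩
    splitSum U (λ L S → q ^ inv L S * (D f (length L) * η g (length S)))
      + splitSum U (λ L S → q ^ inv L S * (f (length L) * D g (length S)))
      ≈⟨ +-cong (splitSum-⋆ d (D f) (η g)) (splitSum-⋆ d f (D g)) ⟩
    (D f ⋆ η g) (length U) + (f ⋆ D g) (length U)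
      ≈⟨ +-comm _ _ ⟩
    (f ⋆ D g) (length U) + (D f ⋆ η g) (length U)
      ≈⟨ D-⋆ f g (length U) ⟨
    (f ⋆ g) (suc (length U)) ∎
    where
    left : ∀ L S → L ⊆ U → S ⊆ U → length L ℕ.+ length S ≡ length U →
           q ^ inv (x ∷ L) S * (f (suc (length L)) * g (length S)) ≈
           q ^ inv L S * (D f (length L) * η g (length S))
    left L S _ S⊆U _ = begin
      q ^ (less x S ℕ.+ inv L S) * (D f (length L) * g (length S))
        ≡⟨ ≡.cong (λ k → q ^ (k ℕ.+ inv L S) * (D f (length L) * g (length S)))
             (less-max (All-resp-⊆ S⊆U U<x)) ⟩
      q ^ (length S ℕ.+ inv L S) * (D f (length L) * g (length S))
        ≈⟨ *-congʳ (^-homo-* q (length S) _) ⟩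
      q ^ length S * q ^ inv L S * (D f (length L) * g (length S))
        ≈⟨ solve 4 (λ a b x y → a :* b :* (x :* y) := b :* (x :* (a :* y))) refl _ _ _ _ ⟩
      q ^ inv L S * (D f (length L) * η g (length S)) ∎
    right : ∀ L S → L ⊆ U → S ⊆ U → length L ℕ.+ length S ≡ length U →
            q ^ inv L (x ∷ S) * (f (length L) * g (suc (length S))) ≈
            q ^ inv L S * (f (length L) * D g (length S))
    right L S L⊆U _ _ = *-congʳ (reflexive (≡.cong (q ^_) (inv-∷ʳ-max S (All-resp-⊆ L⊆U U<x))))

  riccatiTerm : Seq
  riccatiTerm = A ⊕ s ⊙ (η A ⋆ A) ⊕ (- s) ⊙ η A

  OnDescending : ℕ → Set ℓ
  OnDescending n = ∀ U → length U ℕ.≤ n → Descending U → wordSum (length U) U weight ≈ A (length U)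

  wordSum-max : ∀ {n} → OnDescending n → ∀ m U → length U ℕ.≤ n → Descending (m ∷ U) →
                wordSum (suc (length U)) (m ∷ U) weight ≈ riccatiTerm (length U)
  wordSum-max ih m U ∣U∣≤n (U<m ∷ d) = begin
    wordSum (suc (length U)) (m ∷ U) weight
      ≈⟨ wordSum-split m U weight ⟩
    splitSum U (λ L S → wordSum (length L) L (λ u → wordSum (length S) S (λ v → weight (u ++ m ∷ v))))
      ≈⟨ splitSum-cong U piece ⟩
    splitSum U (λ L S → F₁ L S + F₂ L S + F₃ L S)
      ≈⟨ trans (splitSum-+ U _ F₃) (+-congʳ (splitSum-+ U F₁ F₂)) ⟩
    splitSum U F₁ + splitSum U F₂ + splitSum U F₃
      -- One product for each summand of `maxFactor`: the correction for l = 0 puts `δ` in the right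
      -- factor, the correction for k = 0 puts it in the left one.
      ≈⟨ +-cong (+-cong (splitSum-⋆ d (s ⊙ A) (η A)) (splitSum-⋆ d ((1# - s) ⊙ A) δ))
                (splitSum-⋆ d (s ⊙ δ) (A ⊕ (- 1#) ⊙ η A)) ⟩
    ((s ⊙ A) ⋆ η A) ∣U∣ + (((1# - s) ⊙ A) ⋆ δ) ∣U∣ + ((s ⊙ δ) ⋆ (A ⊕ (- 1#) ⊙ η A)) ∣U∣
      ≈⟨ +-cong (+-cong (trans (⋆-⊙ˡ s A (η A) ∣U∣) (*-congˡ (⋆-comm A (η A) ∣U∣)))
                        (trans (⋆-⊙ˡ (1# - s) A δ ∣U∣) (*-congˡ (trans (⋆-comm A δ ∣U∣) (δ-⋆ A ∣U∣)))))
                (trans (⋆-⊙ˡ s δ _ ∣U∣) (*-congˡ (δ-⋆ _ ∣U∣))) ⟩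
    s * (η A ⋆ A) ∣U∣ + (1# - s) * A ∣U∣ + s * (A ∣U∣ + - 1# * η A ∣U∣)
      ≈⟨ solve 4 (λ s c a e → s :* c :+ (:1 :- s) :* a :+ s :* (a :+ (:- :1) :* e) :=
           a :+ s :* c :+ (:- s) :* e)
           refl s _ _ _ ⟩
    riccatiTerm ∣U∣ ∎
    where
    ∣U∣ = length U
    F₁ F₂ F₃ : List ℕ → List ℕ → Carrier
    F₁ L S = q ^ inv L S * ((s ⊙ A) (length L) * η A (length S))
    F₂ L S = q ^ inv L S * (((1# - s) ⊙ A) (length L) * δ (length S))
    F₃ L S = q ^ inv L S * ((s ⊙ δ) (length L) * (A ⊕ (- 1#) ⊙ η A) (length S))

    expand : ∀ k l → maxFactor k l * (A k * A l) ≈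
      (s ⊙ A) k * η A l + ((1# - s) ⊙ A) k * δ l + (s ⊙ δ) k * (A ⊕ (- 1#) ⊙ η A) l
    expand zero zero = solve 1
      (λ s → (s :* :1 :+ (:1 :- s) :* :1 :+ s :* (:1 :* (:1 :- :1))) :* (:1 :* :1 :* (:1 :* :1))
        := (s :* (:1 :* :1)) :* (:1 :* (:1 :* :1)) :+ ((:1 :- s) :* (:1 :* :1)) :* :1
           :+ (s :* :1) :* (:1 :* :1 :+ (:- :1) :* (:1 :* (:1 :* :1)))) refl s
    expand zero (suc l) = solve 3
      (λ s p b → (s :* p :+ (:1 :- s) :* :0 :+ s :* (:1 :* (:1 :- p))) :* (:1 :* :1 :* b)
        := (s :* (:1 :* :1)) :* (p :* b) :+ ((:1 :- s) :* (:1 :* :1)) :* :0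
           :+ (s :* :1) :* (b :+ (:- :1) :* (p :* b))) refl s (q ^ suc l) (A (suc l))
    expand (suc k) zero = solve 2
      (λ s a → (s :* :1 :+ (:1 :- s) :* :1 :+ s :* (:0 :* (:1 :- :1))) :* (a :* (:1 :* :1))
        := (s :* a) :* (:1 :* (:1 :* :1)) :+ ((:1 :- s) :* a) :* :1
           :+ (s :* :0) :* (:1 :* :1 :+ (:- :1) :* (:1 :* (:1 :* :1)))) refl s (A (suc k))
    expand (suc k) (suc l) = solve 4
      (λ s p a b → (s :* p :+ (:1 :- s) :* :0 :+ s :* (:0 :* (:1 :- p))) :* (a :* b)
        := (s :* a) :* (p :* b) :+ ((:1 :- s) :* a) :* :0
           :+ (s :* :0) :* (b :+ (:- :1) :* (p :* b))) refl s (q ^ suc l) (A (suc k)) (A (suc l))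

    piece : ∀ L S → L ⊆ U → S ⊆ U → length L ℕ.+ length S ≡ length U →
      wordSum (length L) L (λ u → wordSum (length S) S (λ v → weight (u ++ m ∷ v))) ≈
        F₁ L S + F₂ L S + F₃ L S
    piece L S L⊆U S⊆U len = begin
      wordSum k L (λ u → wordSum l S (λ v → weight (u ++ m ∷ v)))
        ≈⟨ wordSum-cong-↭ k L ≡.refl (λ u u↭L → trans
             (wordSum-cong-↭ l S ≡.refl (λ v v↭S → pair u v u↭L v↭S)) (wordSum-* l S _ weight)) ⟩
      wordSum k L (λ u → p * weight u * wordSum l S weight)
        ≈⟨ wordSum-cong k L (λ u → solve 3 (λ p x y → p :* x :* y := p :* y :* x) refl _ _ _) ⟩
      wordSum k L (λ u → p * wordSum l S weight * weight u)
        ≈⟨ wordSum-* k L _ weight ⟩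
      p * wordSum l S weight * wordSum k L weight
        ≈⟨ *-cong (*-congˡ (ih S (ℕ.≤-trans (ℕ.m+n≤o⇒n≤o k (ℕ.≤-reflexive len)) ∣U∣≤n)
             (Descending-resp-⊆ S⊆U d)))
                  (ih L (ℕ.≤-trans (ℕ.m+n≤o⇒m≤o k (ℕ.≤-reflexive len)) ∣U∣≤n)
                    (Descending-resp-⊆ L⊆U d)) ⟩
      q ^ inv L S * maxFactor k l * A l * A k
        ≈⟨ solve 4 (λ i f b a → i :* f :* b :* a := i :* (f :* (a :* b))) refl _ _ _ _ ⟩
      q ^ inv L S * (maxFactor k l * (A k * A l))
        ≈⟨ *-congˡ (expand k l) ⟩
      q ^ inv L S * ((s ⊙ A) k * η A l + ((1# - s) ⊙ A) k * δ l + (s ⊙ δ) k * (A ⊕ (- 1#) ⊙ η A) l)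
        ≈⟨ trans (distribˡ _ _ _) (+-congʳ (distribˡ _ _ _)) ⟩
      F₁ L S + F₂ L S + F₃ L S ∎
      where
      k = length L
      l = length S
      p = q ^ inv L S * maxFactor k l

      pair : ∀ u v → u ↭ L → v ↭ S → weight (u ++ m ∷ v) ≈ p * weight u * weight v
      pair u v u↭L v↭S = begin
        weight (u ++ m ∷ v)
          ≈⟨ weight-max u v (All-resp-↭ (↭-sym u↭L) (All-resp-⊆ L⊆U U<m))
                            (All-resp-↭ (↭-sym v↭S) (All-resp-⊆ S⊆U U<m)) ⟩
        q ^ inv u v * (maxFactor (length u) (length v) * (weight u * weight v))
          ≡⟨ ≡.cong₂ (λ i f → q ^ i * (f * (weight u * weight v)))
               (inv-↭ u↭L v↭S) (≡.cong₂ maxFactor (↭-length u↭L) (↭-length v↭S)) ⟩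
        q ^ inv L S * (maxFactor k l * (weight u * weight v))
          ≈⟨ solve 4 (λ i f x y → i :* (f :* (x :* y)) := i :* f :* x :* y) refl _ _ _ _ ⟩
        p * weight u * weight v ∎

  A-suc : ∀ {n} → OnDescending n → ∀ k → k ℕ.≤ n → A (suc k) ≈ riccatiTerm k
  A-suc ih k k≤n = ≡.subst (λ j → wordSum (suc j) (desc (suc k)) weight ≈ riccatiTerm j)
    (List.length-applyDownFrom suc k)
    (wordSum-max ih (suc k) (desc k) (ℕ.≤-trans (ℕ.≤-reflexive (List.length-applyDownFrom suc k)) k≤n)
      (desc-descending (suc k)))

  -- Instead of relabelling U by 1, ..., n, both alphabets are expanded at their greatest letter;
  -- the results are the same `riccatiTerm`.
  onDescending : ∀ n → OnDescending n
  onDescending n       []      _           _ = refl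
  onDescending (suc n) (m ∷ U) (s≤s ∣U∣≤n) d =
    trans (wordSum-max (onDescending n) m U ∣U∣≤n d) (sym (A-suc (onDescending n) (length U) ∣U∣≤n))

  A-riccati : D A ≋ riccatiTerm
  A-riccati n = A-suc (onDescending n) n ℕ.≤-refl

-- Solving the Riccati equation

module Linearisation {c ℓ} (R : CommutativeRing c ℓ) (q s : CommutativeRing.Carrier R) where
  open CommutativeRing R hiding (zero)
  open IntegerSolver R
  open QSequences R q
  open import Algebra.Properties.Semiring.Exp semiring using (_^_)
  open import Relation.Binary.Reasoning.Setoid setoid

  -- geo, sgn and num are (-s)ⁿ, (-1)ⁿ and (-1)ⁿ (1 + s + ⋯ + sⁿ).
  geo sgn num : Seq
  geo n = (- s) ^ n
  sgn n = (- 1#) ^ n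
  num zero    = 1#
  num (suc n) = - num n + geo (suc n)

  -- The geometric sum in the form 1 + s (1 + ⋯ + sⁿ). It expresses `num ∘ suc` by `sgn` and `num`,
  -- on which the induction in `marked-num` relies.
  num-suc : ∀ n → num (suc n) ≈ - sgn n + - s * num n
  num-suc zero    = solve 1 (λ s → :- :1 :+ :- s :* :1 := :- :1 :+ :- s :* :1) refl s
  num-suc (suc n) = begin
    - num (suc n) + - s * geo (suc n)
      ≈⟨ +-congʳ (-‿cong (num-suc n)) ⟩
    - (- sgn n + - s * num n) + - s * geo (suc n)
      ≈⟨ solve 4 (λ s e p w → :- (:- e :+ :- s :* p) :+ :- s :* w :=
           :- (:- :1 :* e) :+ :- s :* (:- p :+ w))
           refl s (sgn n) (num n) (geo (suc n)) ⟩
    - (- 1# * sgn n) + - s * num (suc n) ∎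

  gauss-cong : ∀ {γ γ′} → γ ≋ γ′ → gauss γ ≋ gauss γ′
  gauss-cong γ≋ zero    = γ≋ 0
  gauss-cong γ≋ (suc n) = *-congˡ (gauss-cong (γ≋ ∘ suc) n)

  gauss-⊕ : ∀ γ γ′ → gauss (γ ⊕ γ′) ≋ gauss γ ⊕ gauss γ′
  gauss-⊕ γ γ′ zero    = refl
  gauss-⊕ γ γ′ (suc n) = trans (*-congˡ (gauss-⊕ (γ ∘ suc) (γ′ ∘ suc) n)) (distribˡ _ _ _)

  gauss-⊙ : ∀ a γ → gauss (a ⊙ γ) ≋ a ⊙ gauss γ
  gauss-⊙ a γ zero    = refl
  gauss-⊙ a γ (suc n) = trans (*-congˡ (gauss-⊙ a (γ ∘ suc) n))
    (solve 3 (λ p a x → p :* (a :* x) := a :* (p :* x)) refl _ _ _)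

  W P : Seq
  W = gauss geo
  P = gauss num

  D-W : D W ≋ (- s) ⊙ η W
  D-W n = trans (*-congˡ (gauss-⊙ (- s) geo n))
    (solve 3 (λ p a x → p :* (a :* x) := a :* (p :* x)) refl _ _ _)

  D-P : D P ≋ (- 1#) ⊙ η P ⊕ (- s) ⊙ η W
  D-P n = begin
    q ^ n * gauss (num ∘ suc) n
      ≈⟨ *-congˡ (gauss-cong (λ k → solve 3
           (λ p s g → :- p :+ (:- s) :* g := (:- :1) :* p :+ (:- s) :* g) refl (num k) s (geo k)) n) ⟩
    q ^ n * gauss ((- 1#) ⊙ num ⊕ (- s) ⊙ geo) n
      ≈⟨ *-congˡ (trans (gauss-⊕ ((- 1#) ⊙ num) ((- s) ⊙ geo) n)
           (+-cong (gauss-⊙ (- 1#) num n) (gauss-⊙ (- s) geo n))) ⟩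
    q ^ n * (- 1# * P n + - s * W n)
      ≈⟨ solve 4 (λ x s p w → x :* (:- :1 :* p :+ :- s :* w) := :- :1 :* (x :* p) :+ :- s :* (x :* w))
           refl (q ^ n) s (P n) (W n) ⟩
    - 1# * η P n + - s * η W n ∎

  module _ (A : Seq) (A₀ : A 0 ≈ 1#) (riccati : D A ≋ A ⊕ s ⊙ (η A ⋆ A) ⊕ (- s) ⊙ η A) where

    private
      Δ : Seq
      Δ = P ⋆ A ⊕ (- 1#) ⊙ W

      D-P⋆A : ∀ n → D (P ⋆ A) n ≈ - s * (η W ⋆ A) n + (s * ((η P ⋆ η A) ⋆ A) n + - s * (η P ⋆ η A) n)
      D-P⋆A n = begin
        (D P ⋆ A) n + (η P ⋆ D A) n
          ≈⟨ +-cong (trans (⋆-congʳ D-P n)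
               (trans (⋆-⊕ˡ _ _ A n) (+-cong (⋆-⊙ˡ (- 1#) (η P) A n) (⋆-⊙ˡ (- s) (η W) A n))))
                    (trans (⋆-congˡ riccati n) (trans (⋆-⊕ʳ (η P) (A ⊕ s ⊙ (η A ⋆ A)) ((- s) ⊙ η A) n)
                      (+-cong (trans (⋆-⊕ʳ (η P) A (s ⊙ (η A ⋆ A)) n)
                        (+-congˡ (trans (⋆-⊙ʳ s (η P) (η A ⋆ A) n)
                          (*-congˡ (sym (⋆-assoc (η P) (η A) A n))))))
                        (⋆-⊙ʳ (- s) (η P) (η A) n)))) ⟩
        - 1# * (η P ⋆ A) n + - s * (η W ⋆ A) n
          + ((η P ⋆ A) n + s * ((η P ⋆ η A) ⋆ A) n + - s * (η P ⋆ η A) n)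
          ≈⟨ solve 5 (λ s a b c d → :- :1 :* a :+ :- s :* b :+ (a :+ s :* c :+ :- s :* d) :=
               :- s :* b :+ (s :* c :+ :- s :* d))
               refl s _ _ _ _ ⟩
        - s * (η W ⋆ A) n + (s * ((η P ⋆ η A) ⋆ A) n + - s * (η P ⋆ η A) n) ∎

      -- The summand -ηP of `D P` cancels the linear term of the Riccati equation, and the two W
      -- terms complete the rest to Δ. The equation is homogeneous in ηΔ, so Δ vanishes with its
      -- initial value.
      D-Δ : ∀ n → Δ (suc n) ≈ s * (η Δ ⋆ A) n + - s * η Δ n
      D-Δ n = begin
        D (P ⋆ A) n + - 1# * D W n
          ≈⟨ +-cong (D-P⋆A n) (*-congˡ (D-W n)) ⟩
        - s * (η W ⋆ A) n + (s * ((η P ⋆ η A) ⋆ A) n + - s * (η P ⋆ η A) n) + - 1# * (- s * η W n)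
          ≈⟨ solve 5 (λ s a b c d → :- s :* a :+ (s :* b :+ :- s :* c) :+ :- :1 :* (:- s :* d)
               := s :* (b :+ :- :1 :* a) :+ :- s :* (c :+ :- :1 :* d)) refl s _ _ _ _ ⟩
        s * (((η P ⋆ η A) ⋆ A) n + - 1# * (η W ⋆ A) n) + - s * ((η P ⋆ η A) n + - 1# * η W n)
          ≈⟨ +-cong (*-congˡ (trans (+-congˡ (sym (⋆-⊙ˡ (- 1#) (η W) A n))) (sym (⋆-⊕ˡ _ _ A n))))
               refl ⟩
        s * (((η P ⋆ η A) ⊕ (- 1#) ⊙ η W) ⋆ A) n + - s * ((η P ⋆ η A) ⊕ (- 1#) ⊙ η W) n
          ≈⟨ +-cong (*-congˡ (⋆-congʳ η-Δ n)) (*-congˡ (η-Δ n)) ⟨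
        s * (η Δ ⋆ A) n + - s * η Δ n ∎
        where
        η-Δ : η Δ ≋ (η P ⋆ η A) ⊕ (- 1#) ⊙ η W
        η-Δ n = begin
          q ^ n * ((P ⋆ A) n + - 1# * W n)
            ≈⟨ solve 3 (λ p x w → p :* (x :+ :- :1 :* w) := p :* x :+ :- :1 :* (p :* w)) refl _ _ _ ⟩
          η (P ⋆ A) n + - 1# * η W n
            ≈⟨ +-congʳ (η-⋆ P A n) ⟩
          (η P ⋆ η A) n + - 1# * η W n ∎

      Δ≈0 : ∀ n k → k ℕ.≤ n → Δ k ≈ 0#
      Δ≈0 n       zero    _         = begin
        1# * A 0 + - 1# * 1#   ≈⟨ +-congʳ (*-congˡ A₀) ⟩
        1# * 1# + - 1# * 1#    ≈⟨ solve 0 (:1 :* :1 :+ :- :1 :* :1 := :0) refl ⟩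
        0#                     ∎
      Δ≈0 (suc n) (suc k) (s≤s k≤n) = begin
        Δ (suc k)                               ≈⟨ D-Δ k ⟩
        s * (η Δ ⋆ A) k + - s * η Δ k           ≈⟨ +-cong (*-congˡ (⋆-zeroˡ≤ A k vanish))
          (*-congˡ (vanish k ℕ.≤-refl)) ⟩
        s * 0# + - s * 0#                       ≈⟨ solve 1 (λ s → s :* :0 :+ :- s :* :0 := :0) refl s ⟩
        0#                                      ∎
        where
        vanish : ∀ j → j ℕ.≤ k → η Δ j ≈ 0#
        vanish j j≤k = trans (*-congˡ (Δ≈0 n j (ℕ.≤-trans j≤k k≤n))) (zeroʳ _)

    P⋆riccati : P ⋆ A ≋ W
    P⋆riccati n = begin
      (P ⋆ A) n                        ≈⟨ solve 2 (λ x w → x := x :+ :- :1 :* w :+ w) refl _ (W n) ⟩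
      Δ n + W n                        ≈⟨ +-congʳ (Δ≈0 n n ℕ.≤-refl) ⟩
      0# + W n                         ≈⟨ +-identityˡ _ ⟩
      W n                              ∎

-- Sums over compositions and the marking of blocks

-- Φ N n is the sum over all compositions b of n of N b times ∏ q^i over the
-- sums i of the proper suffixes of b and ∏ (1 - q^i) over the other 0 < i < n.
-- Up to division by (q;q)ₙ this is the stable principal specialisation of the
-- quasisymmetric function with monomial coefficients N, so that multiplying it
-- by gauss γ amounts to marking some blocks (see mark): the coefficient is
-- γ k when k blocks are marked, and a marked block gives up one letter.
module Compositions {c ℓ} (R : CommutativeRing c ℓ) (q : CommutativeRing.Carrier R) where
  open CommutativeRing R hiding (zero)
  open IntegerSolver R
  open QSequences R q
  open WordSums R
  open import Algebra.Properties.Semiring.Exp semiring using (_^_)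
  open import Relation.Binary.Reasoning.Setoid setoid

  Positive : List ℕ → Set
  Positive = All (0 ℕ.<_)

  mutual
    Φ : (List ℕ → Carrier) → Seq
    Φ N zero    = N []
    Φ N (suc n) = Ψ (λ l b → N (suc l ∷ b)) n

    -- The first block is under construction: it has l letters so far.
    Ψ : (ℕ → List ℕ → Carrier) → Seq
    Ψ N zero    = N 0 []
    -- With suc n letters left, the first block is either closed here, for the factor q^(suc n), or
    -- given one more letter.
    Ψ N (suc n) = q ^ suc n * Φ (N 0) (suc n) + (1# - q ^ suc n) * Ψ (N ∘ suc) n

  mutual
    Φ-cong : ∀ n {N N′} → (∀ b → Positive b → sum b ≡ n → N b ≈ N′ b) → Φ N n ≈ Φ N′ n
    Φ-cong zero    eq = eq [] [] ≡.refl
    Φ-cong (suc n) eq = Ψ-cong n (λ l b b>0 len → eq (suc l ∷ b) (s≤s z≤n ∷ b>0) (≡.cong suc len))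

    Ψ-cong : ∀ n {N N′} → (∀ l b → Positive b → l ℕ.+ sum b ≡ n → N l b ≈ N′ l b) → Ψ N n ≈ Ψ N′ n
    Ψ-cong zero    eq = eq 0 [] [] ≡.refl
    Ψ-cong (suc n) eq = +-cong (*-congˡ (Φ-cong (suc n) (eq 0)))
      (*-congˡ (Ψ-cong n (λ l b b>0 len → eq (suc l) b b>0 (≡.cong suc len))))

  mutual
    Φ-+ : ∀ n N N′ → Φ (λ b → N b + N′ b) n ≈ Φ N n + Φ N′ n
    Φ-+ zero    N N′ = refl
    Φ-+ (suc n) N N′ = Ψ-+ n _ _

    Ψ-+ : ∀ n N N′ → Ψ (λ l b → N l b + N′ l b) n ≈ Ψ N n + Ψ N′ n
    Ψ-+ zero    N N′ = refl
    Ψ-+ (suc n) N N′ = trans (+-cong (*-congˡ (Φ-+ (suc n) (N 0) (N′ 0)))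
      (*-congˡ (Ψ-+ n (N ∘ suc) (N′ ∘ suc))))
      (solve 6 (λ p p′ a b c d → p :* (a :+ b) :+ p′ :* (c :+ d) :=
        p :* a :+ p′ :* c :+ (p :* b :+ p′ :* d))
        refl _ _ _ _ _ _)

  mutual
    Φ-* : ∀ n a N → Φ (λ b → a * N b) n ≈ a * Φ N n
    Φ-* zero    a N = refl
    Φ-* (suc n) a N = Ψ-* n a _

    Ψ-* : ∀ n a N → Ψ (λ l b → a * N l b) n ≈ a * Ψ N n
    Ψ-* zero    a N = refl
    Ψ-* (suc n) a N = trans (+-cong (*-congˡ (Φ-* (suc n) a (N 0))) (*-congˡ (Ψ-* n a (N ∘ suc))))
      (solve 5 (λ p p′ a x y → p :* (a :* x) :+ p′ :* (a :* y) := a :* (p :* x :+ p′ :* y)) refl _ _ _ _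
        _)

  Ψ-0 : ∀ n → Ψ (λ l b → 0#) n ≈ 0#
  Ψ-0 n = begin
    Ψ (λ l b → 0#) n         ≈⟨ Ψ-cong n (λ _ _ _ _ → sym (zeroˡ 0#)) ⟩
    Ψ (λ l b → 0# * 0#) n    ≈⟨ Ψ-* n 0# _ ⟩
    0# * Ψ (λ l b → 0#) n    ≈⟨ zeroˡ _ ⟩
    0#                       ∎

  Ψ-pickSum : ∀ {a} {A : Set a} n (U : List A) (N : A → List A → ℕ → List ℕ → Carrier) →
              Ψ (λ l b → pickSum U (λ x r → N x r l b)) n ≈ pickSum U (λ x r → Ψ (N x r) n)
  Ψ-pickSum n []      N = Ψ-0 n
  Ψ-pickSum n (u ∷ U) N = trans (Ψ-+ n (N u U) _) (+-congˡ (Ψ-pickSum n U (λ x r → N x (u ∷ r))))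

  Φ-δ : ∀ {N} → N [] ≈ 1# → (∀ l b → Positive (suc l ∷ b) → N (suc l ∷ b) ≈ 0#) → Φ N ≋ δ
  Φ-δ N[] N∷ zero    = N[]
  Φ-δ N[] N∷ (suc n) = trans (Ψ-cong n (λ l b b>0 _ → N∷ l b (s≤s z≤n ∷ b>0))) (Ψ-0 n)

  Ψ-unfold : ∀ N → Ψ N ≋ η (Φ (N 0)) ⊕ Z (Ψ (N ∘ suc))
  Ψ-unfold N zero    = solve 1 (λ x → x := :1 :* x :+ :0) refl (N 0 [])
  Ψ-unfold N (suc n) = refl

  mark : Seq → (List ℕ → Carrier) → List ℕ → Carrier
  mark γ N []          = γ 0 * N []
  mark γ N (zero ∷ b)  = mark γ (λ b → N (0 ∷ b)) b
  mark γ N (suc l ∷ b) = mark γ (λ b → N (suc l ∷ b)) b + mark (γ ∘ suc) (λ b → N (l ∷ b)) b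

  -- A marked block of one letter shrinks to size 0 and must then count as absent, like a variable
  -- with exponent 0.
  ZeroInvariant : (List ℕ → Carrier) → Set ℓ
  ZeroInvariant N = ∀ c b → N (c ++ 0 ∷ b) ≈ N (c ++ b)

  -- The functional equation G(z) = G(qz) + z G⁺(qz), where G and G⁺ are the series of `gauss γ` and
  -- `gauss (γ ∘ suc)`.
  gauss-⋆-η : ∀ γ f → gauss γ ⋆ η f ≋ η (gauss γ ⋆ f) ⊕ Z (η (gauss (γ ∘ suc) ⋆ f))
  gauss-⋆-η γ f n = begin
    (gauss γ ⋆ η f) n
      ≈⟨ ⋆-congʳ (η+ZD (gauss γ)) n ⟩
    ((η (gauss γ) ⊕ Z (η (gauss (γ ∘ suc)))) ⋆ η f) n
      ≈⟨ ⋆-⊕ˡ (η (gauss γ)) (Z (η (gauss (γ ∘ suc)))) (η f) n ⟩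
    (η (gauss γ) ⋆ η f) n + (Z (η (gauss (γ ∘ suc))) ⋆ η f) n
      ≈⟨ +-cong (sym (η-⋆ (gauss γ) f n))
                (trans (Z-⋆ _ (η f) n) (Z-cong (λ k → sym (η-⋆ (gauss (γ ∘ suc)) f k)) n)) ⟩
    η (gauss γ ⋆ f) n + Z (η (gauss (γ ∘ suc) ⋆ f)) n ∎

  mutual
    -- Since e_k(1, q, q², ...) = q^C(k,2) / (q;q)ₖ, the series of `gauss γ` specialises ∑ γ k e_k.
    -- Multiplication by e_k raises the exponents of k distinct variables by one; the blocks of
    -- these variables are the marked ones.
    gauss-⋆-Φ : ∀ n γ N → ZeroInvariant N → (gauss γ ⋆ Φ N) n ≈ Φ (mark γ N) n
    gauss-⋆-Φ zero    γ N inv = refl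
    gauss-⋆-Φ (suc n) γ N inv = begin
      (gauss γ ⋆ Φ N) (suc n)
        ≈⟨ D-⋆ (gauss γ) (Φ N) n ⟩
      (gauss γ ⋆ Ψ (λ l b → N (suc l ∷ b))) n + (η (gauss (γ ∘ suc)) ⋆ η (Φ N)) n
        -- The letter that `D` takes from `gauss γ` is the mark of a first block with no other
        -- letter so far, hence the empty block in front of b.
        ≈⟨ +-congˡ (trans (sym (η-⋆ (gauss (γ ∘ suc)) (Φ N) n))
             (*-congˡ (⋆-congˡ (λ k → Φ-cong k (λ b _ _ → sym (inv [] b))) n))) ⟩
      (gauss γ ⋆ Ψ (λ l b → N (suc l ∷ b))) n + η (gauss (γ ∘ suc) ⋆ Φ (λ b → N (0 ∷ b))) n
        ≈⟨ gauss-⋆-Ψ n γ (λ l b → N (l ∷ b)) (λ l c b → inv (l ∷ c) b) ⟩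
      Φ (mark γ N) (suc n) ∎

    gauss-⋆-Ψ : ∀ n γ (N : ℕ → List ℕ → Carrier) → (∀ l → ZeroInvariant (N l)) →
      (gauss γ ⋆ Ψ (N ∘ suc)) n + η (gauss (γ ∘ suc) ⋆ Φ (N 0)) n ≈
      Ψ (λ l b → mark γ (N (suc l)) b + mark (γ ∘ suc) (N l) b) n
    gauss-⋆-Ψ zero    γ N inv = +-congˡ (*-identityˡ _)
    gauss-⋆-Ψ (suc n) γ N inv = begin
      (G ⋆ Ψ (N ∘ suc)) (suc n) + η (G⁺ ⋆ Φ (N 0)) (suc n)
        ≈⟨ +-congʳ (trans (⋆-congˡ (Ψ-unfold (N ∘ suc)) (suc n)) (trans (⋆-⊕ʳ G _ _ (suc n))
             (+-cong (gauss-⋆-η γ (Φ (N 1)) (suc n)) (⋆-Z G (Ψ (N ∘ (2 ℕ.+_))) (suc n))))) ⟩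
      q ^ suc n * (G ⋆ Φ (N 1)) (suc n) + (1# - q ^ suc n) * η (G⁺ ⋆ Φ (N 1)) n
        + (1# - q ^ suc n) * (G ⋆ Ψ (N ∘ (2 ℕ.+_))) n + q ^ suc n * (G⁺ ⋆ Φ (N 0)) (suc n)
        ≈⟨ solve 6 (λ p p′ a b c d → p :* a :+ p′ :* b :+ p′ :* c :+ p :* d :=
             p :* (a :+ d) :+ p′ :* (c :+ b))
             refl _ _ _ _ _ _ ⟩
      q ^ suc n * ((G ⋆ Φ (N 1)) (suc n) + (G⁺ ⋆ Φ (N 0)) (suc n))
        + (1# - q ^ suc n) * ((G ⋆ Ψ (N ∘ (2 ℕ.+_))) n + η (G⁺ ⋆ Φ (N 1)) n)
        ≈⟨ +-cong (*-congˡ (+-cong (gauss-⋆-Φ (suc n) γ (N 1) (inv 1))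
             (gauss-⋆-Φ (suc n) (γ ∘ suc) (N 0) (inv 0))))
                  (*-congˡ (gauss-⋆-Ψ n γ (N ∘ suc) (inv ∘ suc))) ⟩
      q ^ suc n * (Φ (mark γ (N 1)) (suc n) + Φ (mark (γ ∘ suc) (N 0)) (suc n)) + (1# - q ^ suc n)
        * Ψ _ n
        ≈⟨ +-congʳ (*-congˡ (Φ-+ (suc n) (mark γ (N 1)) (mark (γ ∘ suc) (N 0)))) ⟨
      Ψ (λ l b → mark γ (N (suc l)) b + mark (γ ∘ suc) (N l) b) (suc n) ∎
      where
      G  = gauss γ
      G⁺ = gauss (γ ∘ suc)

-- Barred words: maj - exc as a sum over descents

-- Words are read backwards from here on, so that the position of the head of a
-- word is its length. A letter is barred when it exceeds its position.
barred : ℕ → List ℕ → Bool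
barred x w = suc (length w) <ᵇ x

-- Whether y, barred or not, is below its right neighbour x when all barred
-- letters precede all unbarred ones; b and c are the bars of x and y.
below : Bool → ℕ → Bool → ℕ → Bool
below true  x true  y = y <ᵇ x
below true  x false y = false
below false x true  y = true
below false x false y = y <ᵇ x

excʳ : List ℕ → ℕ
excʳ []      = 0
excʳ (x ∷ w) = 𝟙 (barred x w) ℕ.+ excʳ w

majFrom : ℕ → List ℕ → ℕ
majFrom x []      = 0
majFrom x (y ∷ w) = 𝟙 (not (y <ᵇ x)) ℕ.* suc (length w) ℕ.+ majFrom y w

majʳ : List ℕ → ℕ
majʳ []      = 0
majʳ (x ∷ w) = majFrom x w

dexFrom : Bool → ℕ → List ℕ → ℕ
dexFrom b x []      = 0
dexFrom b x (y ∷ w) = 𝟙 (not (below b x (barred y w) y)) ℕ.* suc (length w) ℕ.+ dexFrom (barred y w) y w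

dexʳ : List ℕ → ℕ
dexʳ []      = 0
dexʳ (x ∷ w) = dexFrom (barred x w) x w

-- With equal bars both orders agree. If only x is barred, then y ≤ n < x is an ascent of the plain
-- word but a descent of the barred one. If only y is barred, then x ≤ suc n ≤ y, and the roles are
-- exchanged.
descents-bars : ∀ x y n → let b = suc n <ᵇ x ; c = n <ᵇ y in
  𝟙 (not (y <ᵇ x)) ℕ.+ 𝟙 b ≡ 𝟙 (not (below b x c y)) ℕ.+ 𝟙 c
descents-bars x y n with suc n ℕ.<? x | n ℕ.<? y
... | yes b | yes c rewrite <ᵇ-true b | <ᵇ-true c = ≡.refl
... | yes b | no ¬c rewrite <ᵇ-true b | <ᵇ-false (ℕ.≮⇒≥ ¬c)
                          | <ᵇ-true (ℕ.≤-<-trans (ℕ.≮⇒≥ ¬c) (ℕ.<-trans (ℕ.n<1+n n) b)) = ≡.refl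
... | no ¬b | yes c rewrite <ᵇ-false (ℕ.≮⇒≥ ¬b) | <ᵇ-true c
                          | <ᵇ-false (ℕ.≤-trans (ℕ.≮⇒≥ ¬b) c) = ≡.refl
... | no ¬b | no ¬c rewrite <ᵇ-false (ℕ.≮⇒≥ ¬b) | <ᵇ-false (ℕ.≮⇒≥ ¬c) = ≡.refl

-- Summation by parts of `descents-bars`: a bar at position i enters with weight i on one side and i
-- - 1 on the other, so each barred letter leaves 1. The extra term on the left is the boundary term
-- at the last letter x, which `majʳ-dexʳ` removes because x cannot exceed the length.
majFrom-dexFrom : ∀ x w → majFrom x w ℕ.+ 𝟙 (barred x w) ℕ.* suc (length w) ≡
                          dexFrom (barred x w) x w ℕ.+ excʳ (x ∷ w)
majFrom-dexFrom x [] with barred x []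
... | true  = ≡.refl
... | false = ≡.refl
-- The boundary term of the shorter word is added on both sides, in place of a subtraction in ℕ.
majFrom-dexFrom x (y ∷ w) = ℕ.+-cancelʳ-≡ (𝟙 c ℕ.* n) _ _ (begin
  (d ℕ.* n ℕ.+ majFrom y w) ℕ.+ 𝟙 b ℕ.* suc n ℕ.+ 𝟙 c ℕ.* n
    ≡⟨ solve 5 (λ d n m b c → (d :* n :+ m) :+ b :* (con 1 :+ n) :+ c :* n :=
         (d :+ b) :* n :+ b :+ (m :+ c :* n))
         ≡.refl d n (majFrom y w) (𝟙 b) (𝟙 c) ⟩
  (d ℕ.+ 𝟙 b) ℕ.* n ℕ.+ 𝟙 b ℕ.+ (majFrom y w ℕ.+ 𝟙 c ℕ.* n)
    ≡⟨ ≡.cong₂ (λ i j → i ℕ.* n ℕ.+ 𝟙 b ℕ.+ j) (descents-bars x y n) (majFrom-dexFrom y w) ⟩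
  (e ℕ.+ 𝟙 c) ℕ.* n ℕ.+ 𝟙 b ℕ.+ (dexFrom c y w ℕ.+ excʳ (y ∷ w))
    ≡⟨ solve 6 (λ e n m b c x → (e :+ c) :* n :+ b :+ (m :+ x) := (e :* n :+ m) :+ (b :+ x) :+ c :* n)
         ≡.refl e n (dexFrom c y w) (𝟙 b) (𝟙 c) (excʳ (y ∷ w)) ⟩
  (e ℕ.* n ℕ.+ dexFrom c y w) ℕ.+ (𝟙 b ℕ.+ excʳ (y ∷ w)) ℕ.+ 𝟙 c ℕ.* n ∎)
  where
  open ≡.≡-Reasoning
  open +-*-Solver
  n = suc (length w)
  b = barred x (y ∷ w)
  c = barred y w
  d = 𝟙 (not (y <ᵇ x))
  e = 𝟙 (not (below b x c y))

majʳ-dexʳ : ∀ w → All (ℕ._≤ length w) w → majʳ w ≡ dexʳ w ℕ.+ excʳ w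
majʳ-dexʳ []      _           = ≡.refl
majʳ-dexʳ (x ∷ w) (x≤n ∷ _) = begin
  majFrom x w                                               ≡⟨ ℕ.+-identityʳ _ ⟨
  majFrom x w ℕ.+ 0                                         ≡⟨ ≡.cong
    (λ b → majFrom x w ℕ.+ 𝟙 b ℕ.* suc (length w)) (<ᵇ-false x≤n) ⟨
  majFrom x w ℕ.+ 𝟙 (barred x w) ℕ.* suc (length w)         ≡⟨ majFrom-dexFrom x w ⟩
  dexʳ (x ∷ w) ℕ.+ excʳ (x ∷ w)                             ∎
  where open ≡.≡-Reasoning

-- Cutting barred words into increasing blocks

module MajorExcedances {c ℓ} (R : CommutativeRing c ℓ) (q s : CommutativeRing.Carrier R) where
  open CommutativeRing R hiding (zero)
  open IntegerSolver R
  open WordSums R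
  open Compositions R q
  open import Algebra.Properties.Semiring.Exp semiring using (_^_; ^-homo-*)
  open import Relation.Binary.Reasoning.Setoid setoid

  bar : Bool → Carrier
  bar true  = s
  bar false = 1#

  weightʳ : List ℕ → Carrier
  weightʳ w = q ^ dexʳ w * s ^ excʳ w

  weightFrom : Bool → ℕ → List ℕ → Carrier
  weightFrom b x w = q ^ dexFrom b x w * s ^ excʳ w

  -- The ways to continue a block with l more letters after x, which has bar b;
  -- k takes the unused letters, for the m positions of the other blocks.
  chain : ℕ → ℕ → Bool → ℕ → List ℕ → (List ℕ → Carrier) → Carrier
  chain m zero    b x U k = k U
  chain m (suc l) b x U k = pickSum U (λ y r → let c = suc (l ℕ.+ m) <ᵇ y in
    ⟦ below b x c y ⟧ * (bar c * chain m l c y r k))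

  -- A block starts after a cut, where nothing is compared. Its virtual right neighbour is the
  -- unbarred letter one above its last position, which has every letter below it, barred or not
  -- (`below-start`).
  chains : List ℕ → List ℕ → Carrier
  chains []      []      = 1#
  chains (_ ∷ _) []      = 0#
  chains U       (l ∷ b) = chain (sum b) l false (suc (l ℕ.+ sum b)) U (λ r → chains r b)

  chainsFrom : Bool → ℕ → List ℕ → ℕ → List ℕ → Carrier
  chainsFrom b x U l bs = chain (sum bs) l b x U (λ r → chains r bs)

  s^𝟙 : ∀ b n → s ^ (𝟙 b ℕ.+ n) ≈ bar b * s ^ n
  s^𝟙 true  n = refl
  s^𝟙 false n = sym (*-identityˡ _)

  q^𝟙 : ∀ b n → q ^ (𝟙 (not b) ℕ.* n) ≈ q ^ n + (1# - q ^ n) * ⟦ b ⟧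
  q^𝟙 true  n = solve 1 (λ p → :1 := p :+ (:1 :- p) :* :1) refl (q ^ n)
  q^𝟙 false n = trans (reflexive (≡.cong (q ^_) (ℕ.+-identityʳ n)))
    (solve 1 (λ p → p := p :+ (:1 :- p) :* :0) refl (q ^ n))

  below-start : ∀ n y → ⟦ below false (suc n) (n <ᵇ y) y ⟧ ≈ 1#
  below-start n y with n ℕ.<? y
  ... | yes c rewrite <ᵇ-true c = refl
  ... | no ¬c rewrite <ᵇ-false (ℕ.≮⇒≥ ¬c) | <ᵇ-true (s≤s (ℕ.≮⇒≥ ¬c)) = refl

  weightSum : ∀ n U → ℕ → Carrier
  weightSum n r y = bar (suc n <ᵇ y) * wordSum n r (weightFrom (suc n <ᵇ y) y)

  mutual
    weightFrom-chains : ∀ n b x U → n ≡ length U →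
      wordSum n U (weightFrom b x) ≈ Ψ (chainsFrom b x U) n
    weightFrom-chains zero    b x []          _   = *-identityˡ _
    weightFrom-chains (suc n) b x U len = begin
      pickSum U (λ y r → wordSum n r (λ w → weightFrom b x (y ∷ w)))
        ≈⟨ pickSum-cong-↭ U (λ y r p → trans
             (wordSum-cong-↭ n r (shorter p)
               (λ w w↭r → letter y w (≡.trans (↭-length w↭r) (≡.sym (shorter p)))))
             (wordSum-* n r _ _)) ⟩
      pickSum U (λ y r → (q ^ suc n + (1# - q ^ suc n) * o y) * bar (suc n <ᵇ y) * wordSum n r
        (weightFrom (suc n <ᵇ y) y))
        ≈⟨ pickSum-cong U (λ y r → solve 5
             (λ p p′ o b w → (p :+ p′ :* o) :* b :* w := p :* (b :* w) :+ p′ :* (o :* (b :* w)))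
             refl _ _ _ _ _) ⟩
      pickSum U (λ y r → q ^ suc n * weightSum n r y + (1# - q ^ suc n) * (o y * weightSum n r y))
        ≈⟨ trans (pickSum-+ U _ _) (+-cong (pickSum-* U (q ^ suc n) (λ y r → weightSum n r y))
             (pickSum-* U (1# - q ^ suc n) (λ y r → o y * weightSum n r y))) ⟩
      q ^ suc n * pickSum U (λ y r → weightSum n r y) + (1# - q ^ suc n) *
        pickSum U (λ y r → o y * weightSum n r y)
        ≈⟨ +-cong (*-congˡ (chains-start n U len)) (*-congˡ (sym (chainsFrom-suc n b x U len))) ⟩
      Ψ (chainsFrom b x U) (suc n) ∎
      where
      o : ℕ → Carrier
      o y = ⟦ below b x (suc n <ᵇ y) y ⟧
      shorter : ∀ {y r} → y ∷ r ↭ U → n ≡ length r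
      shorter p = ℕ.suc-injective (≡.trans len (≡.sym (↭-length p)))
      letter : ∀ y w → length w ≡ n → weightFrom b x (y ∷ w) ≈
        (q ^ suc n + (1# - q ^ suc n) * o y) * bar (suc n <ᵇ y) * weightFrom (suc n <ᵇ y) y w
      letter y w ≡.refl = begin
        q ^ (𝟙 (not (below b x c′ y)) ℕ.* suc n ℕ.+ dexFrom c′ y w) * s ^ (𝟙 c′ ℕ.+ excʳ w)
          ≈⟨ *-cong (trans (^-homo-* q (𝟙 (not (below b x c′ y)) ℕ.* suc n) _)
               (*-congʳ (q^𝟙 (below b x c′ y) (suc n)))) (s^𝟙 c′ (excʳ w)) ⟩
        (q ^ suc n + (1# - q ^ suc n) * o y) * q ^ dexFrom c′ y w * (bar c′ * s ^ excʳ w)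
          ≈⟨ solve 4 (λ a d b e → a :* d :* (b :* e) := a :* b :* (d :* e)) refl _ _ _ _ ⟩
        (q ^ suc n + (1# - q ^ suc n) * o y) * bar c′ * weightFrom c′ y w ∎
        where c′ = suc n <ᵇ y

    chains-start : ∀ n U → suc n ≡ length U → pickSum U (λ y r → weightSum n r y) ≈ Φ (chains U) (suc n)
    chains-start n U@(_ ∷ _) len = begin
      pickSum U (λ y r → weightSum n r y)
        ≈⟨ pickSum-cong U {h = λ y r → weightSum n r y}
          (λ y r → trans (*-congʳ (below-start (suc n) y)) (*-identityˡ _)) ⟨
      pickSum U (λ y r → ⟦ below false (suc (suc n)) (suc n <ᵇ y) y ⟧ * weightSum n r y)
        ≈⟨ chainsFrom-suc n false (suc (suc n)) U len ⟨
      Ψ (λ l → chainsFrom false (suc (suc n)) U (suc l)) n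
        ≈⟨ Ψ-cong n (λ l b _ l+b≡n → reflexive
             (≡.cong (λ x → chainsFrom false (suc (suc x)) U (suc l) b) (≡.sym l+b≡n))) ⟩
      Φ (chains U) (suc n) ∎

    chainsFrom-suc : ∀ n b x U → suc n ≡ length U →
      Ψ (λ l → chainsFrom b x U (suc l)) n ≈
      pickSum U (λ y r → ⟦ below b x (suc n <ᵇ y) y ⟧ * weightSum n r y)
    chainsFrom-suc n b x U len = begin
      Ψ (λ l → chainsFrom b x U (suc l)) n
        ≈⟨ Ψ-cong n (λ l bs _ l+b≡n → reflexive (≡.cong (λ i → pickSum U (λ y r → let c = suc i <ᵇ y in
             ⟦ below b x c y ⟧ * (bar c * chainsFrom c y r l bs))) l+b≡n)) ⟩
      Ψ (λ l bs → pickSum U (λ y r → let c = suc n <ᵇ y in ⟦ below b x c y ⟧ * (bar c * chainsFrom c y r l bs))) n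
        ≈⟨ Ψ-pickSum n U (λ y r l bs → let c = suc n <ᵇ y in ⟦ below b x c y ⟧ * (bar c * chainsFrom c y r l bs)) ⟩
      pickSum U (λ y r → Ψ (λ l bs → let c = suc n <ᵇ y in ⟦ below b x c y ⟧ * (bar c * chainsFrom c y r l bs)) n)
        ≈⟨ pickSum-cong-↭ U (λ y r p → let c = suc n <ᵇ y in trans (Ψ-* n _ _) (*-congˡ (trans (Ψ-* n _ _) (*-congˡ
             (sym (weightFrom-chains n c y r (ℕ.suc-injective (≡.trans len (≡.sym (↭-length p)))))))))
               ) ⟩
      pickSum U (λ y r → ⟦ below b x (suc n <ᵇ y) y ⟧ * weightSum n r y) ∎

  weightʳ-chains : ∀ n U → n ≡ length U → wordSum n U weightʳ ≈ Φ (chains U) n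
  weightʳ-chains zero    []          _   = *-identityˡ _
  weightʳ-chains (suc n) U len = begin
    pickSum U (λ y r → wordSum n r (λ w → weightʳ (y ∷ w)))
      ≈⟨ pickSum-cong-↭ U (λ y r p → trans (wordSum-cong-↭ n r (shorter p) (λ w w↭r →
           letter y w (≡.trans (↭-length w↭r) (≡.sym (shorter p))))) (wordSum-* n r _ _)) ⟩
    pickSum U (λ y r → weightSum n r y)
      ≈⟨ chains-start n U len ⟩
    Φ (chains U) (suc n) ∎
    where
    shorter : ∀ {y r} → y ∷ r ↭ U → n ≡ length r
    shorter p = ℕ.suc-injective (≡.trans len (≡.sym (↭-length p)))
    letter : ∀ y w → length w ≡ n → weightʳ (y ∷ w) ≈ bar (suc n <ᵇ y) * weightFrom (suc n <ᵇ y) y w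
    letter y w ≡.refl = trans (*-congˡ (s^𝟙 (barred y w) (excʳ w)))
      (solve 3 (λ d b e → d :* (b :* e) := b :* (d :* e)) refl _ _ _)

-- Weighted subsets and their greatest elements

module Selections {c ℓ} (R : CommutativeRing c ℓ) where
  open CommutativeRing R hiding (zero)
  open IntegerSolver R
  open WordSums R
  open import Relation.Binary.Reasoning.Setoid setoid

  -- The sum over all l-element subsets V of U of k (U ∖ V) ∏_{v ∈ V} ω v.
  select : ℕ → (ℕ → Carrier) → List ℕ → (List ℕ → Carrier) → Carrier
  select zero    ω U       k = k U
  select (suc l) ω []      k = 0#
  select (suc l) ω (v ∷ U) k = ω v * select l ω U k + select (suc l) ω U (k ∘ (v ∷_))

  select-cong : ∀ l {ω ω′} U {k k′} → All (λ v → ω v ≈ ω′ v) U →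
    (∀ r → r ⊆ U → l ℕ.+ length r ≡ length U → k r ≈ k′ r) → select l ω U k ≈ select l ω′ U k′
  select-cong zero    U       ω≈         k≈ = k≈ U ⊆-refl ≡.refl
  select-cong (suc l) []      ω≈         k≈ = refl
  select-cong (suc l) (v ∷ U) (ωv ∷ ω≈) k≈ = +-cong
    (*-cong ωv (select-cong l U ω≈ (λ r r⊆U len → k≈ r (skip v r⊆U) (≡.cong suc len))))
    (select-cong (suc l) U ω≈ (λ r r⊆U len → k≈ (v ∷ r) (≡.refl ∷ r⊆U)
      (≡.trans (ℕ.+-suc (suc l) _) (≡.cong suc len))))

  select-weight-cong : ∀ l {ω ω′} U k → All (λ v → ω v ≈ ω′ v) U → select l ω U k ≈ select l ω′ U k
  select-weight-cong l U k ω≈ = select-cong l U ω≈ (λ _ _ _ → refl)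

  -- There are at most l letters strictly between a and b ≤ suc l + a.
  select-crowded : ∀ l {ω a b U} k → Descending U → (∀ v → v ℕ.≤ a → ω v ≈ 0#) →
    All (λ v → b ℕ.≤ v → ω v ≈ 0#) U → b ℕ.≤ suc l ℕ.+ a → select (suc l) ω U k ≈ 0#
  select-crowded l k []        low high b≤ = refl
  select-crowded l {ω} {a} {b} {v ∷ U} k (U<v ∷ d) low (highv ∷ high) b≤ =
    trans (+-cong head (select-crowded l (k ∘ (v ∷_)) d low high b≤)) (+-identityˡ 0#)
    where
    inside : ∀ l → b ℕ.≤ suc l ℕ.+ a → a ℕ.< v → v ℕ.< b → select l ω U k ≈ 0#
    inside zero    b≤ a<v v<b = ⊥-elim (ℕ.<⇒≱ (ℕ.<-≤-trans v<b b≤) a<v)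
    inside (suc l) b≤ a<v v<b = select-crowded l k d low
      (All.map (λ u<v v≤u → ⊥-elim (ℕ.<⇒≱ u<v v≤u)) U<v) (ℕ.s≤s⁻¹ (ℕ.≤-trans v<b b≤))
    head : ω v * select l ω U k ≈ 0#
    head with v ℕ.≤? a | b ℕ.≤? v
    ... | yes v≤a | _       = trans (*-congʳ (low v v≤a)) (zeroˡ _)
    ... | no  _   | yes b≤v = trans (*-congʳ (highv b≤v)) (zeroˡ _)
    ... | no  v≰a | no b≰v  = trans (*-congˡ (inside l b≤ (ℕ.≰⇒> v≰a) (ℕ.≰⇒> b≰v))) (zeroʳ _)

  select-0 : ∀ l U k → select (suc l) (λ _ → 0#) U k ≈ 0#
  select-0 l []      k = refl
  select-0 l (v ∷ U) k = trans (+-cong (zeroˡ _) (select-0 l U _)) (+-identityˡ 0#)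

  -- A subset whose elements carry a label 0 or 1 is either all labelled 1, or
  -- has a greatest element y labelled 0.
  select-max : ∀ l (ω₀ ω₁ : ℕ → Carrier) {U} k → Descending U →
    select (suc l) (λ v → ω₀ v + ω₁ v) U k ≈
    pickSum U (λ y r → ω₀ y * select l (λ v → ⟦ v <ᵇ y ⟧ * ω₀ v + ω₁ v) r k) + select (suc l) ω₁ U k
  select-max l ω₀ ω₁ k []                    = sym (+-identityˡ 0#)
  select-max l ω₀ ω₁ {x ∷ U} k (U<x ∷ d) = begin
    (ω₀ x + ω₁ x) * select l ω U k + select (suc l) ω U (k ∘ (x ∷_))
      ≈⟨ +-cong (distribʳ _ _ _) (select-max l ω₀ ω₁ (k ∘ (x ∷_)) d) ⟩
    ω₀ x * select l ω U k + ω₁ x * select l ω U k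
      + (pickSum U (λ y r → ω₀ y * select l (ω< y) r (k ∘ (x ∷_))) + select (suc l) ω₁ U (k ∘ (x ∷_)))
      ≈⟨ solve 4 (λ a b c d → a :+ b :+ (c :+ d) := a :+ (b :+ c) :+ d) refl _ _ _ _ ⟩
    ω₀ x * select l ω U k
      + (ω₁ x * select l ω U k + pickSum U (λ y r → ω₀ y * select l (ω< y) r (k ∘ (x ∷_))))
      + select (suc l) ω₁ U (k ∘ (x ∷_))
      ≈⟨ +-congʳ (+-cong (*-congˡ (select-weight-cong l U k (All.map head U<x))) (tail l)) ⟩
    ω₀ x * select l (ω< x) U k
      + (pickSum U (λ y r → ω₀ y * select l (ω< y) (x ∷ r) k) + ω₁ x * select l ω₁ U k)
      + select (suc l) ω₁ U (k ∘ (x ∷_))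
      ≈⟨ solve 4 (λ a b c d → a :+ (b :+ c) :+ d := a :+ b :+ (c :+ d)) refl _ _ _ _ ⟩
    ω₀ x * select l (ω< x) U k + pickSum U (λ y r → ω₀ y * select l (ω< y) (x ∷ r) k)
      + (ω₁ x * select l ω₁ U k + select (suc l) ω₁ U (k ∘ (x ∷_))) ∎
    where
    ω : ℕ → Carrier
    ω v = ω₀ v + ω₁ v
    ω< : ℕ → ℕ → Carrier
    ω< y v = ⟦ v <ᵇ y ⟧ * ω₀ v + ω₁ v
    -- x exceeds all of U, so the restriction to letters below x is void there; conversely, for y in
    -- U, `ω<x` leaves x only the label 1.
    head : ∀ {v} → v ℕ.< x → ω v ≈ ω< x v
    head v<x rewrite <ᵇ-true v<x = +-congʳ (sym (*-identityˡ _))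
    ω<x : ∀ {y r} → y ∷ r ↭ U → ω< y x ≈ ω₁ x
    ω<x p with y<x ∷ _ ← All-resp-↭ (↭-sym p) U<x
      rewrite <ᵇ-false (ℕ.<⇒≤ y<x) = trans (+-congʳ (zeroˡ _)) (+-identityˡ _)

    tail : ∀ l → ω₁ x * select l ω U k + pickSum U (λ y r → ω₀ y * select l (ω< y) r (k ∘ (x ∷_))) ≈
                 pickSum U (λ y r → ω₀ y * select l (ω< y) (x ∷ r) k) + ω₁ x * select l ω₁ U k
    tail zero    = +-comm _ _
    tail (suc l) = begin
      ω₁ x * select (suc l) ω U k + pickSum U (λ y r → ω₀ y * select (suc l) (ω< y) r (k ∘ (x ∷_)))
        ≈⟨ +-congʳ (*-congˡ (select-max l ω₀ ω₁ k d)) ⟩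
      ω₁ x * (pickSum U (λ y r → ω₀ y * select l (ω< y) r k) + select (suc l) ω₁ U k)
        + pickSum U (λ y r → ω₀ y * select (suc l) (ω< y) r (k ∘ (x ∷_)))
        ≈⟨ solve 4 (λ w a b c → w :* (a :+ b) :+ c := w :* a :+ c :+ w :* b) refl _ _ _ _ ⟩
      ω₁ x * pickSum U (λ y r → ω₀ y * select l (ω< y) r k)
        + pickSum U (λ y r → ω₀ y * select (suc l) (ω< y) r (k ∘ (x ∷_))) + ω₁ x * select (suc l) ω₁ U k
        ≈⟨ +-congʳ (trans (+-congʳ (sym (pickSum-* U (ω₁ x) (λ y r → ω₀ y * select l (ω< y) r k))))
             (sym (pickSum-+ U _ _))) ⟩
      pickSum U (λ y r → ω₁ x * (ω₀ y * select l (ω< y) r k) + ω₀ y * select (suc l) (ω< y) r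
        (k ∘ (x ∷_)))
        + ω₁ x * select (suc l) ω₁ U k
        ≈⟨ +-congʳ (pickSum-cong-↭ U (λ y r p → trans
             (solve 4 (λ w a b c → w :* (a :* b) :+ a :* c := a :* (w :* b :+ c)) refl _ _ _ _)
             (*-congˡ (+-congʳ (*-congʳ (sym (ω<x p))))))) ⟩
      pickSum U (λ y r → ω₀ y * select (suc l) (ω< y) (x ∷ r) k) + ω₁ x * select (suc l) ω₁ U k ∎

  -- The case ω₁ = 0 of `select-max`, where the subset labelled 1 throughout contributes nothing.
  select-max′ : ∀ l ω {U} k → Descending U → select (suc l) ω U k ≈
    pickSum U (λ y r → ω y * select l (λ v → ⟦ v <ᵇ y ⟧ * ω v) r k)
  select-max′ l ω {U} k d = begin
    select (suc l) ω U k
      ≈⟨ select-weight-cong (suc l) U k (All.universal (λ v → sym (+-identityʳ _)) U) ⟩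
    select (suc l) (λ v → ω v + 0#) U k
      ≈⟨ select-max l ω (λ _ → 0#) k d ⟩
    pickSum U (λ y r → ω y * select l (λ v → ⟦ v <ᵇ y ⟧ * ω v + 0#) r k) + select (suc l) (λ _ → 0#) U k
      ≈⟨ +-cong (pickSum-cong U (λ y r → *-congˡ
           (select-weight-cong l r k (All.universal (λ v → +-identityʳ _) r))))
                (select-0 l U k) ⟩
    pickSum U (λ y r → ω y * select l (λ v → ⟦ v <ᵇ y ⟧ * ω v) r k) + 0#
      ≈⟨ +-identityʳ _ ⟩
    pickSum U (λ y r → ω y * select l (λ v → ⟦ v <ᵇ y ⟧ * ω v) r k) ∎

-- Increasing blocks as subsets

module Chains {c ℓ} (R : CommutativeRing c ℓ) (q s : CommutativeRing.Carrier R) where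
  open CommutativeRing R hiding (zero)
  open IntegerSolver R
  open WordSums R
  open MajorExcedances R q s
  open Selections R
  open import Relation.Binary.Reasoning.Setoid setoid

  barredBelow : ℕ → ℕ → ℕ → Carrier
  barredBelow m x v = ⟦ v <ᵇ x ⟧ * (s * ⟦ suc m <ᵇ v ⟧)

  lettersBelow : ℕ → ℕ → ℕ → Carrier
  lettersBelow m x v = ⟦ v <ᵇ x ⟧ + s * ⟦ suc m <ᵇ v ⟧

  private
    -- If a barred letter y leaves room for l smaller barred letters in the
    -- positions after m, then it does exceed its own position.
    barred-y : ∀ m l y {r} k → Descending r →
      s * ⟦ suc m <ᵇ y ⟧ * select l (barredBelow m y) r k ≈
      ⟦ suc (l ℕ.+ m) <ᵇ y ⟧ * (s * select l (barredBelow m y) r k)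
    barred-y m l y {r} k d with suc m ℕ.<? y | suc (l ℕ.+ m) ℕ.<? y
    ... | yes m<y | yes l+m<y rewrite <ᵇ-true m<y | <ᵇ-true l+m<y =
      solve 2 (λ s x → s :* :1 :* x := :1 :* (s :* x)) refl _ _
    ... | no m≮y | yes l+m<y = ⊥-elim (m≮y (ℕ.≤-<-trans (s≤s (ℕ.m≤n+m m l)) l+m<y))
    ... | no m≮y | no l+m≮y rewrite <ᵇ-false (ℕ.≮⇒≥ m≮y) | <ᵇ-false (ℕ.≮⇒≥ l+m≮y) =
      solve 2 (λ s x → s :* :0 :* x := :0 :* (s :* x)) refl _ _
    ... | yes m<y | no l+m≮y rewrite <ᵇ-true m<y | <ᵇ-false (ℕ.≮⇒≥ l+m≮y) = begin
      s * 1# * select l (barredBelow m y) r k  ≈⟨ *-congˡ (empty l (ℕ.≮⇒≥ l+m≮y)) ⟩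
      s * 1# * 0#                              ≈⟨ solve 2
        (λ s x → s :* :1 :* :0 := :0 :* (s :* x)) refl _ _ ⟩
      0# * (s * select l (barredBelow m y) r k) ∎
      where
      empty : ∀ l → y ℕ.≤ suc (l ℕ.+ m) → select l (barredBelow m y) r k ≈ 0#
      empty zero    y≤ = ⊥-elim (ℕ.<⇒≱ m<y y≤)
      empty (suc l) y≤ = select-crowded l k d
        (λ v v≤ → trans (*-congˡ (trans (*-congˡ (reflexive (≡.cong ⟦_⟧ (<ᵇ-false v≤)))) (zeroʳ s)))
          (zeroʳ _))
        (All.universal (λ v y≤v → trans (*-congʳ (reflexive (≡.cong ⟦_⟧ (<ᵇ-false y≤v)))) (zeroˡ _)) r)
        (ℕ.≤-trans y≤ (ℕ.≤-reflexive (≡.cong suc (≡.sym (ℕ.+-suc l m)))))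

    below-trans : ∀ x y (f : ℕ → Carrier) l r k (g : ℕ → Carrier) →
      ⟦ y <ᵇ x ⟧ * select l (λ v → ⟦ v <ᵇ y ⟧ * (⟦ v <ᵇ x ⟧ * f v) + g v) r k ≈
      ⟦ y <ᵇ x ⟧ * select l (λ v → ⟦ v <ᵇ y ⟧ * f v + g v) r k
    below-trans x y f l r k g with y ℕ.<? x
    ... | no y≮x rewrite <ᵇ-false (ℕ.≮⇒≥ y≮x) = trans (zeroˡ _) (sym (zeroˡ _))
    ... | yes y<x = *-congˡ (select-weight-cong l r k (All.universal letter r))
      where
      letter : ∀ v → ⟦ v <ᵇ y ⟧ * (⟦ v <ᵇ x ⟧ * f v) + g v ≈ ⟦ v <ᵇ y ⟧ * f v + g v
      letter v with v ℕ.<? y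
      ... | yes v<y rewrite <ᵇ-true v<y | <ᵇ-true (ℕ.<-trans v<y y<x) =
        +-congʳ (*-congˡ (*-identityˡ _))
      ... | no v≮y rewrite <ᵇ-false (ℕ.≮⇒≥ v≮y) = +-congʳ (trans (zeroˡ _) (sym (zeroˡ _)))

    pickSum-cong-desc : ∀ {U g h} → Descending U → (∀ y r → Descending r → g y r ≈ h y r) →
                        pickSum U g ≈ pickSum U h
    pickSum-cong-desc d eq = go d (λ y r _ d′ → eq y r d′)
      where
      go : ∀ {U g h} → Descending U → (∀ y r → y ∷ r ↭ U → Descending r → g y r ≈ h y r) →
           pickSum U g ≈ pickSum U h
      go {[]}    _          eq = refl
      go {x ∷ U} (U<x ∷ d) eq = +-cong (eq x U ↭-refl d)
        (go d (λ y r p d′ → eq y (x ∷ r) (_↭_.trans (swap y x ↭-refl) (prep x p))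
          (All.tail (All-resp-↭ (↭-sym p) U<x) ∷ d′)))

  -- As the letters of a chain decrease at least as fast as their positions, the
  -- condition on the bars is only felt at the last barred letter ...
  chain-barred : ∀ l m x {U} k → Descending U →
    chain m l true x U k ≈ select l (barredBelow m x) U k
  chain-barred zero    m x k d = refl
  chain-barred (suc l) m x {U} k d = begin
    pickSum U (λ y r → ⟦ below true x (isBarred y) y ⟧
      * (bar (isBarred y) * chain m l (isBarred y) y r k))
      ≈⟨ pickSum-cong-desc d term ⟩
    pickSum U (λ y r → barredBelow m x y * select l (λ v → ⟦ v <ᵇ y ⟧ * barredBelow m x v) r k)
      ≈⟨ select-max′ l (barredBelow m x) k d ⟨
    select (suc l) (barredBelow m x) U k ∎
    where
    isBarred : ℕ → Bool
    isBarred y = suc (l ℕ.+ m) <ᵇ y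

    first : ∀ y r → Descending r →
      ⟦ below true x (isBarred y) y ⟧ * (bar (isBarred y) * chain m l (isBarred y) y r k) ≈
      ⟦ y <ᵇ x ⟧ * (⟦ isBarred y ⟧ * (s * select l (barredBelow m y) r k))
    first y r d′ with isBarred y
    ... | true  = *-congˡ (trans (*-congˡ (chain-barred l m y k d′)) (sym (*-identityˡ _)))
    ... | false = trans (zeroˡ _) (sym (trans (*-congˡ (zeroˡ _)) (zeroʳ _)))

    term : ∀ y r → Descending r →
      ⟦ below true x (isBarred y) y ⟧ * (bar (isBarred y) * chain m l (isBarred y) y r k) ≈
      barredBelow m x y * select l (λ v → ⟦ v <ᵇ y ⟧ * barredBelow m x v) r k
    term y r d′ = begin
      ⟦ below true x (isBarred y) y ⟧ * (bar (isBarred y) * chain m l (isBarred y) y r k)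
        ≈⟨ first y r d′ ⟩
      ⟦ y <ᵇ x ⟧ * (⟦ isBarred y ⟧ * (s * select l (barredBelow m y) r k))
        ≈⟨ *-congˡ (barred-y m l y k d′) ⟨
      ⟦ y <ᵇ x ⟧ * (s * ⟦ suc m <ᵇ y ⟧ * select l (barredBelow m y) r k)
        ≈⟨ solve 3 (λ a b c → a :* (b :* c) := b :* (a :* c)) refl _ _ _ ⟩
      s * ⟦ suc m <ᵇ y ⟧ * (⟦ y <ᵇ x ⟧ * select l (barredBelow m y) r k)
        ≈⟨ *-congˡ (trans (*-congˡ (unpad (λ v → ⟦ v <ᵇ y ⟧ * (s * ⟦ suc m <ᵇ v ⟧))))
             (trans (sym (below-trans x y (λ v → s * ⟦ suc m <ᵇ v ⟧) l r k (λ _ → 0#)))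
               (*-congˡ (sym (unpad (λ v → ⟦ v <ᵇ y ⟧ * barredBelow m x v)))))) ⟩
      s * ⟦ suc m <ᵇ y ⟧ * (⟦ y <ᵇ x ⟧ * select l (λ v → ⟦ v <ᵇ y ⟧ * barredBelow m x v) r k)
        ≈⟨ solve 3 (λ a b c → b :* (a :* c) := a :* b :* c) refl _ _ _ ⟩
      barredBelow m x y * select l (λ v → ⟦ v <ᵇ y ⟧ * barredBelow m x v) r k ∎
      where
      unpad : ∀ f → select l f r k ≈ select l (λ v → f v + 0#) r k
      unpad f = select-weight-cong l r k (All.universal (λ v → sym (+-identityʳ _)) r)

  -- ... and at the first unbarred one.
  chain-unbarred : ∀ l m x {U} k → Descending U → x ℕ.≤ suc (l ℕ.+ m) →
    chain m l false x U k ≈ select l (lettersBelow m x) U k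
  chain-unbarred zero    m x k d x≤ = refl
  chain-unbarred (suc l) m x {U} k d x≤ = begin
    pickSum U (λ y r → ⟦ below false x (isBarred y) y ⟧
      * (bar (isBarred y) * chain m l (isBarred y) y r k))
      ≈⟨ pickSum-cong-desc d term ⟩
    pickSum U (λ y r → ⟦ y <ᵇ x ⟧ * select l (λ v → ⟦ v <ᵇ y ⟧ * ⟦ v <ᵇ x ⟧ + s * ⟦ suc m <ᵇ v ⟧) r k
      + s * ⟦ suc m <ᵇ y ⟧ * select l (λ v → ⟦ v <ᵇ y ⟧ * (s * ⟦ suc m <ᵇ v ⟧)) r k)
      ≈⟨ pickSum-+ U _ _ ⟩
    pickSum U (λ y r → ⟦ y <ᵇ x ⟧ * select l (λ v → ⟦ v <ᵇ y ⟧ * ⟦ v <ᵇ x ⟧ + s * ⟦ suc m <ᵇ v ⟧) r k)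
      + pickSum U (λ y r → s * ⟦ suc m <ᵇ y ⟧ * select l (λ v → ⟦ v <ᵇ y ⟧ * (s * ⟦ suc m <ᵇ v ⟧)) r k)
      ≈⟨ +-congˡ (select-max′ l (λ v → s * ⟦ suc m <ᵇ v ⟧) k d) ⟨
    pickSum U (λ y r → ⟦ y <ᵇ x ⟧ * select l (λ v → ⟦ v <ᵇ y ⟧ * ⟦ v <ᵇ x ⟧ + s * ⟦ suc m <ᵇ v ⟧) r k)
      + select (suc l) (λ v → s * ⟦ suc m <ᵇ v ⟧) U k
      -- Label 0 stands for unbarred and label 1 for barred. Read backwards, a block begins with its
      -- greatest unbarred letter, or with its greatest barred letter if all are barred.
      ≈⟨ select-max l (λ v → ⟦ v <ᵇ x ⟧) (λ v → s * ⟦ suc m <ᵇ v ⟧) k d ⟨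
    select (suc l) (lettersBelow m x) U k ∎
    where
    isBarred : ℕ → Bool
    isBarred y = suc (l ℕ.+ m) <ᵇ y

    first : ∀ y r → Descending r →
      ⟦ below false x (isBarred y) y ⟧ * (bar (isBarred y) * chain m l (isBarred y) y r k) ≈
      ⟦ y <ᵇ x ⟧ * select l (lettersBelow m y) r k + ⟦ isBarred y ⟧
        * (s * select l (barredBelow m y) r k)
    first y r d′ with suc (l ℕ.+ m) ℕ.<? y
    -- Here x ≤ y by the bound on x, so the alternative of an unbarred y below x vanishes.
    ... | yes cy rewrite <ᵇ-true cy | <ᵇ-false (ℕ.≤-trans x≤ cy) = trans
      (*-congˡ (*-congˡ (chain-barred l m y k d′)))
      (solve 2 (λ a b → :1 :* b := :0 :* a :+ :1 :* b) refl _ _)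
    ... | no ¬cy rewrite <ᵇ-false (ℕ.≮⇒≥ ¬cy) = trans
      (*-congˡ (*-congˡ (chain-unbarred l m y k d′ (ℕ.≮⇒≥ ¬cy))))
      (solve 3 (λ i a b → i :* (:1 :* a) := i :* a :+ :0 :* b) refl _ _ _)

    term : ∀ y r → Descending r →
      ⟦ below false x (isBarred y) y ⟧ * (bar (isBarred y) * chain m l (isBarred y) y r k) ≈
      ⟦ y <ᵇ x ⟧ * select l (λ v → ⟦ v <ᵇ y ⟧ * ⟦ v <ᵇ x ⟧ + s * ⟦ suc m <ᵇ v ⟧) r k
      + s * ⟦ suc m <ᵇ y ⟧ * select l (λ v → ⟦ v <ᵇ y ⟧ * (s * ⟦ suc m <ᵇ v ⟧)) r k
    term y r d′ = trans (first y r d′) (+-cong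
      (trans (*-congˡ (select-weight-cong l r k
        (All.universal (λ v → +-congʳ (sym (*-identityʳ _))) r)))
        (trans (sym (below-trans x y (λ _ → 1#) l r k (λ v → s * ⟦ suc m <ᵇ v ⟧)))
          (*-congˡ (select-weight-cong l r k
            (All.universal (λ v → +-congʳ (*-congˡ (*-identityʳ _))) r)))))
      (sym (barred-y m l y k d′)))

  -- The weight of v in a block at the positions m + 1, …, m + l is the case d = 1;
  -- the case d = 0 is simpler, as it does not distinguish the position m + 1.
  blockWeight : ℕ → ℕ → ℕ → ℕ → Carrier
  blockWeight d l m v = ⟦ v <ᵇ suc (l ℕ.+ m) ⟧ + s * ⟦ d ℕ.+ m <ᵇ v ⟧

  chains≈select : ∀ {U} l b → Descending U →
    chains U (l ∷ b) ≈ select l (blockWeight 1 l (sum b)) U (λ r → chains r b)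
  chains≈select {[]}    l b d = chain-unbarred l (sum b) _ _ d ℕ.≤-refl
  chains≈select {_ ∷ _} l b d = chain-unbarred l (sum b) _ _ d ℕ.≤-refl

-- Products of linear forms

-- Functions on lists of naturals as coefficient families of polynomials in
-- x₀, x₁, …; mul α is multiplication by the linear form ∑ α i xᵢ.
module LinearForms {c ℓ} (R : CommutativeRing c ℓ) where
  open CommutativeRing R hiding (zero)
  open IntegerSolver R
  open Selections R
  open import Relation.Binary.Reasoning.Setoid setoid

  Form Poly : Set c
  Form = ℕ → Carrier
  Poly = List ℕ → Carrier

  infix 4 _≗_
  _≗_ : Poly → Poly → Set ℓ
  f ≗ g = ∀ b → f b ≈ g b

  lower : ℕ → (ℕ → Carrier) → Carrier
  lower zero    g = 0#
  lower (suc l) g = g l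

  -- The length of the list is the number of variables, so a linear form is 0 at the empty list. It
  -- is this truncation that makes `mul-J` hold.
  mul : Form → Poly → Poly
  mul α f []      = 0#
  mul α f (l ∷ b) = α 0 * lower l (λ l′ → f (l′ ∷ b)) + mul (α ∘ suc) (λ b → f (l ∷ b)) b

  one : Poly
  one []          = 1#
  one (zero ∷ b)  = one b
  one (suc _ ∷ b) = 0#

  lower-cong : ∀ l {g h} → (∀ l → g l ≈ h l) → lower l g ≈ lower l h
  lower-cong zero    eq = refl
  lower-cong (suc l) eq = eq l

  lower-+ : ∀ l g h → lower l (λ l → g l + h l) ≈ lower l g + lower l h
  lower-+ zero    g h = sym (+-identityˡ 0#)
  lower-+ (suc l) g h = refl

  lower-* : ∀ l a g → lower l (λ l → a * g l) ≈ a * lower l g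
  lower-* zero    a g = sym (zeroʳ a)
  lower-* (suc l) a g = refl

  mul-cong : ∀ {α β f g} → (∀ i → α i ≈ β i) → f ≗ g → mul α f ≗ mul β g
  mul-cong α≈ f≗ []      = refl
  mul-cong α≈ f≗ (l ∷ b) = +-cong (*-cong (α≈ 0) (lower-cong l (λ l → f≗ (l ∷ b))))
    (mul-cong (α≈ ∘ suc) (λ b → f≗ (l ∷ b)) b)

  mul-congʳ : ∀ {α f g} → f ≗ g → mul α f ≗ mul α g
  mul-congʳ = mul-cong (λ _ → refl)

  mul-+ : ∀ α f g → mul α (λ b → f b + g b) ≗ λ b → mul α f b + mul α g b
  mul-+ α f g []      = sym (+-identityˡ 0#)
  mul-+ α f g (l ∷ b) = trans
    (+-cong (*-congˡ (lower-+ l (λ l → f (l ∷ b)) (λ l → g (l ∷ b))))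
      (mul-+ (α ∘ suc) (λ b → f (l ∷ b)) (λ b → g (l ∷ b)) b))
    (solve 5 (λ a x y z w → a :* (x :+ y) :+ (z :+ w) := a :* x :+ z :+ (a :* y :+ w)) refl _ _ _ _ _)

  mul-* : ∀ α a f → mul α (λ b → a * f b) ≗ λ b → a * mul α f b
  mul-* α a f []      = sym (zeroʳ a)
  mul-* α a f (l ∷ b) = trans
    (+-cong (*-congˡ (lower-* l a (λ l → f (l ∷ b)))) (mul-* (α ∘ suc) a (λ b → f (l ∷ b)) b))
    (solve 4 (λ α a x y → α :* (a :* x) :+ a :* y := a :* (α :* x :+ y)) refl _ _ _ _)

  mul-0 : ∀ α → mul α (λ _ → 0#) ≗ λ _ → 0#
  mul-0 α b = trans (mul-cong (λ _ → refl) (λ _ → sym (zeroˡ 0#)) b)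
    (trans (mul-* α 0# (λ _ → 0#) b) (zeroˡ _))

  mul-form-+ : ∀ α β f → mul (λ i → α i + β i) f ≗ λ b → mul α f b + mul β f b
  mul-form-+ α β f []      = sym (+-identityˡ 0#)
  mul-form-+ α β f (l ∷ b) = trans (+-congˡ (mul-form-+ (α ∘ suc) (β ∘ suc) (λ b → f (l ∷ b)) b))
    (solve 5 (λ a b x y z → (a :+ b) :* x :+ (y :+ z) := a :* x :+ y :+ (b :* x :+ z)) refl _ _ _ _ _)

  mul-form-* : ∀ a α f → mul (λ i → a * α i) f ≗ λ b → a * mul α f b
  mul-form-* a α f []      = sym (zeroʳ a)
  mul-form-* a α f (l ∷ b) = trans (+-congˡ (mul-form-* a (α ∘ suc) (λ b → f (l ∷ b)) b))
    (solve 4 (λ a α x y → a :* α :* x :+ a :* y := a :* (α :* x :+ y)) refl _ _ _ _)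

  mul-form-0 : ∀ f → mul (λ _ → 0#) f ≗ λ _ → 0#
  mul-form-0 f b = trans (mul-cong {f = f} (λ _ → sym (zeroˡ 0#)) (λ _ → refl) b)
    (trans (mul-form-* 0# (λ _ → 0#) f b) (zeroˡ _))

  lower-mul : ∀ l α (f : ℕ → Poly) b → lower l (λ l → mul α (f l) b) ≈
    mul α (λ b → lower l (λ l → f l b)) b
  lower-mul zero    α f b = sym (mul-0 α b)
  lower-mul (suc l) α f b = refl

  mul-comm : ∀ α β f → mul α (mul β f) ≗ mul β (mul α f)
  mul-comm α β f []      = refl
  mul-comm α β f (l ∷ b) = begin
    α 0 * lower l (λ l → β 0 * lower l (λ l → f (l ∷ b)) + mul β⁺ (λ b → f (l ∷ b)) b)
      + mul α⁺ (λ b → β 0 * f⁻ b + mul β⁺ (λ b → f (l ∷ b)) b) b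
      ≈⟨ +-cong (*-congˡ (left (β 0) β⁺)) (right (β 0) α⁺ β⁺) ⟩
    α 0 * (β 0 * lower l (λ l → lower l (λ l → f (l ∷ b))) + mul β⁺ f⁻ b)
      + (β 0 * mul α⁺ f⁻ b + mul α⁺ (mul β⁺ (λ b → f (l ∷ b))) b)
      ≈⟨ +-congˡ (+-congˡ (mul-comm α⁺ β⁺ (λ b → f (l ∷ b)) b)) ⟩
    α 0 * (β 0 * lower l (λ l → lower l (λ l → f (l ∷ b))) + mul β⁺ f⁻ b)
      + (β 0 * mul α⁺ f⁻ b + mul β⁺ (mul α⁺ (λ b → f (l ∷ b))) b)
      ≈⟨ solve 6 (λ a b x y z w → a :* (b :* x :+ y) :+ (b :* z :+ w) :=
           b :* (a :* x :+ z) :+ (a :* y :+ w))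
           refl _ _ _ _ _ _ ⟩
    β 0 * (α 0 * lower l (λ l → lower l (λ l → f (l ∷ b))) + mul α⁺ f⁻ b)
      + (α 0 * mul β⁺ f⁻ b + mul β⁺ (mul α⁺ (λ b → f (l ∷ b))) b)
      ≈⟨ +-cong (*-congˡ (left (α 0) α⁺)) (right (α 0) β⁺ α⁺) ⟨
    β 0 * lower l (λ l → α 0 * lower l (λ l → f (l ∷ b)) + mul α⁺ (λ b → f (l ∷ b)) b)
      + mul β⁺ (λ b → α 0 * f⁻ b + mul α⁺ (λ b → f (l ∷ b)) b) b ∎
    where
    α⁺ = α ∘ suc
    β⁺ = β ∘ suc
    f⁻ : Poly
    f⁻ b = lower l (λ l → f (l ∷ b))
    left : ∀ a γ → lower l (λ l → a * lower l (λ l → f (l ∷ b)) + mul γ (λ b → f (l ∷ b)) b) ≈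
                   a * lower l (λ l → lower l (λ l → f (l ∷ b))) + mul γ f⁻ b
    left a γ = trans (lower-+ l _ _)
      (+-cong (lower-* l a (λ l → lower l (λ l → f (l ∷ b)))) (lower-mul l γ (λ l b → f (l ∷ b)) b))
    right : ∀ a γ γ′ → mul γ (λ b → a * f⁻ b + mul γ′ (λ b → f (l ∷ b)) b) b ≈
                       a * mul γ f⁻ b + mul γ (mul γ′ (λ b → f (l ∷ b))) b
    right a γ γ′ = trans (mul-+ γ (λ b → a * f⁻ b) _ b) (+-congʳ (mul-* γ a f⁻ b))

  mulAll : List Form → Poly → Poly
  mulAll []       f = f
  mulAll (α ∷ αs) f = mul α (mulAll αs f)

  mulAll-cong : ∀ αs {f g} → f ≗ g → mulAll αs f ≗ mulAll αs g
  mulAll-cong []       f≗ = f≗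
  mulAll-cong (α ∷ αs) f≗ = mul-congʳ (mulAll-cong αs f≗)

  mulAll-+ : ∀ αs f g → mulAll αs (λ b → f b + g b) ≗ λ b → mulAll αs f b + mulAll αs g b
  mulAll-+ []       f g b = refl
  mulAll-+ (α ∷ αs) f g b = trans (mul-congʳ (mulAll-+ αs f g) b)
    (mul-+ α (mulAll αs f) (mulAll αs g) b)

  mulAll-* : ∀ αs a f → mulAll αs (λ b → a * f b) ≗ λ b → a * mulAll αs f b
  mulAll-* []       a f b = refl
  mulAll-* (α ∷ αs) a f b = trans (mul-congʳ (mulAll-* αs a f) b) (mul-* α a (mulAll αs f) b)

  mulAll-++ : ∀ αs βs f b → mulAll (αs ++ βs) f b ≈ mulAll αs (mulAll βs f) b
  mulAll-++ []       βs f b = refl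
  mulAll-++ (α ∷ αs) βs f b = mul-congʳ (mulAll-++ αs βs f) b

  mul-mulAll : ∀ β αs f → mul β (mulAll αs f) ≗ mulAll αs (mul β f)
  mul-mulAll β []       f b = refl
  mul-mulAll β (α ∷ αs) f b = trans (mul-comm β α (mulAll αs f) b) (mul-congʳ (mul-mulAll β αs f) b)

  -- Distributing the letters of U over blocks of prescribed sizes, where a
  -- letter v in block i has weight w i v, block by block ...
  distribute : (ℕ → Form) → List ℕ → Poly
  distribute w []      []      = 1#
  distribute w (_ ∷ _) []      = 0#
  distribute w U       (l ∷ b) = select l (w 0) U (λ r → distribute (w ∘ suc) r b)

  distribute-∷ : ∀ w U l b → distribute w U (l ∷ b) ≡ select l (w 0) U (λ r → distribute (w ∘ suc) r b)
  distribute-∷ w []      l b = ≡.refl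
  distribute-∷ w (_ ∷ _) l b = ≡.refl

  select-mul : ∀ l ω U α (F : List ℕ → Poly) b →
    select l ω U (λ r → mul α (F r) b) ≈ mul α (λ b → select l ω U (λ r → F r b)) b
  select-mul zero    ω U       α F b = refl
  select-mul (suc l) ω []      α F b = sym (mul-0 α b)
  select-mul (suc l) ω (v ∷ U) α F b = begin
    ω v * select l ω U (λ r → mul α (F r) b) + select (suc l) ω U (λ r → mul α (F (v ∷ r)) b)
      ≈⟨ +-cong (*-congˡ (select-mul l ω U α F b)) (select-mul (suc l) ω U α (F ∘ (v ∷_)) b) ⟩
    ω v * mul α (λ b → select l ω U (λ r → F r b)) b
      + mul α (λ b → select (suc l) ω U (λ r → F (v ∷ r) b)) b
      ≈⟨ +-congʳ (mul-* α (ω v) (λ b → select l ω U (λ r → F r b)) b) ⟨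
    mul α (λ b → ω v * select l ω U (λ r → F r b)) b
      + mul α (λ b → select (suc l) ω U (λ r → F (v ∷ r) b)) b
      ≈⟨ mul-+ α (λ b → ω v * select l ω U (λ r → F r b))
           (λ b → select (suc l) ω U (λ r → F (v ∷ r) b)) b ⟨
    mul α (λ b → select (suc l) ω (v ∷ U) (λ r → F r b)) b ∎

  -- ... or letter by letter.
  distribute-letter : ∀ w v U → distribute w (v ∷ U) ≗ mul (λ i → w i v) (distribute w U)
  distribute-letter w v U []         = refl
  distribute-letter w v U (zero ∷ b) = begin
    distribute (w ∘ suc) (v ∷ U) b
      ≈⟨ distribute-letter (w ∘ suc) v U b ⟩
    mul (λ i → w (suc i) v) (distribute (w ∘ suc) U) b
      ≈⟨ mul-congʳ (λ b → reflexive (distribute-∷ w U 0 b)) b ⟨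
    mul (λ i → w (suc i) v) (λ b → distribute w U (0 ∷ b)) b
      ≈⟨ solve 2 (λ a x → x := a :* :0 :+ x) refl _ _ ⟩
    mul (λ i → w i v) (distribute w U) (0 ∷ b) ∎
  distribute-letter w v U (suc l ∷ b) = +-cong
    (*-congˡ (sym (reflexive (distribute-∷ w U l b))))
    (begin
      select (suc l) (w 0) U (λ r → distribute (w ∘ suc) (v ∷ r) b)
        ≈⟨ select-cong (suc l) U (All.universal (λ _ → refl) U)
             (λ r _ _ → distribute-letter (w ∘ suc) v r b) ⟩
      select (suc l) (w 0) U (λ r → mul (λ i → w (suc i) v) (distribute (w ∘ suc) r) b)
        ≈⟨ select-mul (suc l) (w 0) U _ (distribute (w ∘ suc)) b ⟩
      mul (λ i → w (suc i) v) (λ b → select (suc l) (w 0) U (λ r → distribute (w ∘ suc) r b)) b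
        ≈⟨ mul-congʳ (λ b → reflexive (distribute-∷ w U (suc l) b)) b ⟨
      mul (λ i → w (suc i) v) (λ b → distribute w U (suc l ∷ b)) b ∎)

  product : (ℕ → Form) → ℕ → Poly
  product α zero    = one
  product α (suc n) = mul (α (suc n)) (product α n)

  distribute-desc : ∀ w n → distribute w (desc n) ≗ product (λ v i → w i v) n
  distribute-desc w (suc n) b = trans (distribute-letter w (suc n) (desc n) b)
    (mul-congʳ (distribute-desc w n) b)
  distribute-desc w zero    b = go w b
    where
    go : ∀ w → distribute w [] ≗ one
    go w []          = refl
    go w (zero ∷ b)  = go (w ∘ suc) b
    go w (suc l ∷ b) = refl

  product-block : ∀ {α β} l m → (∀ v → m ℕ.< v → v ℕ.≤ l ℕ.+ m → ∀ i → α v i ≈ β i) →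
    product α (l ℕ.+ m) ≗ mulAll (replicate l β) (product α m)
  product-block zero    m α≈ b = refl
  product-block (suc l) m α≈ b = mul-cong (α≈ _ (s≤s (ℕ.m≤n+m m l)) ℕ.≤-refl)
    (product-block l m (λ v m<v v≤ → α≈ v m<v (ℕ.m≤n⇒m≤1+n v≤))) b

-- Block weights as linear forms

module BlockForms {c ℓ} (R : CommutativeRing c ℓ) (q s : CommutativeRing.Carrier R) where
  open CommutativeRing R hiding (zero)
  open IntegerSolver R
  open QSequences R q using (Seq)
  open Linearisation R q s
  open Compositions R q
  open MajorExcedances R q s
  open Selections R
  open Chains R q s
  open LinearForms R
  open import Relation.Binary.Reasoning.Setoid setoid

  -- The value s past the last block makes these forms agree with `B` and `L` in every variable, not
  -- only in those belonging to b.
  weights : ℕ → List ℕ → ℕ → Form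
  weights d []      i       v = s
  weights d (l ∷ b) zero    v = blockWeight d l (sum b) v
  weights d (l ∷ b) (suc i) v = weights d b i v

  blocks : ℕ → List ℕ → Poly
  blocks d U b = distribute (weights d b) U b

  chains≈blocks : ∀ b {U} → Descending U → chains U b ≈ blocks 1 U b
  chains≈blocks []      {[]}    _ = refl
  chains≈blocks []      {_ ∷ _} _ = refl
  chains≈blocks (l ∷ b) {U}     d = begin
    chains U (l ∷ b)
      ≈⟨ chains≈select l b d ⟩
    select l (blockWeight 1 l (sum b)) U (λ r → chains r b)
      ≈⟨ select-cong l U (All.universal (λ _ → refl) U)
           (λ r r⊆U _ → chains≈blocks b (Descending-resp-⊆ r⊆U d)) ⟩
    select l (blockWeight 1 l (sum b)) U (λ r → blocks 1 r b)
      ≡⟨ distribute-∷ (weights 1 (l ∷ b)) U l b ⟨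
    blocks 1 U (l ∷ b) ∎

  family : ℕ → Poly
  family d b = blocks d (desc (sum b)) b

  sum-zero : ∀ b b′ → sum (b ++ 0 ∷ b′) ≡ sum (b ++ b′)
  sum-zero []      b′ = ≡.refl
  sum-zero (l ∷ b) b′ = ≡.cong (l ℕ.+_) (sum-zero b b′)

  family-zeroInvariant : ∀ d → ZeroInvariant (family d)
  family-zeroInvariant d b b′ = begin
    blocks d (desc (sum (b ++ 0 ∷ b′))) (b ++ 0 ∷ b′)
      ≡⟨ ≡.cong (λ n → blocks d (desc n) (b ++ 0 ∷ b′)) (sum-zero b b′) ⟩
    blocks d (desc (sum (b ++ b′))) (b ++ 0 ∷ b′)
      ≈⟨ go b (desc (sum (b ++ b′))) ⟩
    blocks d (desc (sum (b ++ b′))) (b ++ b′) ∎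
    where
    go : ∀ b U → blocks d U (b ++ 0 ∷ b′) ≈ blocks d U (b ++ b′)
    go []      U = reflexive (distribute-∷ (weights d (0 ∷ b′)) U 0 b′)
    go (l ∷ b) U = begin
      blocks d U (l ∷ b ++ 0 ∷ b′)
        ≡⟨ distribute-∷ (weights d (l ∷ b ++ 0 ∷ b′)) U l (b ++ 0 ∷ b′) ⟩
      select l (blockWeight d l (sum (b ++ 0 ∷ b′))) U (λ r → blocks d r (b ++ 0 ∷ b′))
        ≈⟨ select-cong l U (All.universal (λ v →
             reflexive (≡.cong (λ n → blockWeight d l n v) (sum-zero b b′))) U)
             (λ r _ _ → go b r) ⟩
      select l (blockWeight d l (sum (b ++ b′))) U (λ r → blocks d r (b ++ b′))
        ≡⟨ distribute-∷ (weights d (l ∷ b ++ b′)) U l (b ++ b′) ⟨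
      blocks d U (l ∷ b ++ b′) ∎

  cons : Carrier → Form → Form
  cons a α zero    = a
  cons a α (suc i) = α i

  -- Prepends the weights in the p blocks already passed. Those blocks lie at larger positions than
  -- the values of the letters still considered, so each weight there is 1.
  up : ℕ → Form → Form
  up zero    α = α
  up (suc p) α = cons 1# (up p α)

  cons-cong : ∀ a {α β} → (∀ i → α i ≈ β i) → ∀ i → cons a α i ≈ cons a β i
  cons-cong a α≈ zero    = refl
  cons-cong a α≈ (suc i) = α≈ i

  up-cong : ∀ p {α β} → (∀ i → α i ≈ β i) → ∀ i → up p α i ≈ up p β i
  up-cong zero    α≈ = α≈
  up-cong (suc p) α≈ = cons-cong 1# (up-cong p α≈)

  up-cons : ∀ p α i → up p (cons 1# α) i ≈ up (suc p) α i
  up-cons zero    α i = refl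
  up-cons (suc p) α i = cons-cong 1# (up-cons p α) i

  -- B p is ∑_{i < p} xᵢ + s ∑_{i ≥ p} xᵢ and X p is x_p. The last block of a word
  -- comes first, so in the family 1 the least letter of the block p has the form
  -- B (suc p); all other letters have the form L p.
  B X L : ℕ → Form
  B zero    = λ _ → s
  B (suc p) = cons 1# (B p)
  X zero    = cons 1# (λ _ → 0#)
  X (suc p) = cons 0# (X p)
  L p i     = B p i + X p i

  L-B : ∀ p i → L p i ≈ B (suc p) i + s * X p i
  L-B zero    zero          = solve 1 (λ s → s :+ :1 := :1 :+ s :* :1) refl s
  L-B zero    (suc i)       = solve 1 (λ s → s :+ :0 := s :+ s :* :0) refl s
  L-B (suc p) zero          = solve 1 (λ s → :1 :+ :0 := :1 :+ s :* :0) refl s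
  L-B (suc p) (suc i)       = L-B p i

  up-B₁ : ∀ p i → up p (B 1) i ≈ B (suc p) i
  up-B₁ zero    i = refl
  up-B₁ (suc p) i = cons-cong 1# (up-B₁ p) i

  up-L : ∀ p i → up p (L 0) i ≈ L p i
  up-L zero    i       = refl
  up-L (suc p) zero    = sym (+-identityʳ _)
  up-L (suc p) (suc i) = up-L p i

  -- For d = 1 an empty block would break this: at v = suc (sum b) its weight is 0 instead of s.
  -- Hence the positivity assumptions in the lemmas for `family 1`.
  weights-large : ∀ d b v → All (d ℕ.≤_) b → sum b ℕ.< v → ∀ i → weights d b i v ≈ s
  weights-large d []      v _           _   i       = refl
  weights-large d (l ∷ b) v (d≤l ∷ d≤b) b<v zero
    rewrite <ᵇ-false {v} {suc (l ℕ.+ sum b)} b<v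
          | <ᵇ-true {d ℕ.+ sum b} {v} (ℕ.≤-<-trans (ℕ.+-monoˡ-≤ (sum b) d≤l) b<v) =
    solve 1 (λ s → :0 :+ s :* :1 := s) refl s
  weights-large d (l ∷ b) v (d≤l ∷ d≤b) b<v (suc i) =
    weights-large d b v d≤b (ℕ.≤-<-trans (ℕ.m≤n+m (sum b) l) b<v) i

  weights-below : ∀ d l b v → v ℕ.≤ sum b → ∀ i → weights d (l ∷ b) i v ≈
    cons 1# (λ i → weights d b i v) i
  weights-below d l b v v≤ zero
    rewrite <ᵇ-true {v} {suc (l ℕ.+ sum b)} (s≤s (ℕ.m≤n⇒m≤o+n l v≤))
          | <ᵇ-false {d ℕ.+ sum b} {v} (ℕ.m≤n⇒m≤o+n d v≤) = solve 1 (λ s → :1 :+ s :* :0 := :1) refl s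
  weights-below d l b v v≤ (suc i) = refl

  weights-L : ∀ d l b v → All (d ℕ.≤_) b → d ℕ.+ sum b ℕ.< v → v ℕ.≤ l ℕ.+ sum b → ∀ i →
              weights d (l ∷ b) i v ≈ L 0 i
  weights-L d l b v d≤b <v v≤ zero
    rewrite <ᵇ-true {v} {suc (l ℕ.+ sum b)} (s≤s v≤) | <ᵇ-true {d ℕ.+ sum b} {v} <v =
    solve 1 (λ s → :1 :+ s :* :1 := s :+ :1) refl s
  weights-L d l b v d≤b <v v≤ (suc i) =
    trans (weights-large d b v d≤b (ℕ.m+n≤o⇒n≤o d (ℕ.≤-trans (ℕ.≤-reflexive (ℕ.+-suc d _)) <v)) i)
      (sym (+-identityʳ s))

  weights-least : ∀ l b → Positive b → ∀ i → weights 1 (suc l ∷ b) i (suc (sum b)) ≈ B 1 i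
  weights-least l b b>0 zero
    rewrite <ᵇ-true {sum b} {suc (l ℕ.+ sum b)} (s≤s (ℕ.m≤n+m (sum b) l))
          | <ᵇ-false {suc (sum b)} {suc (sum b)} ℕ.≤-refl = solve 1 (λ s → :1 :+ s :* :0 := :1) refl s
  weights-least l b b>0 (suc i) = weights-large 1 b _ b>0 ℕ.≤-refl i

  L^ : ℕ → ℕ → Poly → Poly
  L^ p l = mulAll (replicate l (L p))

  powers : ℕ → List ℕ → Poly
  powers p []      = one
  powers p (l ∷ b) = L^ p l (powers (suc p) b)

  -- The clause for an empty block is junk.
  special : (ℕ → Form) → ℕ → List ℕ → Poly
  special H p []          = one
  special H p (zero ∷ b)  = special H (suc p) b
  special H p (suc l ∷ b) = L^ p l (mul (H p) (special H (suc p) b))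

  product-powers : ∀ α p b → (∀ v → v ℕ.≤ sum b → ∀ i → α v i ≈ up p (λ i → weights 0 b i v) i) →
                   product α (sum b) ≗ powers p b
  product-powers α p []      α≈ _ = refl
  product-powers α p (l ∷ b) α≈ b′ = trans
    (product-block {β = L p} l (sum b) (λ v <v v≤ i → trans (α≈ v v≤ i)
      (trans (up-cong p (weights-L 0 l b v (All.universal (λ _ → z≤n) b) <v v≤) i) (up-L p i))) b′)
    (mulAll-cong (replicate l (L p)) (product-powers α (suc p) b (λ v v≤ i →
      trans (α≈ v (ℕ.m≤n⇒m≤o+n l v≤) i) (trans (up-cong p (weights-below 0 l b v v≤) i)
        (up-cons p _ i)))) b′)

  product-special : ∀ α p b → Positive b →
    (∀ v → v ℕ.≤ sum b → ∀ i → α v i ≈ up p (λ i → weights 1 b i v) i) →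
                    product α (sum b) ≗ special (B ∘ suc) p b
  product-special α p []          _         α≈ _  = refl
  product-special α p (suc l ∷ b) (_ ∷ b>0) α≈ b′ = trans
    (reflexive (≡.cong (λ n → product α n b′) (≡.sym (ℕ.+-suc l (sum b)))))
    (trans
      (product-block {β = L p} l (suc (sum b)) (λ v <v v≤ i → let v≤′ = ℕ.≤-trans v≤ (ℕ.≤-reflexive (ℕ.+-suc l (sum b))) in
        trans (α≈ v v≤′ i) (trans (up-cong p (weights-L 1 (suc l) b v b>0 <v v≤′) i) (up-L p i))) b′)
      (mulAll-cong (replicate l (L p)) (mul-cong
        (λ i → trans (α≈ (suc (sum b)) (s≤s (ℕ.m≤n+m (sum b) l)) i)
          (trans (up-cong p (weights-least l b b>0) i) (up-B₁ p i)))
        (product-special α (suc p) b b>0 (λ v v≤ i → trans (α≈ v (ℕ.m≤n⇒m≤o+n (suc l) v≤) i)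
          (trans (up-cong p (weights-below 1 (suc l) b v v≤) i) (up-cons p _ i))))) b′))

  family₀ : ∀ b → family 0 b ≈ powers 0 b b
  family₀ b = trans (distribute-desc (weights 0 b) (sum b) b) (product-powers _ 0 b (λ _ _ _ → refl) b)

  family₁ : ∀ b → Positive b → family 1 b ≈ special (B ∘ suc) 0 b b
  family₁ b b>0 = trans (distribute-desc (weights 1 b) (sum b) b)
    (product-special _ 0 b b>0 (λ _ _ _ → refl) b)

  -- A marked block trades one factor `L p` for the variable `X p`: taking the coefficient with one
  -- letter fewer amounts to multiplying by that variable, see `mul-X`.
  marked : ℕ → Seq → List ℕ → Poly
  marked p γ []          = λ b → γ 0 * one b
  marked p γ (zero ∷ b)  = marked (suc p) γ b
  marked p γ (suc l ∷ b) = L^ p l (λ b′ → mul (L p) (marked (suc p) γ b) b′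
    + mul (X p) (marked (suc p) (γ ∘ suc) b) b′)

  mul-X : ∀ b₀ l b f → mul (X (length b₀)) f (b₀ ++ suc l ∷ b) ≈ f (b₀ ++ l ∷ b)
  mul-X []       l b f = trans (+-cong (*-identityˡ _) (mul-form-0 _ b)) (+-identityʳ _)
  mul-X (k ∷ b₀) l b f = trans (+-cong (zeroˡ _) (mul-X b₀ l b (λ b → f (k ∷ b)))) (+-identityˡ _)

  private
    length-snoc : ∀ (b : List ℕ) l → length (b ++ l ∷ []) ≡ suc (length b)
    length-snoc []      l = ≡.refl
    length-snoc (_ ∷ b) l = ≡.cong suc (length-snoc b l)

  -- The recursion runs through b, but coefficients are taken at the whole of b₀ ++ b. So b₀ records
  -- the sizes of the blocks passed, and αs the linear forms that they contributed.
  mark≈marked : ∀ αs b₀ γ F b → (∀ b → F b ≈ mulAll αs (powers (length b₀) b) (b₀ ++ b)) →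
                mark γ F b ≈ mulAll αs (marked (length b₀) γ b) (b₀ ++ b)
  mark≈marked αs b₀ γ F []         F≈ = trans (*-congˡ (F≈ [])) (sym (mulAll-* αs (γ 0) one (b₀ ++ [])))
  mark≈marked αs b₀ γ F (zero ∷ b) F≈ = begin
    mark γ (λ b → F (0 ∷ b)) b
      ≈⟨ mark≈marked αs (b₀ ++ 0 ∷ []) γ (λ b → F (0 ∷ b)) b (λ b → trans (F≈ (0 ∷ b))
           (reflexive (≡.cong₂ (λ n → mulAll αs (powers n b)) (≡.sym (length-snoc b₀ 0))
             (≡.sym (List.++-assoc b₀ (0 ∷ []) b))))) ⟩
    mulAll αs (marked (length (b₀ ++ 0 ∷ [])) γ b) ((b₀ ++ 0 ∷ []) ++ b)
      ≡⟨ ≡.cong₂ (λ n → mulAll αs (marked n γ b)) (length-snoc b₀ 0) (List.++-assoc b₀ (0 ∷ []) b) ⟩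
    mulAll αs (marked (suc (length b₀)) γ b) (b₀ ++ 0 ∷ b) ∎
  mark≈marked αs b₀ γ F (suc l ∷ b) F≈ = begin
    mark γ (λ b → F (suc l ∷ b)) b + mark (γ ∘ suc) (λ b → F (l ∷ b)) b
      ≈⟨ +-cong (block γ (suc l)) (block (γ ∘ suc) l) ⟩
    mulAll αs (L^ p (suc l) M) (b₀ ++ suc l ∷ b) + mulAll αs (L^ p l M⁺) (b₀ ++ l ∷ b)
      ≈⟨ +-cong (mulAll-cong αs (mul-mulAll (L p) ls M) _)
           (sym (mul-X b₀ l b (mulAll αs (L^ p l M⁺)))) ⟩
    mulAll αs (L^ p l (mul (L p) M)) (b₀ ++ suc l ∷ b) + mul (X p) (mulAll αs (L^ p l M⁺))
      (b₀ ++ suc l ∷ b)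
      ≈⟨ +-congˡ (trans (mul-mulAll (X p) αs (L^ p l M⁺) _)
           (mulAll-cong αs (mul-mulAll (X p) ls M⁺) _)) ⟩
    mulAll αs (L^ p l (mul (L p) M)) (b₀ ++ suc l ∷ b) + mulAll αs (L^ p l (mul (X p) M⁺))
      (b₀ ++ suc l ∷ b)
      ≈⟨ trans (mulAll-cong αs (mulAll-+ ls (mul (L p) M) (mul (X p) M⁺)) _)
           (mulAll-+ αs (L^ p l (mul (L p) M)) (L^ p l (mul (X p) M⁺)) _) ⟨
    mulAll αs (marked p γ (suc l ∷ b)) (b₀ ++ suc l ∷ b) ∎
    where
    p  = length b₀
    ls = replicate l (L p)
    M  = marked (suc p) γ b
    M⁺ = marked (suc p) (γ ∘ suc) b

    block : ∀ γ l → mark γ (λ b → F (l ∷ b)) b ≈ mulAll αs (L^ p l (marked (suc p) γ b)) (b₀ ++ l ∷ b)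
    block γ l = begin
      mark γ (λ b → F (l ∷ b)) b
        ≈⟨ mark≈marked (αs ++ replicate l (L p)) (b₀ ++ l ∷ []) γ (λ b → F (l ∷ b)) b
             (λ b → trans (F≈ (l ∷ b)) (trans
             (sym (mulAll-++ αs (replicate l (L p)) (powers (suc p) b) _))
             (reflexive (≡.cong₂ (λ n → mulAll (αs ++ replicate l (L p)) (powers n b))
               (≡.sym (length-snoc b₀ l)) (≡.sym (List.++-assoc b₀ (l ∷ []) b)))))) ⟩
      mulAll (αs ++ replicate l (L p)) (marked (length (b₀ ++ l ∷ [])) γ b) ((b₀ ++ l ∷ []) ++ b)
        ≡⟨ ≡.cong₂ (λ n → mulAll (αs ++ replicate l (L p)) (marked n γ b)) (length-snoc b₀ l)
             (List.++-assoc b₀ (l ∷ []) b) ⟩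
      mulAll (αs ++ replicate l (L p)) (marked (suc p) γ b) (b₀ ++ l ∷ b)
        ≈⟨ mulAll-++ αs (replicate l (L p)) (marked (suc p) γ b) _ ⟩
      mulAll αs (L^ p l (marked (suc p) γ b)) (b₀ ++ l ∷ b) ∎

  mark-family₀ : ∀ γ b → mark γ (family 0) b ≈ marked 0 γ b b
  mark-family₀ γ b = mark≈marked [] [] γ (family 0) b family₀

-- The identities M = W ⋆ K and P ⋆ K = δ

module Equidistribution {c ℓ} (R : CommutativeRing c ℓ) (q s : CommutativeRing.Carrier R) where
  open CommutativeRing R hiding (zero)
  open IntegerSolver R
  open QSequences R q
  open WordSums R
  open AdmissibleInversions R q s using (A; A-riccati)
  open Linearisation R q s
  open Compositions R q
  open MajorExcedances R q s using (weightʳ; weightʳ-chains; chains)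
  open LinearForms R
  open BlockForms R q s
  open import Algebra.Properties.Semiring.Exp semiring using (_^_)
  open import Relation.Binary.Reasoning.Setoid setoid

  L^-cong : ∀ p l {f g} → f ≗ g → L^ p l f ≗ L^ p l g
  L^-cong p l = mulAll-cong (replicate l (L p))

  marked-cong : ∀ p {γ γ′} b → γ ≋ γ′ → marked p γ b ≗ marked p γ′ b
  marked-cong p []          γ≋ _  = *-congʳ (γ≋ 0)
  marked-cong p (zero ∷ b)  γ≋    = marked-cong (suc p) b γ≋
  marked-cong p (suc l ∷ b) γ≋    = L^-cong p l λ b′ →
    +-cong (mul-congʳ (marked-cong (suc p) b γ≋) b′) (mul-congʳ (marked-cong (suc p) b (γ≋ ∘ suc)) b′)

  marked-⊙ : ∀ p a γ b → marked p (a ⊙ γ) b ≗ λ b′ → a * marked p γ b b′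
  marked-⊙ p a γ []          _  = *-assoc _ _ _
  marked-⊙ p a γ (zero ∷ b)     = marked-⊙ (suc p) a γ b
  marked-⊙ p a γ (suc l ∷ b) b′ = trans
    (L^-cong p l (λ b′ → trans
      (+-cong (trans (mul-congʳ (marked-⊙ (suc p) a γ b) b′) (mul-* (L p) a (marked (suc p) γ b) b′))
              (trans (mul-congʳ (marked-⊙ (suc p) a (γ ∘ suc) b) b′)
                (mul-* (X p) a (marked (suc p) (γ ∘ suc) b) b′)))
      (sym (distribˡ _ _ _))) b′)
    (mulAll-* (replicate l (L p)) a _ b′)

  marked-⊕ : ∀ p γ γ′ b → marked p (γ ⊕ γ′) b ≗ λ b′ → marked p γ b b′ + marked p γ′ b b′
  marked-⊕ p γ γ′ []          _  = distribʳ _ _ _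
  marked-⊕ p γ γ′ (zero ∷ b)     = marked-⊕ (suc p) γ γ′ b
  marked-⊕ p γ γ′ (suc l ∷ b) b′ = trans
    (L^-cong p l (λ b′ → trans
      (+-cong (trans (mul-congʳ (marked-⊕ (suc p) γ γ′ b) b′)
        (mul-+ (L p) (marked (suc p) γ b) (marked (suc p) γ′ b) b′))
              (trans (mul-congʳ (marked-⊕ (suc p) (γ ∘ suc) (γ′ ∘ suc) b) b′)
                (mul-+ (X p) (marked (suc p) (γ ∘ suc) b) (marked (suc p) (γ′ ∘ suc) b) b′)))
      (solve 4 (λ a b c d → a :+ b :+ (c :+ d) := a :+ c :+ (b :+ d)) refl _ _ _ _)) b′)
    (mulAll-+ (replicate l (L p)) _ _ b′)

  combine : ∀ α β γ a f → (∀ i → α i + a * β i ≈ γ i) → (λ b → mul α f b + a * mul β f b) ≗ mul γ f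
  combine α β γ a f eq b = begin
    mul α f b + a * mul β f b            ≈⟨ +-congˡ (mul-form-* a β f b) ⟨
    mul α f b + mul (λ i → a * β i) f b  ≈⟨ mul-form-+ α (λ i → a * β i) f b ⟨
    mul (λ i → α i + a * β i) f b        ≈⟨ mul-cong eq (λ _ → refl) b ⟩
    mul γ f b                            ∎

  -- For γ k = aᵏ the sum over sets of marked blocks factors: in each block one factor `L p` becomes
  -- `L p` + a `X p`. The value a = -s yields `B (suc p)`, the form of the least letter of a block
  -- in `family 1`, and a = -1 yields `B p`.
  marked-geometric : ∀ a H → (∀ p i → L p i + a * X p i ≈ H p i) →
    ∀ p b → Positive b → marked p (a ^_) b ≗ special H p b
  marked-geometric a H eq p []          _         _  = *-identityˡ _
  marked-geometric a H eq p (suc l ∷ b) (_ ∷ b>0) = L^-cong p l λ b′ → begin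
    mul (L p) (marked (suc p) (a ^_) b) b′ + mul (X p) (marked (suc p) (a ⊙ (a ^_)) b) b′
      ≈⟨ +-congˡ (trans (mul-congʳ (marked-⊙ (suc p) a (a ^_) b) b′)
           (mul-* (X p) a (marked (suc p) (a ^_) b) b′)) ⟩
    mul (L p) (marked (suc p) (a ^_) b) b′ + a * mul (X p) (marked (suc p) (a ^_) b) b′
      ≈⟨ combine (L p) (X p) (H p) a (marked (suc p) (a ^_) b) (eq p) b′ ⟩
    mul (H p) (marked (suc p) (a ^_) b) b′
      ≈⟨ mul-congʳ (marked-geometric a H eq (suc p) b b>0) b′ ⟩
    mul (H p) (special H (suc p) b) b′ ∎

  marked-geo : ∀ p b → Positive b → marked p geo b ≗ special (B ∘ suc) p b
  marked-geo = marked-geometric (- s) (B ∘ suc) (λ p i → trans (+-congʳ (L-B p i))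
    (solve 3 (λ s x y → y :+ s :* x :+ :- s :* x := y) refl s (X p i) (B (suc p) i)))

  marked-sgn : ∀ p b → Positive b → marked p sgn b ≗ special B p b
  marked-sgn = marked-geometric (- 1#) B (λ p i → solve 2 (λ x y → y :+ x :+ :- :1 :* x := y) refl
    (X p i) (B p i))

  -- J p k is ∑_{i < p} xᵢ + s ∑_{i ≥ p + k} xᵢ.
  J : ℕ → ℕ → Form
  J zero    zero    = λ _ → s
  J zero    (suc k) = cons 0# (J zero k)
  J (suc p) k       = cons 1# (J p k)

  J-X : ∀ p k i → J (suc p) k i - X p i ≈ J p (suc k) i
  J-X zero    k zero    = -‿inverseʳ 1#
  J-X zero    k (suc i) = solve 1 (λ x → x :- :0 := x) refl _
  J-X (suc p) k zero    = solve 0 (:1 :- :0 := :1) refl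
  J-X (suc p) k (suc i) = J-X p k i

  J-L : ∀ p i → L p i + num 1 * X p i ≈ J p 1 i
  J-L zero    zero    = solve 1 (λ s → s :+ :1 :+ (:- :1 :+ :- s :* :1) :* :1 := :0) refl s
  J-L zero    (suc i) = solve 1 (λ s → s :+ :0 :+ (:- :1 :+ :- s :* :1) :* :0 := s) refl s
  J-L (suc p) zero    = solve 1 (λ s → :1 :+ :0 :+ (:- :1 :+ :- s :* :1) :* :0 := :1) refl s
  J-L (suc p) (suc i) = J-L p i

  -- The first variable in `J 0 (length b)` is the one just past those of b.
  mul-J : ∀ b f → mul (J 0 (length b)) f b ≈ 0#
  mul-J []      f = refl
  mul-J (l ∷ b) f = trans (+-cong (zeroˡ _) (mul-J b _)) (+-identityˡ 0#)

  -- Up to a factor 1 - s, the family num is sgn - s geo, and the product of the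
  -- forms B 0, …, B (k - 1) differs from s times that of B 1, …, B k by a
  -- multiple of B 0 - s B k, which vanishes on k variables. To avoid dividing by
  -- 1 - s, (B p - s B (p + k)) / (1 - s) is replaced by J p k.
  marked-num : ∀ p l b → Positive b →
    marked p num (suc l ∷ b) ≗ L^ p l (mul (J p (suc (length b))) (special B (suc p) b))
  marked-num p l [] _ = L^-cong p l λ b′ → begin
    mul (L p) (λ b → 1# * one b) b′ + mul (X p) (λ b → num 1 * one b) b′
      ≈⟨ +-cong (mul-congʳ (λ b → *-identityˡ _) b′) (mul-* (X p) (num 1) one b′) ⟩
    mul (L p) one b′ + num 1 * mul (X p) one b′
      ≈⟨ combine (L p) (X p) (J p 1) (num 1) one (J-L p) b′ ⟩
    mul (J p 1) one b′ ∎
  marked-num p l b@(suc l′ ∷ b₁) b>0@(_ ∷ b₁>0) = L^-cong p l λ b′ → begin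
    mul (L p) M b′ + mul (X p) (marked (suc p) (num ∘ suc) b) b′
      ≈⟨ +-congˡ (trans (mul-congʳ num⁺ b′) (trans (mul-+ (X p) _ _ b′)
           (+-cong (mul-* (X p) (- 1#) Y b′) (mul-* (X p) (- s) M b′)))) ⟩
    mul (L p) M b′ + (- 1# * mul (X p) Y b′ + - s * mul (X p) M b′)
      ≈⟨ solve 3 (λ a b c → a :+ (b :+ c) := a :+ c :+ b) refl _ _ _ ⟩
    mul (L p) M b′ + - s * mul (X p) M b′ + - 1# * mul (X p) Y b′
      ≈⟨ +-congʳ (combine (L p) (X p) (B (suc p)) (- s) M (λ i → trans (+-congʳ (L-B p i))
           (solve 3 (λ s x y → y :+ s :* x :+ :- s :* x := y) refl s (X p i) (B (suc p) i))) b′) ⟩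
    mul (B (suc p)) M b′ + - 1# * mul (X p) Y b′
      ≈⟨ +-congʳ (BM b′) ⟩
    mul (J (suc p) (length b)) Y b′ + - 1# * mul (X p) Y b′
      ≈⟨ combine (J (suc p) (length b)) (X p) (J p (suc (length b))) (- 1#) Y
           (λ i → trans (+-congˡ (solve 1 (λ x → :- :1 :* x := :- x) refl (X p i)))
             (J-X p (length b) i)) b′ ⟩
    mul (J p (suc (length b))) Y b′ ∎
    where
    M = marked (suc p) num b
    Y = special B (suc p) b

    num⁺ : marked (suc p) (num ∘ suc) b ≗ λ b′ → - 1# * Y b′ + - s * M b′
    num⁺ b′ = begin
      marked (suc p) (num ∘ suc) b b′
        ≈⟨ marked-cong (suc p) b (λ n → trans (num-suc n)
             (+-congʳ (solve 1 (λ x → :- x := :- :1 :* x) refl (sgn n)))) b′ ⟩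
      marked (suc p) ((- 1#) ⊙ sgn ⊕ (- s) ⊙ num) b b′
        ≈⟨ trans (marked-⊕ (suc p) ((- 1#) ⊙ sgn) ((- s) ⊙ num) b b′)
             (+-cong (marked-⊙ (suc p) (- 1#) sgn b b′) (marked-⊙ (suc p) (- s) num b b′)) ⟩
      - 1# * marked (suc p) sgn b b′ + - s * M b′
        ≈⟨ +-congʳ (*-congˡ (marked-sgn (suc p) b b>0 b′)) ⟩
      - 1# * Y b′ + - s * M b′ ∎

    -- By induction M contains the factor J′. Once J′ is moved outwards, `B (suc p)` joins the forms
    -- of the block l′, and together with Y₁ they make up Y.
    BM : ∀ b′ → mul (B (suc p)) M b′ ≈ mul (J (suc p) (length b)) Y b′
    BM b′ = begin
      mul (B (suc p)) M b′
        ≈⟨ mul-congʳ (marked-num (suc p) l′ b₁ b₁>0) b′ ⟩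
      mul (B (suc p)) (L^ (suc p) l′ (mul J′ Y₁)) b′
        ≈⟨ mul-congʳ (mul-mulAll J′ (replicate l′ (L (suc p))) Y₁) b′ ⟨
      mul (B (suc p)) (mul J′ (L^ (suc p) l′ Y₁)) b′
        ≈⟨ mul-comm (B (suc p)) J′ (L^ (suc p) l′ Y₁) b′ ⟩
      mul J′ (mul (B (suc p)) (L^ (suc p) l′ Y₁)) b′
        ≈⟨ mul-congʳ (mul-mulAll (B (suc p)) (replicate l′ (L (suc p))) Y₁) b′ ⟩
      mul J′ Y b′ ∎
      where
      J′ = J (suc p) (length b)
      Y₁ = special B (suc (suc p)) b₁

  mark-geo : ∀ b → Positive b → mark geo (family 0) b ≈ family 1 b
  mark-geo b b>0 = begin
    mark geo (family 0) b         ≈⟨ mark-family₀ geo b ⟩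
    marked 0 geo b b              ≈⟨ marked-geo 0 b b>0 b ⟩
    special (B ∘ suc) 0 b b       ≈⟨ family₁ b b>0 ⟨
    family 1 b                    ∎

  mark-num : ∀ l b → Positive (suc l ∷ b) → mark num (family 0) (suc l ∷ b) ≈ 0#
  mark-num l b (_ ∷ b>0) = begin
    mark num (family 0) (suc l ∷ b)
      ≈⟨ mark-family₀ num (suc l ∷ b) ⟩
    marked 0 num (suc l ∷ b) (suc l ∷ b)
      ≈⟨ marked-num 0 l b b>0 (suc l ∷ b) ⟩
    L^ 0 l (mul (J 0 (suc (length b))) (special B 1 b)) (suc l ∷ b)
      ≈⟨ mul-mulAll (J 0 (suc (length b))) (replicate l (L 0)) (special B 1 b) (suc l ∷ b) ⟨
    mul (J 0 (suc (length b))) (L^ 0 l (special B 1 b)) (suc l ∷ b)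
      ≈⟨ mul-J (suc l ∷ b) (L^ 0 l (special B 1 b)) ⟩
    0# ∎

  K M : Seq
  K   = Φ (family 0)
  M n = wordSum n (desc n) weightʳ

  M≈W⋆K : M ≋ W ⋆ K
  M≈W⋆K n = begin
    wordSum n (desc n) weightʳ
      ≈⟨ weightʳ-chains n (desc n) (≡.sym (List.length-applyDownFrom suc n)) ⟩
    Φ (chains (desc n)) n
      ≈⟨ Φ-cong n (λ b b>0 len → trans (chains≈blocks b (desc-descending n))
           (trans (reflexive (≡.cong (λ m → blocks 1 (desc m) b) (≡.sym len)))
             (sym (mark-geo b b>0)))) ⟩
    Φ (mark geo (family 0)) n
      ≈⟨ gauss-⋆-Φ n geo (family 0) (family-zeroInvariant 0) ⟨
    (W ⋆ K) n ∎

  P⋆K≈δ : P ⋆ K ≋ δ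
  P⋆K≈δ n = trans (gauss-⋆-Φ n num (family 0) (family-zeroInvariant 0))
    (Φ-δ (*-identityˡ 1#) mark-num n)

  A≈M : A ≋ M
  A≈M n = begin
    A n                 ≈⟨ δ-⋆ A n ⟨
    (δ ⋆ A) n           ≈⟨ ⋆-congʳ (λ k → trans (⋆-comm K P k) (P⋆K≈δ k)) n ⟨
    ((K ⋆ P) ⋆ A) n     ≈⟨ ⋆-assoc K P A n ⟩
    (K ⋆ (P ⋆ A)) n     ≈⟨ ⋆-congˡ (P⋆riccati A (*-identityˡ 1#) A-riccati) n ⟩
    (K ⋆ W) n           ≈⟨ ⋆-comm K W n ⟩
    (W ⋆ K) n           ≈⟨ M≈W⋆K n ⟨
    M n                 ∎

-- From permutations to words

anyᵇ : ∀ {n} → (Fin n → Bool) → Bool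
anyᵇ {zero}  p = false
anyᵇ {suc n} p = p zero ∨ anyᵇ (p ∘ suc)

does-any? : ∀ {n p} {P : Pred (Fin n) p} (P? : Decidable P) → does (Fin.any? P?) ≡ anyᵇ (does ∘ P?)
does-any? {zero}  P? = ≡.refl
does-any? {suc n} P? = ≡.cong (does (P? zero) ∨_) (does-any? (P? ∘ suc))

anyᵇ-false : ∀ n → anyᵇ {n} (λ _ → false) ≡ false
anyᵇ-false zero    = ≡.refl
anyᵇ-false (suc n) = anyᵇ-false n

∑ᶠ : ∀ {n} → (Fin n → ℕ) → ℕ
∑ᶠ f = sum (tabulate f)

∑ᶠ-cong : ∀ {n} {f g : Fin n → ℕ} → (∀ i → f i ≡ g i) → ∑ᶠ f ≡ ∑ᶠ g
∑ᶠ-cong eq = ≡.cong sum (List.tabulate-cong eq)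

module _ {a p} {A : Set a} {P : Pred A p} (P? : Decidable P) where

  length-filter-tabulate : ∀ {n} (g : Fin n → A) →
    length (filter P? (tabulate g)) ≡ ∑ᶠ (λ i → 𝟙 (does (P? (g i))))
  length-filter-tabulate {zero}  g = ≡.refl
  length-filter-tabulate {suc n} g with does (P? (g zero))
  ... | true  = ≡.cong suc (length-filter-tabulate (g ∘ suc))
  ... | false = length-filter-tabulate (g ∘ suc)

  sum-filter-tabulate : ∀ (h : A → ℕ) {n} (g : Fin n → A) →
    sum (map h (filter P? (tabulate g))) ≡ ∑ᶠ (λ i → 𝟙 (does (P? (g i))) ℕ.* h (g i))
  sum-filter-tabulate h {zero}  g = ≡.refl
  sum-filter-tabulate h {suc n} g with does (P? (g zero))
  ... | true  = ≡.cong₂ ℕ._+_ (≡.sym (ℕ.*-identityˡ _)) (sum-filter-tabulate h (g ∘ suc))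
  ... | false = sum-filter-tabulate h (g ∘ suc)

length-filter-product : ∀ {a b p} {A : Set a} {B : Set b} {P : Pred (A × B) p} (P? : Decidable P)
  {m n} (g : Fin m → A) (h : Fin n → B) →
  length (filter P? (cartesianProduct (tabulate g) (tabulate h))) ≡
  ∑ᶠ (λ i → ∑ᶠ (λ j → 𝟙 (does (P? (g i , h j)))))
length-filter-product P? {zero}  g h = ≡.refl
length-filter-product P? {suc m} g h = begin
  length (filter P? (map (g zero ,_) (tabulate h) ++ rest))
    ≡⟨ ≡.cong length (List.filter-++ P? (map (g zero ,_) (tabulate h)) rest) ⟩
  length (filter P? (map (g zero ,_) (tabulate h)) ++ filter P? rest)
    ≡⟨ List.length-++ (filter P? (map (g zero ,_) (tabulate h))) ⟩
  length (filter P? (map (g zero ,_) (tabulate h))) ℕ.+ length (filter P? rest)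
    ≡⟨ ≡.cong₂ ℕ._+_ (≡.trans (≡.cong (length ∘ filter P?) (List.map-tabulate h (g zero ,_)))
         (length-filter-tabulate P? (λ j → g zero , h j))) (length-filter-product P? (g ∘ suc) h) ⟩
  ∑ᶠ (λ i → ∑ᶠ (λ j → 𝟙 (does (P? (g i , h j))))) ∎
  where
  open ≡.≡-Reasoning
  rest = cartesianProduct (tabulate (g ∘ suc)) (tabulate h)

descentAt : ∀ {n} → (Fin n → ℕ) → Fin n → Bool
descentAt f i = anyᵇ λ j → (toℕ j ≡ᵇ suc (toℕ i)) ∧ (f j <ᵇ f i)

descentAt-zero : ∀ {n} (f : Fin (suc (suc n)) → ℕ) → descentAt f zero ≡ (f (suc zero) <ᵇ f zero)
descentAt-zero {n} f = ≡.trans (≡.cong ((f (suc zero) <ᵇ f zero) ∨_) (anyᵇ-false n)) (∨-identityʳ _)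

∑-desFrom : ∀ {n} (f : Fin (suc n) → ℕ) → ∑ᶠ (𝟙 ∘ descentAt f) ≡ desFrom (f zero) (tabulate (f ∘ suc))
∑-desFrom {zero}  f = ≡.refl
∑-desFrom {suc n} f = ≡.cong₂ ℕ._+_ (≡.cong 𝟙 (descentAt-zero f)) (∑-desFrom (f ∘ suc))

majFwd : ℕ → ℕ → List ℕ → ℕ
majFwd k x []      = 0
majFwd k x (y ∷ w) = 𝟙 (not (x <ᵇ y)) ℕ.* k ℕ.+ majFwd (suc k) y w

not-<ᵇ : ∀ x y → ¬ x ≡ y → not (x <ᵇ y) ≡ (y <ᵇ x)
not-<ᵇ x y x≢y with x ℕ.<? y
... | yes x<y rewrite <ᵇ-true x<y = ≡.sym (<ᵇ-false (ℕ.<⇒≤ x<y))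
... | no  x≮y rewrite <ᵇ-false (ℕ.≮⇒≥ x≮y) = ≡.sym (<ᵇ-true (ℕ.≤∧≢⇒< (ℕ.≮⇒≥ x≮y) (x≢y ∘ ≡.sym)))

∑-majFwd : ∀ {n} k (f : Fin (suc n) → ℕ) → Injective _≡_ _≡_ f →
  ∑ᶠ (λ i → 𝟙 (descentAt f i) ℕ.* (k ℕ.+ toℕ i)) ≡ majFwd k (f zero) (tabulate (f ∘ suc))
∑-majFwd {zero}  k f inj = ≡.refl
∑-majFwd {suc n} k f inj = ≡.cong₂ ℕ._+_
  (≡.cong₂ (λ b m → 𝟙 b ℕ.* m)
    (≡.trans (descentAt-zero f) (≡.sym (not-<ᵇ _ _ (λ eq → Fin.0≢1+n (inj eq))))) (ℕ.+-identityʳ k))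
  (≡.trans (∑ᶠ-cong {n = suc n} (λ i → ≡.cong (𝟙 (descentAt (f ∘ suc) i) ℕ.*_) (ℕ.+-suc k (toℕ i))))
    (∑-majFwd (suc k) (f ∘ suc) (Fin.suc-injective ∘ inj)))

majʳ-reverse : ∀ x w v → majʳ (w ʳ++ (x ∷ v)) ≡ majFwd (suc (length v)) x w ℕ.+ majʳ (x ∷ v)
majʳ-reverse x []      v = ≡.refl
majʳ-reverse x (y ∷ w) v = begin
  majʳ (w ʳ++ (y ∷ x ∷ v))
    ≡⟨ majʳ-reverse y w (x ∷ v) ⟩
  majFwd (suc (suc (length v))) y w ℕ.+ (d ℕ.+ majʳ (x ∷ v))
    ≡⟨ ℕ.+-assoc (majFwd _ y w) d _ ⟨
  majFwd (suc (suc (length v))) y w ℕ.+ d ℕ.+ majʳ (x ∷ v)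
    ≡⟨ ≡.cong (ℕ._+ majʳ (x ∷ v)) (ℕ.+-comm (majFwd _ y w) d) ⟩
  majFwd (suc (length v)) x (y ∷ w) ℕ.+ majʳ (x ∷ v) ∎
  where
  open ≡.≡-Reasoning
  d = 𝟙 (not (x <ᵇ y)) ℕ.* suc (length v)

excFwd : ℕ → List ℕ → ℕ
excFwd k []      = 0
excFwd k (x ∷ w) = 𝟙 (suc k <ᵇ x) ℕ.+ excFwd (suc k) w

∑-excFwd : ∀ {n} k (f : Fin n → ℕ) → ∑ᶠ (λ i → 𝟙 (k ℕ.+ toℕ i <ᵇ f i)) ≡ excFwd k (tabulate (suc ∘ f))
∑-excFwd {zero}  k f = ≡.refl
∑-excFwd {suc n} k f = ≡.cong₂ ℕ._+_ (≡.cong (λ m → 𝟙 (m <ᵇ f zero)) (ℕ.+-identityʳ k))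
  (≡.trans (∑ᶠ-cong {n = n} (λ i → ≡.cong (λ m → 𝟙 (m <ᵇ f (suc i))) (ℕ.+-suc k (toℕ i))))
    (∑-excFwd (suc k) (f ∘ suc)))

excʳ-reverse : ∀ w v → excʳ (w ʳ++ v) ≡ excFwd (length v) w ℕ.+ excʳ v
excʳ-reverse []      v = ≡.refl
excʳ-reverse (x ∷ w) v = begin
  excʳ (w ʳ++ (x ∷ v))                            ≡⟨ excʳ-reverse w (x ∷ v) ⟩
  excFwd (suc (length v)) w ℕ.+ (e ℕ.+ excʳ v)    ≡⟨ ℕ.+-assoc (excFwd _ w) e _ ⟨
  excFwd (suc (length v)) w ℕ.+ e ℕ.+ excʳ v      ≡⟨ ≡.cong (ℕ._+ excʳ v) (ℕ.+-comm (excFwd _ w) e) ⟩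
  excFwd (length v) (x ∷ w) ℕ.+ excʳ v            ∎
  where
  open ≡.≡-Reasoning
  e = 𝟙 (barred x v)

largerBetween : ∀ {n} → ℕ → (Fin n → ℕ) → Fin n → Bool
largerBetween x g j = anyᵇ λ k → (toℕ k <ᵇ toℕ j) ∧ (x <ᵇ g k)

∑-adm : ∀ {n} b x (g : Fin n → ℕ) →
  ∑ᶠ (λ j → 𝟙 ((g j <ᵇ x) ∧ (b ∨ largerBetween x g j))) ≡ adm b x (tabulate g)
∑-adm {zero}  b x g = ≡.refl
∑-adm {suc n} b x g = ≡.cong₂ ℕ._+_
  (≡.cong 𝟙 (≡.trans (≡.cong (λ c → (g zero <ᵇ x) ∧ (b ∨ c)) (anyᵇ-false n))
    (≡.trans (≡.cong ((g zero <ᵇ x) ∧_) (∨-identityʳ b)) (∧-comm (g zero <ᵇ x) b))))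
  (≡.trans (∑ᶠ-cong {n = n} (λ j → ≡.cong (λ c → 𝟙 ((g (suc j) <ᵇ x) ∧ c))
    (≡.sym (∨-assoc b (x <ᵇ g zero) _))))
    (∑-adm (b ∨ (x <ᵇ g zero)) x (g ∘ suc)))

ascentAt : ∀ {n} → (Fin n → ℕ) → Fin n → Bool
ascentAt f i = anyᵇ λ h → (toℕ i ≡ᵇ suc (toℕ h)) ∧ (f h <ᵇ f i)

largerInside : ∀ {n} → (Fin n → ℕ) → Fin n → Fin n → Bool
largerInside f i j = anyᵇ λ k → (toℕ i <ᵇ toℕ k) ∧ ((toℕ k <ᵇ toℕ j) ∧ (f i <ᵇ f k))

-- ascentInto p f i says that f i exceeds its left neighbour, which is p if i is
-- the first position.
ascentInto : ∀ {n} → ℕ → (Fin n → ℕ) → Fin n → Bool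
ascentInto p f i = (toℕ i ≡ᵇ 0) ∧ (p <ᵇ f i) ∨ ascentAt f i

admissibleAt : ∀ {n} → ℕ → (Fin n → ℕ) → Fin n → Fin n → Bool
admissibleAt p f i j = ((toℕ i <ᵇ toℕ j) ∧ (f j <ᵇ f i)) ∧
  (ascentInto p f i ∨ largerInside f i j)

-- Without the first position, its letter becomes the left neighbour p of the rest. The Boolean
-- conditions are arranged so that this shift holds by computation.
∑-aiFrom : ∀ {n} p (f : Fin n → ℕ) → ∑ᶠ (λ i → ∑ᶠ (λ j → 𝟙 (admissibleAt p f i j))) ≡
  aiFrom p (tabulate f)
∑-aiFrom {zero}  p f = ≡.refl
∑-aiFrom {suc n} p f = ≡.cong₂ ℕ._+_
  (≡.trans (∑ᶠ-cong {n = n} (λ j → ≡.cong (λ c →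
    𝟙 ((f (suc j) <ᵇ f zero) ∧ (c ∨ largerBetween (f zero) (f ∘ suc) j)))
      (≡.trans (≡.cong ((p <ᵇ f zero) ∨_) (anyᵇ-false n)) (∨-identityʳ _))))
    (∑-adm (p <ᵇ f zero) (f zero) (f ∘ suc)))
  (∑-aiFrom (f zero) (f ∘ suc))

-- A first letter may be given itself as left neighbour, since x < x fails just as a missing
-- neighbour does.
aiʷ-aiFrom : ∀ x w → aiʷ (x ∷ w) ≡ aiFrom x (x ∷ w)
aiʷ-aiFrom x w rewrite <ᵇ-false {x} {x} ℕ.≤-refl = ≡.refl

∑-des : ∀ {n} (f : Fin n → ℕ) → ∑ᶠ (𝟙 ∘ descentAt f) ≡ desʷ (tabulate f)
∑-des {zero}  f = ≡.refl
∑-des {suc n} f = ∑-desFrom f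

∑-ai : ∀ {n} (f : Fin n → ℕ) →
  ∑ᶠ (λ i → ∑ᶠ (λ j → 𝟙 (((toℕ i <ᵇ toℕ j) ∧ (f j <ᵇ f i)) ∧ (ascentAt f i ∨ largerInside f i j)))) ≡
  aiʷ (tabulate f)
∑-ai {zero}  f = ≡.refl
∑-ai {suc n} f = ≡.trans
  (∑ᶠ-cong {n = suc n} (λ i → ∑ᶠ-cong {n = suc n} (λ j → ≡.cong
    (λ b → 𝟙 (((toℕ i <ᵇ toℕ j) ∧ (f j <ᵇ f i)) ∧ ((b ∨ ascentAt f i) ∨ largerInside f i j)))
    (≡.sym (no-ascent i)))))
  (≡.trans (∑-aiFrom (f zero) f) (≡.sym (aiʷ-aiFrom (f zero) (tabulate (f ∘ suc)))))
  where
  no-ascent : ∀ i → (toℕ i ≡ᵇ 0) ∧ (f zero <ᵇ f i) ≡ false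
  no-ascent zero    = <ᵇ-false {f zero} ℕ.≤-refl
  no-ascent (suc i) = ≡.refl

∑-maj : ∀ {n} (f : Fin n → ℕ) → Injective _≡_ _≡_ f →
  ∑ᶠ (λ i → 𝟙 (descentAt f i) ℕ.* suc (toℕ i)) ≡ majʳ (reverse (tabulate f))
∑-maj {zero}  f inj = ≡.refl
∑-maj {suc n} f inj = ≡.trans (∑-majFwd 1 f inj) (≡.sym
  (≡.trans (majʳ-reverse (f zero) (tabulate (f ∘ suc)) []) (ℕ.+-identityʳ _)))

module _ {n} (σ : Permutation′ n) where

  private
    f : Fin n → ℕ
    f i = suc (toℕ (σ ⟨$⟩ʳ i))

    f-injective : Injective _≡_ _≡_ f
    f-injective eq = Injection.injective (Inverse⇒Injection σ) (Fin.toℕ-injective (ℕ.suc-injective eq))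

  letters : List ℕ
  letters = tabulate f

  does-descent? : ∀ i → does (isDescent? σ i) ≡ descentAt f i
  does-descent? i = does-any? (λ j → next? i j ×-dec (σ ⟨$⟩ʳ j Fin.<? σ ⟨$⟩ʳ i))

  des-letters : des σ ≡ desʷ letters
  des-letters = begin
    des σ                                       ≡⟨ length-filter-tabulate (isDescent? σ) (λ i → i) ⟩
    ∑ᶠ (λ i → 𝟙 (does (isDescent? σ i)))        ≡⟨ ∑ᶠ-cong (λ i → ≡.cong 𝟙 (does-descent? i)) ⟩
    ∑ᶠ (𝟙 ∘ descentAt f)                        ≡⟨ ∑-des f ⟩
    desʷ letters                                ∎
    where open ≡.≡-Reasoning

  maj-letters : maj σ ≡ majʳ (reverse letters)
  maj-letters = begin
    maj σ
      ≡⟨ sum-filter-tabulate (isDescent? σ) (suc ∘ toℕ) (λ i → i) ⟩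
    ∑ᶠ (λ i → 𝟙 (does (isDescent? σ i)) ℕ.* suc (toℕ i))
      ≡⟨ ∑ᶠ-cong (λ i → ≡.cong (λ b → 𝟙 b ℕ.* suc (toℕ i)) (does-descent? i)) ⟩
    ∑ᶠ (λ i → 𝟙 (descentAt f i) ℕ.* suc (toℕ i))
      ≡⟨ ∑-maj f f-injective ⟩
    majʳ (reverse letters) ∎
    where open ≡.≡-Reasoning

  exc-letters : exc σ ≡ excʳ (reverse letters)
  exc-letters = begin
    exc σ
      ≡⟨ length-filter-tabulate (λ i → i Fin.<? σ ⟨$⟩ʳ i) (λ i → i) ⟩
    ∑ᶠ (λ i → 𝟙 (toℕ i <ᵇ toℕ (σ ⟨$⟩ʳ i)))
      ≡⟨ ∑-excFwd 0 (λ i → toℕ (σ ⟨$⟩ʳ i)) ⟩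
    excFwd 0 letters
      ≡⟨ ≡.trans (excʳ-reverse letters []) (ℕ.+-identityʳ _) ⟨
    excʳ (reverse letters) ∎
    where open ≡.≡-Reasoning

  ai-letters : ai σ ≡ aiʷ letters
  ai-letters = begin
    ai σ
      ≡⟨ length-filter-product (λ p → isInversion? σ p ×-dec isAdmissible? σ p) (λ i → i) (λ j → j) ⟩
    ∑ᶠ (λ i → ∑ᶠ (λ j → 𝟙 (does (isInversion? σ (i , j)) ∧ does (isAdmissible? σ (i , j)))))
      ≡⟨ ∑ᶠ-cong (λ i → ∑ᶠ-cong (λ j → ≡.cong (λ b → 𝟙 (does (isInversion? σ (i , j)) ∧ b)) (≡.cong₂ _∨_
           (does-any? (λ h → next? h i ×-dec (σ ⟨$⟩ʳ h Fin.<? σ ⟨$⟩ʳ i)))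
           (does-any? (λ k → (i Fin.<? k) ×-dec (k Fin.<? j) ×-dec (σ ⟨$⟩ʳ i Fin.<? σ ⟨$⟩ʳ k)))))) ⟩
    ∑ᶠ (λ i → ∑ᶠ (λ j → 𝟙 (does (isInversion? σ (i , j)) ∧ (ascentAt f i ∨ largerInside f i j))))
      ≡⟨ ∑-ai f ⟩
    aiʷ letters ∎
    where open ≡.≡-Reasoning

  letters-bounded : All (ℕ._≤ length (reverse letters)) (reverse letters)
  letters-bounded = ≡.subst (λ m → All (ℕ._≤ m) (reverse letters))
    (≡.sym (≡.trans (List.length-reverse letters) (List.length-tabulate f)))
    (All-resp-↭ (↭-sym (↭-reverse letters)) (All.tabulate⁺ (λ i → Fin.toℕ<n (σ ⟨$⟩ʳ i))))

tabulate-desc : ∀ n → tabulate {n = n} (suc ∘ toℕ) ↭ desc n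
tabulate-desc n = ≡.subst₂ _↭_ (≡.sym (tabulate-applyUpTo suc n)) (List.reverse-applyUpTo suc n)
  (↭-sym (↭-reverse (applyUpTo suc n)))
  where
  tabulate-applyUpTo : ∀ (g : ℕ → ℕ) n → tabulate {n = n} (g ∘ toℕ) ≡ applyUpTo g n
  tabulate-applyUpTo g zero    = ≡.refl
  tabulate-applyUpTo g (suc n) = ≡.cong (g 0 ∷_) (tabulate-applyUpTo (g ∘ suc) n)

theorem6p1 : ∀ {c ℓ} (R : CommutativeRing c ℓ) →
    let open CommutativeRing R
        open SumOver R
    in (q t : Carrier) (n : ℕ) →
       ∑𝔖 n (λ σ → (q ^ aid σ) * (t ^ des σ)) ≈ ∑𝔖 n (λ σ → (q ^ maj σ) * (t ^ exc σ))
theorem6p1 R q t n = begin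
  ∑𝔖 n (λ σ → q ^ aid σ * t ^ des σ)
    ≈⟨ ∑𝔖-cong n (λ σ → trans (rescale (ai σ) (des σ))
         (reflexive (≡.cong₂ (λ i j → q ^ i * (q * t) ^ j) (ai-letters σ) (des-letters σ)))) ⟩
  ∑𝔖 n (weight ∘ word (suc ∘ toℕ))
    ≈⟨ ∑𝔖-word n (suc ∘ toℕ) weight ⟩
  wordSum n (tabulate {n = n} (suc ∘ toℕ)) weight
    ≈⟨ wordSum-↭ n weight (tabulate-desc n) ⟩
  A n
    ≈⟨ A≈M n ⟩
  M n
    ≈⟨ wordSum-↭ n weightʳ (tabulate-desc n) ⟨
  wordSum n (tabulate {n = n} (suc ∘ toℕ)) weightʳ
    -- `weightʳ` reads words backwards, and reversal only permutes the words on a fixed alphabet.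
    ≈⟨ wordSum-reverse n (tabulate (suc ∘ toℕ)) weightʳ ⟨
  wordSum n (tabulate {n = n} (suc ∘ toℕ)) (weightʳ ∘ reverse)
    ≈⟨ ∑𝔖-word n (suc ∘ toℕ) (weightʳ ∘ reverse) ⟨
  ∑𝔖 n (weightʳ ∘ reverse ∘ word (suc ∘ toℕ))
    ≈⟨ ∑𝔖-cong n (λ σ → trans
         (reflexive (≡.cong₂ (λ i j → q ^ i * t ^ j)
           (≡.trans (maj-letters σ) (majʳ-dexʳ _ (letters-bounded σ))) (exc-letters σ)))
         (rescale (dexʳ (reverse (letters σ))) (excʳ (reverse (letters σ))))) ⟨
  ∑𝔖 n (λ σ → q ^ maj σ * t ^ exc σ) ∎
  where
  open CommutativeRing R hiding (zero)
  open SumOver R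
  open WordSums R
  open AdmissibleInversions R q (q * t) using (A; weight)
  open MajorExcedances R q (q * t) using (weightʳ)
  open Equidistribution R q (q * t) using (M; A≈M)
  open import Algebra.Properties.Semiring.Exp semiring using (^-homo-*)
  open import Algebra.Properties.CommutativeSemiring.Exp commutativeSemiring using (^-distrib-*)
  open import Relation.Binary.Reasoning.Setoid setoid

  -- Used with aid = ai + des on one side and with maj = dex + exc on the other: in both, the second
  -- summand is the exponent of t.
  rescale : ∀ i j → q ^ (i ℕ.+ j) * t ^ j ≈ q ^ i * (q * t) ^ j
  rescale i j = begin
    q ^ (i ℕ.+ j) * t ^ j       ≈⟨ *-congʳ (^-homo-* q i j) ⟩
    q ^ i * q ^ j * t ^ j       ≈⟨ *-assoc _ _ _ ⟩
    q ^ i * (q ^ j * t ^ j)     ≈⟨ *-congˡ (^-distrib-* q t j) ⟨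
    q ^ i * (q * t) ^ j         ∎
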